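{- For every $d\ge0$, the $d$-th graded piece $(\operatorname{im}\Psi)_d=\Psi(\mathrm{Mat}_d)\subseteq\mathrm{WQSym}_d$ of the image of $\Psi$ is $$(\operatorname{im}\Psi)_d=\operatorname{span}_{\mathbb R}\{\Psi(N)\ :\ N\text{ is a loopless nested matroid on }[d]\}.$$ Moreover, $\dim\big((\operatorname{im}\Psi)_d\big)\le d!$.
   Context: $[d]=\{1,\dots,d\}$, $[0]=\emptyset$. For a matroid $M$ on $[d]$, $f\colon[d]\to\mathbb R$ and a basis $B$ put $f(B)=\sum_{i\in B}f(i)$; $f$ is $M$-generic if there is a unique basis $B$ of $M$ maximizing $f(B)$. Let $w_1,w_2,\dots$ be non-commuting variables and $w_f=w_{f(1)}\cdots w_{f(d)}$ for $f\colon[d]\to\mathbb Z_{\ge1}$. Then $\Psi(M)=\sum_{f} w_f$, the sum over all $M$-generic $f\colon[d]\to\mathbb Z_{\ge 1}$. The set composition type of $f$ is the ordered partition of $[d]$ into the level sets of $f$, listed by increasing value. $\mathrm{WQSym}_d$ is the real vector space of formal series $\sum_{f:[d]\to\mathbb Z_{\ge1}}c_fw_f$ with $c_f=c_g$ whenever $f,g$ have the same set composition type. $\mathrm{Mat}_d$ is the real vector space with basis all matroids on $[d]$, and $\Psi$ is extended linearly to it. A cyclic flat of a matroid is a flat that is the union of the circuits it contains. A matroid is nested if its cyclic flats form a chain under inclusion. A loop is an element contained in no basis; loopless means having no loops. -}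

module Defs where

open import Level using (Level; 0ℓ; _⊔_) renaming (suc to lsuc)
open import Algebra.Bundles using (CommutativeMonoid; CommutativeRing)
open import Algebra.Module.Bundles using (Module)
open import Algebra.Module.Structures.Biased using (IsModuleFromLeft)
import Algebra.Module.Morphism.Structures as ModuleMorphisms
import Algebra.Construct.Pointwise as PointwiseConstruction
import Algebra.Properties.AbelianGroup as AbelianGroupProperties
import Algebra.Properties.CommutativeSemigroup as CommutativeSemigroupProperties
import Algebra.Properties.Monoid.Sum as MonoidSum
import Algebra.Properties.Ring as RingProperties
open import Data.Bool.Base using (if_then_else_)
open import Data.Fin.Base using (Fin)
open import Data.Fin.Subset using (Subset; _∈_; _∉_; _⊆_; _⊂_; _∪_; _-_; ⁅_⁆; ∣_∣)
open import Data.Fin.Subset.Properties using (anySubset?; nonempty?)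
open import Data.List.Base using (List; filter; map; upTo)
open import Data.Nat.Base as ℕ using (ℕ; suc)
import Data.Nat.Properties as ℕₚ
open import Data.Product.Base using (Σ-syntax; ∃; ∃-syntax; _×_; _,_; proj₁; proj₂)
open import Data.Product using (∃!)
open import Data.Rational.Base as ℚ using (ℚ; 0ℚ; 1ℚ; ½)
import Data.Rational.Properties as ℚₚ
open import Data.Sum.Base using (_⊎_)
open import Data.Vec.Functional using (Vector)
open import Data.Vec.Base as Vec using (Vec)
import Data.Vec.Properties as Vecₚ
import Data.Bool.Properties as Boolₚ
open import Function.Base using (_∘_; flip; case_of_)
open import Function.Properties.Equivalence using (⇔-isEquivalence)
open import Function.Bundles using (_⇔_; mk⇔; module Equivalence)
open import Relation.Binary.Bundles using (Setoid)
open import Relation.Binary.Structures using (IsEquivalence)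
open import Relation.Binary.PropositionalEquality using (_≡_; refl; sym; trans; cong; cong₂; subst)
open import Relation.Nullary using (¬_; Dec; does; ¬?; _×-dec_; _→-dec_)
open import Relation.Nullary.Decidable as Dec using (does-⇔; decidable-stable)
open import Relation.Unary using (Pred; Decidable)

------------------------------------------------------------------------
-- The real numbers: Cauchy sequences of rationals modulo null sequences

IsCauchy : (ℕ → ℚ) → Set
IsCauchy x = ∀ ε → 0ℚ ℚ.< ε →
  ∃[ N ] ∀ m n → N ℕ.≤ m → N ℕ.≤ n → ℚ.∣ x m ℚ.- x n ∣ ℚ.< ε

-- Eta is switched off, and the operations below are defined by copatterns, so
-- that they do not unfold during conversion checking.
record ℝ : Set where
  no-eta-equality
  field
    seq      : ℕ → ℚ
    isCauchy : IsCauchy seq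

open ℝ public

infix 4 _≈ℝ_

record _≈ℝ_ (x y : ℝ) : Set where
  no-eta-equality
  constructor mk≈
  field
    close : ∀ ε → 0ℚ ℚ.< ε →
      ∃[ N ] ∀ n → N ℕ.≤ n → ℚ.∣ seq x n ℚ.- seq y n ∣ ℚ.< ε

open _≈ℝ_ public

private
  open AbelianGroupProperties ℚₚ.+-0-abelianGroup using (⁻¹-anti-homo-//; //-rightDividesˡ; \\-leftDividesʳ)
  open RingProperties ℚₚ.+-*-ring using (x[y-z]≈xy-xz; [y-z]x≈yx-zx)

  telescope : ∀ a b c → (a ℚ.- b) ℚ.+ (b ℚ.- c) ≡ a ℚ.- c
  telescope a b c = trans (ℚₚ.+-assoc a (ℚ.- b) (b ℚ.- c)) (cong (a ℚ.+_) (\\-leftDividesʳ b (ℚ.- c)))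

  +-interchange : ∀ a b c d → (a ℚ.+ c) ℚ.- (b ℚ.+ d) ≡ (a ℚ.- b) ℚ.+ (c ℚ.- d)
  +-interchange a b c d = trans (cong ((a ℚ.+ c) ℚ.+_) (ℚₚ.neg-distrib-+ b d))
      (interchange a c (ℚ.- b) (ℚ.- d))
    where
    open CommutativeSemigroupProperties
      (CommutativeMonoid.commutativeSemigroup ℚₚ.+-0-commutativeMonoid) using (interchange)

  half-pos : ∀ {ε} → 0ℚ ℚ.< ε → 0ℚ ℚ.< ½ ℚ.* ε
  half-pos 0<ε = ℚₚ.*-monoʳ-<-pos ½ 0<ε

  half+half : ∀ ε → ½ ℚ.* ε ℚ.+ ½ ℚ.* ε ≡ ε
  half+half ε = trans (sym (ℚₚ.*-distribʳ-+ ε ½ ½)) (ℚₚ.*-identityˡ ε)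

  add-close : ∀ {ε} a b c d → ℚ.∣ a ℚ.- b ∣ ℚ.< ½ ℚ.* ε → ℚ.∣ c ℚ.- d ∣ ℚ.< ½ ℚ.* ε →
    ℚ.∣ (a ℚ.+ c) ℚ.- (b ℚ.+ d) ∣ ℚ.< ε
  add-close {ε} a b c d p q = begin-strict
    ℚ.∣ (a ℚ.+ c) ℚ.- (b ℚ.+ d) ∣          ≡⟨ cong ℚ.∣_∣ (+-interchange a b c d) ⟩
    ℚ.∣ (a ℚ.- b) ℚ.+ (c ℚ.- d) ∣          ≤⟨ ℚₚ.∣p+q∣≤∣p∣+∣q∣ (a ℚ.- b) (c ℚ.- d) ⟩
    ℚ.∣ a ℚ.- b ∣ ℚ.+ ℚ.∣ c ℚ.- d ∣        <⟨ ℚₚ.+-mono-< p q ⟩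
    ½ ℚ.* ε ℚ.+ ½ ℚ.* ε                    ≡⟨ half+half ε ⟩
    ε                                      ∎
    where open ℚₚ.≤-Reasoning

  neg-close : ∀ {ε} a b → ℚ.∣ a ℚ.- b ∣ ℚ.< ε → ℚ.∣ ℚ.- a ℚ.- ℚ.- b ∣ ℚ.< ε
  neg-close {ε} a b p = subst (ℚ._< ε) (trans (sym (ℚₚ.∣-p∣≡∣p∣ (a ℚ.- b)))
      (cong ℚ.∣_∣ (ℚₚ.neg-distrib-+ a (ℚ.- b)))) p

  swap-close : ∀ {ε} a b → ℚ.∣ a ℚ.- b ∣ ℚ.< ε → ℚ.∣ b ℚ.- a ∣ ℚ.< ε
  swap-close {ε} a b p = subst (ℚ._< ε) (trans (sym (ℚₚ.∣-p∣≡∣p∣ (a ℚ.- b)))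
      (cong ℚ.∣_∣ (⁻¹-anti-homo-// a b))) p

  trans-close : ∀ {ε} a b c → ℚ.∣ a ℚ.- b ∣ ℚ.< ½ ℚ.* ε → ℚ.∣ b ℚ.- c ∣ ℚ.< ½ ℚ.* ε →
    ℚ.∣ a ℚ.- c ∣ ℚ.< ε
  trans-close {ε} a b c p q = begin-strict
    ℚ.∣ a ℚ.- c ∣                          ≡⟨ cong ℚ.∣_∣ (telescope a b c) ⟨
    ℚ.∣ (a ℚ.- b) ℚ.+ (b ℚ.- c) ∣          ≤⟨ ℚₚ.∣p+q∣≤∣p∣+∣q∣ (a ℚ.- b) (b ℚ.- c) ⟩
    ℚ.∣ a ℚ.- b ∣ ℚ.+ ℚ.∣ b ℚ.- c ∣        <⟨ ℚₚ.+-mono-< p q ⟩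
    ½ ℚ.* ε ℚ.+ ½ ℚ.* ε                    ≡⟨ half+half ε ⟩
    ε                                      ∎
    where open ℚₚ.≤-Reasoning

  ≡-close : ∀ {ε} a b → 0ℚ ℚ.< ε → a ≡ b → ℚ.∣ a ℚ.- b ∣ ℚ.< ε
  ≡-close {ε} a .a 0<ε refl = subst (λ r → ℚ.∣ r ∣ ℚ.< ε) (sym (ℚₚ.+-inverseʳ a)) 0<ε

  mul-close : ∀ {ε δ} K a b c d → ℚ.∣ a ∣ ℚ.< K → ℚ.∣ d ∣ ℚ.< K → 0ℚ ℚ.< K →
    K ℚ.* δ ≡ ½ ℚ.* ε → ℚ.∣ a ℚ.- b ∣ ℚ.< δ → ℚ.∣ c ℚ.- d ∣ ℚ.< δ →
    ℚ.∣ a ℚ.* c ℚ.- b ℚ.* d ∣ ℚ.< ε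
  mul-close {ε} {δ} K a b c d a<K d<K 0<K eq p q =
    trans-close (a ℚ.* c) (a ℚ.* d) (b ℚ.* d)
      (subst (ℚ._< ½ ℚ.* ε) (cong ℚ.∣_∣ (x[y-z]≈xy-xz a c d)) (bound a (c ℚ.- d) a<K q))
      (subst (ℚ._< ½ ℚ.* ε)
        (cong ℚ.∣_∣ (trans (ℚₚ.*-comm d (a ℚ.- b)) ([y-z]x≈yx-zx d a b))) (bound d (a ℚ.- b) d<K p))
    where
    open ℚₚ.≤-Reasoning
    bound : ∀ r s → ℚ.∣ r ∣ ℚ.< K → ℚ.∣ s ∣ ℚ.< δ → ℚ.∣ r ℚ.* s ∣ ℚ.< ½ ℚ.* ε
    bound r s r<K s<δ = begin-strict
      ℚ.∣ r ℚ.* s ∣         ≡⟨ ℚₚ.∣p*q∣≡∣p∣*∣q∣ r s ⟩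
      ℚ.∣ r ∣ ℚ.* ℚ.∣ s ∣   ≤⟨ ℚₚ.*-monoʳ-≤-nonNeg ℚ.∣ s ∣ {{ℚₚ.∣-∣-nonNeg s}} (ℚₚ.<⇒≤ r<K) ⟩
      K ℚ.* ℚ.∣ s ∣         <⟨ ℚₚ.*-monoʳ-<-pos K {{ℚ.positive 0<K}} s<δ ⟩
      K ℚ.* δ               ≡⟨ eq ⟩
      ½ ℚ.* ε               ∎

  scale : ∀ K ε → 0ℚ ℚ.< K → 0ℚ ℚ.< ε → ∃[ δ ] 0ℚ ℚ.< δ × K ℚ.* δ ≡ ½ ℚ.* ε
  scale K ε 0<K 0<ε = δ , 0<δ , eq
    where
    instance
      posK : ℚ.Positive K
      posK = ℚ.positive 0<K
      nzK : ℚ.NonZero K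
      nzK = ℚₚ.pos⇒nonZero K
    δ : ℚ
    δ = ℚ.1/ K ℚ.* (½ ℚ.* ε)
    0<δ : 0ℚ ℚ.< δ
    0<δ = ℚₚ.positive⁻¹ δ {{ℚₚ.pos*pos⇒pos (ℚ.1/ K) {{ℚₚ.1/pos⇒pos K}} (½ ℚ.* ε) {{ℚ.positive (half-pos 0<ε)}}}}
    eq : K ℚ.* δ ≡ ½ ℚ.* ε
    eq = trans (sym (ℚₚ.*-assoc K (ℚ.1/ K) (½ ℚ.* ε)))
        (trans (cong (ℚ._* (½ ℚ.* ε)) (ℚₚ.*-inverseʳ K)) (ℚₚ.*-identityˡ (½ ℚ.* ε)))

  bounded : (x : ℝ) → ∃[ K ] 0ℚ ℚ.< K × ∃[ N ] ∀ n → N ℕ.≤ n → ℚ.∣ seq x n ∣ ℚ.< K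
  bounded x =
    let (N , cauchy) = isCauchy x 1ℚ (ℚₚ.positive⁻¹ 1ℚ) in
    1ℚ ℚ.+ ℚ.∣ seq x N ∣ ,
    ℚₚ.+-mono-<-≤ (ℚₚ.positive⁻¹ 1ℚ) (ℚₚ.0≤∣p∣ (seq x N)) ,
    N ,
    λ n N≤n → begin-strict
      ℚ.∣ seq x n ∣                               ≡⟨ cong ℚ.∣_∣ (//-rightDividesˡ (seq x N) (seq x n)) ⟨
      ℚ.∣ (seq x n ℚ.- seq x N) ℚ.+ seq x N ∣     ≤⟨ ℚₚ.∣p+q∣≤∣p∣+∣q∣ (seq x n ℚ.- seq x N) (seq x N) ⟩
      ℚ.∣ seq x n ℚ.- seq x N ∣ ℚ.+ ℚ.∣ seq x N ∣ <⟨ ℚₚ.+-monoˡ-< ℚ.∣ seq x N ∣ (cauchy n N N≤n ℕₚ.≤-refl) ⟩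
      1ℚ ℚ.+ ℚ.∣ seq x N ∣                        ∎
    where open ℚₚ.≤-Reasoning

  bounded₂ : (x y : ℝ) → ∃[ K ] 0ℚ ℚ.< K ×
    ∃[ N ] ∀ n → N ℕ.≤ n → ℚ.∣ seq x n ∣ ℚ.< K × ℚ.∣ seq y n ∣ ℚ.< K
  bounded₂ x y =
    let (K , 0<K , N , p) = bounded x
        (L , 0<L , M , q) = bounded y in
    K ℚ.+ L , ℚₚ.+-mono-< 0<K 0<L , N ℕ.⊔ M , λ n h →
      ℚₚ.<-trans (p n (ℕₚ.m⊔n≤o⇒m≤o N M h))
        (subst (ℚ._< K ℚ.+ L) (ℚₚ.+-identityʳ K) (ℚₚ.+-monoʳ-< K 0<L)) ,
      ℚₚ.<-trans (q n (ℕₚ.m⊔n≤o⇒n≤o N M h))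
        (subst (ℚ._< K ℚ.+ L) (ℚₚ.+-identityˡ L) (ℚₚ.+-monoˡ-< L 0<K))

infixl 6 _+ℝ_
infixl 7 _*ℝ_
infix 8 -ℝ_

fromℚ : ℚ → ℝ
seq (fromℚ q) _ = q
isCauchy (fromℚ q) ε 0<ε = 0 , λ _ _ _ _ → ≡-close q q 0<ε refl

_+ℝ_ : ℝ → ℝ → ℝ
seq (x +ℝ y) n = seq x n ℚ.+ seq y n
isCauchy (x +ℝ y) = cauchy
  where
  cauchy : IsCauchy (λ n → seq x n ℚ.+ seq y n)
  cauchy ε 0<ε =
    let (N , p) = isCauchy x (½ ℚ.* ε) (half-pos 0<ε)
        (M , q) = isCauchy y (½ ℚ.* ε) (half-pos 0<ε) in
    N ℕ.⊔ M , λ m n h k →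
    add-close (seq x m) (seq x n) (seq y m) (seq y n)
      (p m n (ℕₚ.m⊔n≤o⇒m≤o N M h) (ℕₚ.m⊔n≤o⇒m≤o N M k))
      (q m n (ℕₚ.m⊔n≤o⇒n≤o N M h) (ℕₚ.m⊔n≤o⇒n≤o N M k))

_*ℝ_ : ℝ → ℝ → ℝ
seq (x *ℝ y) n = seq x n ℚ.* seq y n
isCauchy (x *ℝ y) = cauchy
  where
  cauchy : IsCauchy (λ n → seq x n ℚ.* seq y n)
  cauchy ε 0<ε =
    let (K , 0<K , L , b) = bounded₂ x y
        (δ , 0<δ , eq)    = scale K ε 0<K 0<ε
        (N , p)           = isCauchy x δ 0<δ
        (M , q)           = isCauchy y δ 0<δ in
    L ℕ.⊔ (N ℕ.⊔ M) , λ m n h k →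
    mul-close K (seq x m) (seq x n) (seq y m) (seq y n)
      (proj₁ (b m (ℕₚ.m⊔n≤o⇒m≤o L _ h)))
      (proj₂ (b n (ℕₚ.m⊔n≤o⇒m≤o L _ k)))
      0<K eq
      (p m n (ℕₚ.m⊔n≤o⇒m≤o N M (ℕₚ.m⊔n≤o⇒n≤o L _ h)) (ℕₚ.m⊔n≤o⇒m≤o N M (ℕₚ.m⊔n≤o⇒n≤o L _ k)))
      (q m n (ℕₚ.m⊔n≤o⇒n≤o N M (ℕₚ.m⊔n≤o⇒n≤o L _ h)) (ℕₚ.m⊔n≤o⇒n≤o N M (ℕₚ.m⊔n≤o⇒n≤o L _ k)))

-ℝ_ : ℝ → ℝ
seq (-ℝ x) n = ℚ.- seq x n
isCauchy (-ℝ x) ε 0<ε =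
  let (N , p) = isCauchy x ε 0<ε in
  N , λ m n h k → neg-close (seq x m) (seq x n) (p m n h k)

0ℝ 1ℝ : ℝ
0ℝ = fromℚ 0ℚ
1ℝ = fromℚ 1ℚ

private
  pointwise : ∀ {x y} → (∀ n → seq x n ≡ seq y n) → x ≈ℝ y
  pointwise {x} {y} eq = mk≈ λ ε 0<ε → 0 , λ n _ → ≡-close (seq x n) (seq y n) 0<ε (eq n)

  ≈-isEquivalence : IsEquivalence _≈ℝ_
  ≈-isEquivalence = record
    { refl  = pointwise λ _ → refl
    ; sym   = λ {x} {y} x≈y → mk≈ λ ε 0<ε → case close x≈y ε 0<ε of λ where
        (N , p) → N , λ n h → swap-close (seq x n) (seq y n) (p n h)
    ; trans = λ {x} {y} {z} x≈y y≈z → mk≈ λ ε 0<ε →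
        case close x≈y (½ ℚ.* ε) (half-pos 0<ε) , close y≈z (½ ℚ.* ε) (half-pos 0<ε) of λ where
          ((N , p) , (M , q)) → N ℕ.⊔ M , λ n h →
            trans-close (seq x n) (seq y n) (seq z n)
              (p n (ℕₚ.m⊔n≤o⇒m≤o N M h)) (q n (ℕₚ.m⊔n≤o⇒n≤o N M h))
    }

  +-cong : ∀ {x y u v} → x ≈ℝ y → u ≈ℝ v → x +ℝ u ≈ℝ y +ℝ v
  +-cong {x} {y} {u} {v} x≈y u≈v = mk≈ λ ε 0<ε →
    case close x≈y (½ ℚ.* ε) (half-pos 0<ε) , close u≈v (½ ℚ.* ε) (half-pos 0<ε) of λ where
      ((N , p) , (M , q)) → N ℕ.⊔ M , λ n h →
        add-close (seq x n) (seq y n) (seq u n) (seq v n)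
          (p n (ℕₚ.m⊔n≤o⇒m≤o N M h)) (q n (ℕₚ.m⊔n≤o⇒n≤o N M h))

  *-cong : ∀ {x y u v} → x ≈ℝ y → u ≈ℝ v → x *ℝ u ≈ℝ y *ℝ v
  *-cong {x} {y} {u} {v} x≈y u≈v = mk≈ prf
    where
    prf : ∀ ε → 0ℚ ℚ.< ε → ∃[ N ] ∀ n → N ℕ.≤ n → ℚ.∣ seq (x *ℝ u) n ℚ.- seq (y *ℝ v) n ∣ ℚ.< ε
    prf ε 0<ε =
      let (K , 0<K , L , b) = bounded₂ x v
          (δ , 0<δ , eq)    = scale K ε 0<K 0<ε
          (N , p)           = close x≈y δ 0<δ
          (M , q)           = close u≈v δ 0<δ in
      L ℕ.⊔ (N ℕ.⊔ M) , λ n h →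
      mul-close K (seq x n) (seq y n) (seq u n) (seq v n)
        (proj₁ (b n (ℕₚ.m⊔n≤o⇒m≤o L _ h))) (proj₂ (b n (ℕₚ.m⊔n≤o⇒m≤o L _ h)))
        0<K eq
        (p n (ℕₚ.m⊔n≤o⇒m≤o N M (ℕₚ.m⊔n≤o⇒n≤o L _ h)))
        (q n (ℕₚ.m⊔n≤o⇒n≤o N M (ℕₚ.m⊔n≤o⇒n≤o L _ h)))

  neg-cong : ∀ {x y} → x ≈ℝ y → -ℝ x ≈ℝ -ℝ y
  neg-cong {x} {y} x≈y = mk≈ λ ε 0<ε → case close x≈y ε 0<ε of λ where
    (N , p) → N , λ n h → neg-close (seq x n) (seq y n) (p n h)

ℝ-commutativeRing : CommutativeRing 0ℓ 0ℓ
ℝ-commutativeRing = record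
  { Carrier = ℝ ; _≈_ = _≈ℝ_ ; _+_ = _+ℝ_ ; _*_ = _*ℝ_ ; -_ = -ℝ_ ; 0# = 0ℝ ; 1# = 1ℝ
  ; isCommutativeRing = record
    { isRing = record
      { +-isAbelianGroup = record
        { isGroup = record
          { isMonoid = record
            { isSemigroup = record
              { isMagma = record { isEquivalence = ≈-isEquivalence ; ∙-cong = +-cong }
              ; assoc = λ x y z → pointwise λ n → ℚₚ.+-assoc (seq x n) (seq y n) (seq z n)
              }
            ; identity = (λ x → pointwise λ n → ℚₚ.+-identityˡ (seq x n))
                       , (λ x → pointwise λ n → ℚₚ.+-identityʳ (seq x n))
            }
          ; inverse = (λ x → pointwise λ n → ℚₚ.+-inverseˡ (seq x n))
                    , (λ x → pointwise λ n → ℚₚ.+-inverseʳ (seq x n))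
          ; ⁻¹-cong = neg-cong
          }
        ; comm = λ x y → pointwise λ n → ℚₚ.+-comm (seq x n) (seq y n)
        }
      ; *-cong = *-cong
      ; *-assoc = λ x y z → pointwise λ n → ℚₚ.*-assoc (seq x n) (seq y n) (seq z n)
      ; *-identity = (λ x → pointwise λ n → ℚₚ.*-identityˡ (seq x n))
                   , (λ x → pointwise λ n → ℚₚ.*-identityʳ (seq x n))
      ; distrib = (λ x y z → pointwise λ n → ℚₚ.*-distribˡ-+ (seq x n) (seq y n) (seq z n))
                , (λ x y z → pointwise λ n → ℚₚ.*-distribʳ-+ (seq x n) (seq y n) (seq z n))
      }
    ; *-comm = λ x y → pointwise λ n → ℚₚ.*-comm (seq x n) (seq y n)
    }
  }

ℝ-VectorSpace : (m ℓ : Level) → Set (lsuc (m ⊔ ℓ))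
ℝ-VectorSpace m ℓ = Module ℝ-commutativeRing m ℓ

------------------------------------------------------------------------
-- Spans, bases and dimension

private
  variable
    m ℓ p s ℓs : Level

module LinearAlgebra (V : ℝ-VectorSpace m ℓ) where
  open Module V

  linearCombination : ∀ {n} → Vector ℝ n → Vector Carrierᴹ n → Carrierᴹ
  linearCombination c v = MonoidSum.sum +ᴹ-monoid (λ i → c i *ₗ v i)

  span : Pred Carrierᴹ p → Pred Carrierᴹ (m ⊔ ℓ ⊔ p)
  span S v = ∃[ n ] Σ[ c ∈ Vector ℝ n ] Σ[ u ∈ Vector Carrierᴹ n ]
    (∀ i → S (u i)) × v ≈ᴹ linearCombination c u

  LinearlyIndependent : ∀ {n} → Vector Carrierᴹ n → Set ℓ
  LinearlyIndependent v =
    ∀ c → linearCombination c v ≈ᴹ 0ᴹ → ∀ i → c i ≈ℝ 0ℝ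

  record IsBasisOf (W : Pred Carrierᴹ p) {n : ℕ} (b : Vector Carrierᴹ n) : Set (m ⊔ ℓ ⊔ p) where
    field
      members     : ∀ i → W (b i)
      independent : LinearlyIndependent b
      spanning    : ∀ {w} → W w → Σ[ c ∈ Vector ℝ n ] w ≈ᴹ linearCombination c b

  -- Witnessed by a basis with n elements.
  HasDimension : Pred Carrierᴹ p → ℕ → Set (m ⊔ ℓ ⊔ p)
  HasDimension W n = Σ[ b ∈ Vector Carrierᴹ n ] IsBasisOf W b

------------------------------------------------------------------------
-- The real vector space with a given set as basis: formal linear
-- combinations modulo the congruence generated by the vector space axioms

module Free (S : Setoid s ℓs) where
  private module S = Setoid S

  infixl 6 _⊕_
  infixr 7 _⊙_
  infix 4 _∼_

  data Term : Set s where
    gen : S.Carrier → Term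
    𝟎   : Term
    _⊕_ : Term → Term → Term
    _⊙_ : ℝ → Term → Term

  data _∼_ : Term → Term → Set (s ⊔ ℓs) where
    ∼-refl      : ∀ {x} → x ∼ x
    ∼-sym       : ∀ {x y} → x ∼ y → y ∼ x
    ∼-trans     : ∀ {x y z} → x ∼ y → y ∼ z → x ∼ z
    gen-cong    : ∀ {a b} → a S.≈ b → gen a ∼ gen b
    ⊕-cong      : ∀ {x x′ y y′} → x ∼ x′ → y ∼ y′ → x ⊕ y ∼ x′ ⊕ y′
    ⊕-assoc     : ∀ x y z → (x ⊕ y) ⊕ z ∼ x ⊕ (y ⊕ z)
    ⊕-comm      : ∀ x y → x ⊕ y ∼ y ⊕ x
    ⊕-identityˡ : ∀ x → 𝟎 ⊕ x ∼ x
    ⊙-cong      : ∀ {c c′ x x′} → c ≈ℝ c′ → x ∼ x′ → c ⊙ x ∼ c′ ⊙ x′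
    ⊙-zeroˡ     : ∀ x → 0ℝ ⊙ x ∼ 𝟎
    ⊙-zeroʳ     : ∀ c → c ⊙ 𝟎 ∼ 𝟎
    ⊙-identityˡ : ∀ x → 1ℝ ⊙ x ∼ x
    ⊙-assoc     : ∀ c c′ x → (c *ℝ c′) ⊙ x ∼ c ⊙ c′ ⊙ x
    ⊙-distribˡ  : ∀ c x y → c ⊙ (x ⊕ y) ∼ c ⊙ x ⊕ c ⊙ y
    ⊙-distribʳ  : ∀ x c c′ → (c +ℝ c′) ⊙ x ∼ c ⊙ x ⊕ c′ ⊙ x

  neg : Term → Term
  neg x = (-ℝ 1ℝ) ⊙ x

  private
    neg-inverseˡ : ∀ x → neg x ⊕ x ∼ 𝟎
    neg-inverseˡ x = ∼-trans (⊕-cong ∼-refl (∼-sym (⊙-identityˡ x)))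
      (∼-trans (∼-sym (⊙-distribʳ x (-ℝ 1ℝ) 1ℝ))
      (∼-trans (⊙-cong (CommutativeRing.-‿inverseˡ ℝ-commutativeRing 1ℝ) ∼-refl) (⊙-zeroˡ x)))

  vectorSpace : ℝ-VectorSpace s (s ⊔ ℓs)
  vectorSpace = record
    { Carrierᴹ = Term ; _≈ᴹ_ = _∼_ ; _+ᴹ_ = _⊕_ ; _*ₗ_ = _⊙_ ; _*ᵣ_ = flip _⊙_ ; 0ᴹ = 𝟎 ; -ᴹ_ = neg
    ; isModule = IsModuleFromLeft.isModule {commutativeRing = ℝ-commutativeRing} record
      { isLeftModule = record
        { isLeftSemimodule = record
          { +ᴹ-isCommutativeMonoid = record
            { isMonoid = record
              { isSemigroup = record
                { isMagma = record
                  { isEquivalence = record { refl = ∼-refl ; sym = ∼-sym ; trans = ∼-trans }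
                  ; ∙-cong = ⊕-cong
                  }
                ; assoc = ⊕-assoc
                }
              ; identity = ⊕-identityˡ , λ x → ∼-trans (⊕-comm x 𝟎) (⊕-identityˡ x)
              }
            ; comm = ⊕-comm
            }
          ; isPreleftSemimodule = record
            { *ₗ-cong = ⊙-cong
            ; *ₗ-zeroˡ = ⊙-zeroˡ
            ; *ₗ-distribʳ = ⊙-distribʳ
            ; *ₗ-identityˡ = ⊙-identityˡ
            ; *ₗ-assoc = ⊙-assoc
            ; *ₗ-zeroʳ = ⊙-zeroʳ
            ; *ₗ-distribˡ = ⊙-distribˡ
            }
          }
        ; -ᴹ‿cong = ⊙-cong (CommutativeRing.refl ℝ-commutativeRing)
        ; -ᴹ‿inverse = neg-inverseˡ , λ x → ∼-trans (⊕-comm x (neg x)) (neg-inverseˡ x)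
        }
      }
    }

  module Extension (V : ℝ-VectorSpace m ℓ) (φ : S.Carrier → Module.Carrierᴹ V) where
    open Module V

    extend : Term → Carrierᴹ
    extend (gen a) = φ a
    extend 𝟎       = 0ᴹ
    extend (x ⊕ y) = extend x +ᴹ extend y
    extend (c ⊙ x) = c *ₗ extend x

    module _ (φ-cong : ∀ {a b} → a S.≈ b → φ a ≈ᴹ φ b) where

      extend-cong : ∀ {x y} → x ∼ y → extend x ≈ᴹ extend y
      extend-cong ∼-refl               = ≈ᴹ-refl
      extend-cong (∼-sym p)            = ≈ᴹ-sym (extend-cong p)
      extend-cong (∼-trans p q)        = ≈ᴹ-trans (extend-cong p) (extend-cong q)
      extend-cong (gen-cong p)         = φ-cong p
      extend-cong (⊕-cong p q)         = +ᴹ-cong (extend-cong p) (extend-cong q)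
      extend-cong (⊕-assoc x y z)      = +ᴹ-assoc _ _ _
      extend-cong (⊕-comm x y)         = +ᴹ-comm _ _
      extend-cong (⊕-identityˡ x)      = +ᴹ-identityˡ _
      extend-cong (⊙-cong p q)         = *ₗ-cong p (extend-cong q)
      extend-cong (⊙-zeroˡ x)          = *ₗ-zeroˡ _
      extend-cong (⊙-zeroʳ c)          = *ₗ-zeroʳ _
      extend-cong (⊙-identityˡ x)      = *ₗ-identityˡ _
      extend-cong (⊙-assoc c c′ x)     = *ₗ-assoc _ _ _
      extend-cong (⊙-distribˡ c x y)   = *ₗ-distribˡ _ _ _
      extend-cong (⊙-distribʳ x c c′)  = *ₗ-distribʳ _ _ _

      extend-isLinear :
        ModuleMorphisms.LeftModuleMorphisms.IsLeftModuleHomomorphism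
          (Module.rawLeftModule vectorSpace) (Module.rawLeftModule V) extend
      extend-isLinear = record
        { +ᴹ-isGroupHomomorphism = record
          { isMonoidHomomorphism = record
            { isMagmaHomomorphism = record
              { isRelHomomorphism = record { cong = extend-cong }
              ; homo = λ _ _ → ≈ᴹ-refl
              }
            ; ε-homo = ≈ᴹ-refl
            }
          ; ⁻¹-homo = λ x → uniqueʳ‿-ᴹ _ _ (≈ᴹ-trans
              (+ᴹ-congʳ (≈ᴹ-sym (*ₗ-identityˡ (extend x))))
              (≈ᴹ-trans (≈ᴹ-sym (*ₗ-distribʳ (extend x) 1ℝ (-ℝ 1ℝ)))
              (≈ᴹ-trans (*ₗ-congʳ (CommutativeRing.-‿inverseʳ ℝ-commutativeRing 1ℝ))
                (*ₗ-zeroˡ (extend x)))))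
          }
        ; *ₗ-homo = λ _ _ → ≈ᴹ-refl
        }

------------------------------------------------------------------------
-- Matroids on [d]

private
  variable
    d : ℕ

-- Basis exchange axioms.  Decidability of the basis predicate is what makes the
-- 0/1 coefficients of Ψ(M) definable; classically it is no restriction.
record Matroid (d : ℕ) : Set₁ where
  field
    IsBasis  : Pred (Subset d) 0ℓ
    isBasis? : Decidable IsBasis
    nonempty : ∃ IsBasis
    exchange : ∀ {A B} → IsBasis A → IsBasis B → ∀ {x} → x ∈ A → x ∉ B →
      ∃[ y ] y ∈ B × y ∉ A × IsBasis ((A - x) ∪ ⁅ y ⁆)

open Matroid public

private module ⇔ {a} = IsEquivalence (⇔-isEquivalence {a})

infix 4 _≈ᴹᵃᵗ_

_≈ᴹᵃᵗ_ : Matroid d → Matroid d → Set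
M ≈ᴹᵃᵗ N = ∀ B → IsBasis M B ⇔ IsBasis N B

matroidSetoid : ℕ → Setoid (lsuc 0ℓ) 0ℓ
matroidSetoid d = record
  { Carrier = Matroid d
  ; _≈_     = _≈ᴹᵃᵗ_
  ; isEquivalence = record
    { refl  = λ B → ⇔.refl
    ; sym   = λ p B → ⇔.sym (p B)
    ; trans = λ p q B → ⇔.trans (p B) (q B)
    }
  }

module _ (M : Matroid d) where

  Independent : Pred (Subset d) 0ℓ
  Independent I = ∃[ B ] IsBasis M B × I ⊆ B

  Circuit : Pred (Subset d) 0ℓ
  Circuit C = ¬ Independent C × (∀ {I} → I ⊂ C → Independent I)

  HasRank : Subset d → ℕ → Set
  HasRank S r =
    (∃[ I ] Independent I × I ⊆ S × ∣ I ∣ ≡ r) ×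
    (∀ {I} → Independent I → I ⊆ S → ∣ I ∣ ℕ.≤ r)

  -- Adding any outside element raises the rank, i.e. F equals its closure.
  Flat : Pred (Subset d) 0ℓ
  Flat F = ∀ {x r} → x ∉ F → HasRank F r → ¬ HasRank (F ∪ ⁅ x ⁆) r

  Cyclic : Pred (Subset d) 0ℓ
  Cyclic F = ∀ x → x ∈ F ⇔ (∃[ C ] Circuit C × C ⊆ F × x ∈ C)

  CyclicFlat : Pred (Subset d) 0ℓ
  CyclicFlat F = Flat F × Cyclic F

  Nested : Set
  Nested = ∀ {F G} → CyclicFlat F → CyclicFlat G → F ⊆ G ⊎ G ⊆ F

  Loop : Pred (Fin d) 0ℓ
  Loop x = ∀ {B} → IsBasis M B → x ∉ B

  Loopless : Set
  Loopless = ∀ x → ¬ Loop x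

------------------------------------------------------------------------
-- Formal series and set compositions

ℤ≥1 : Set
ℤ≥1 = ∃ ℕ.NonZero

-- A map f : [d] → ℤ≥1 is given by its vector of values, that is, by the
-- word indexing the monomial w_f in the non-commuting variables.
Word : ℕ → Set
Word d = Vec ℤ≥1 d

-- The series Σ_f c_f w_f is given by its coefficients f ↦ c_f.
FormalSeries : ℕ → ℝ-VectorSpace 0ℓ 0ℓ
FormalSeries d = record
  { Carrierᴹ = Word d → ℝ
  ; _≈ᴹ_ = λ a b → ∀ f → a f ≈ℝ b f
  ; _+ᴹ_ = λ a b f → a f +ℝ b f
  ; _*ₗ_ = λ c a f → c *ℝ a f
  ; _*ᵣ_ = λ a c f → c *ℝ a f
  ; 0ᴹ = λ _ → 0ℝ
  ; -ᴹ_ = λ a f → -ℝ a f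
  ; isModule = IsModuleFromLeft.isModule {commutativeRing = ℝ-commutativeRing} record
    { isLeftModule = record
      { isLeftSemimodule = record
        { +ᴹ-isCommutativeMonoid = Pointwise.isCommutativeMonoid +-isCommutativeMonoid
        ; isPreleftSemimodule = record
          { *ₗ-cong = λ p q f → *-cong p (q f)
          ; *ₗ-zeroˡ = λ a f → zeroˡ (a f)
          ; *ₗ-distribʳ = λ a c c′ f → distribʳ (a f) c c′
          ; *ₗ-identityˡ = λ a f → *-identityˡ (a f)
          ; *ₗ-assoc = λ c c′ a f → *-assoc c c′ (a f)
          ; *ₗ-zeroʳ = λ c f → zeroʳ c
          ; *ₗ-distribˡ = λ c a b f → distribˡ c (a f) (b f)
          }
        }
      ; -ᴹ‿cong = λ p f → -‿cong (p f)
      ; -ᴹ‿inverse = (λ a f → -‿inverseˡ (a f)) , (λ a f → -‿inverseʳ (a f))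
      }
    }
  }
  where
  open CommutativeRing ℝ-commutativeRing hiding (*-cong)
  module Pointwise = PointwiseConstruction (Word d)

levelSet : Word d → ℕ → Subset d
levelSet f v = Vec.map (λ a → does (proj₁ a ℕₚ.≟ v)) f

maxValue : Word d → ℕ
maxValue = Vec.foldr′ (λ a v → proj₁ a ℕ.⊔ v) 0

-- The nonempty level sets of f, listed by increasing value.
setComposition : Word d → List (Subset d)
setComposition f = filter nonempty? (map (levelSet f) (upTo (suc (maxValue f))))

WQSym : (d : ℕ) → Pred (Module.Carrierᴹ (FormalSeries d)) 0ℓ
WQSym d c = ∀ f g → setComposition f ≡ setComposition g → c f ≈ℝ c g

------------------------------------------------------------------------
-- The map Ψ

weight : Word d → Subset d → ℕ
weight f B = Vec.sum (Vec.zipWith (λ a b → if b then proj₁ a else 0) f B)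

Maximizing : Matroid d → Word d → Pred (Subset d) 0ℓ
Maximizing M f B = IsBasis M B × (∀ B′ → IsBasis M B′ → weight f B′ ℕ.≤ weight f B)

Generic : Matroid d → Pred (Word d) 0ℓ
Generic M f = ∃! _≡_ (Maximizing M f)

private
  allSubsets? : {P : Pred (Subset d) ℓ} → Decidable P → Dec (∀ S → P S)
  allSubsets? P? = Dec.map′
    (λ ¬∃¬P S → decidable-stable (P? S) (λ ¬PS → ¬∃¬P (S , ¬PS)))
    (λ ∀P (S , ¬PS) → ¬PS (∀P S))
    (¬? (anySubset? (¬? ∘ P?)))

maximizing? : (M : Matroid d) (f : Word d) → Decidable (Maximizing M f)
maximizing? M f B = isBasis? M B ×-dec
  allSubsets? (λ B′ → isBasis? M B′ →-dec weight f B′ ℕₚ.≤? weight f B)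

generic? : (M : Matroid d) → Decidable (Generic M)
generic? M f = Dec.map′
  (λ (B , max , unique) → B , max , λ {B′} → unique B′)
  (λ (B , max , unique) → B , max , λ B′ → unique)
  (anySubset? (λ B → maximizing? M f B ×-dec
    allSubsets? (λ B′ → maximizing? M f B′ →-dec Vecₚ.≡-dec Boolₚ._≟_ B B′)))

-- Ψ on basis elements: the sum of w_f over all M-generic f.
genericSeries : Matroid d → Module.Carrierᴹ (FormalSeries d)
genericSeries M f = if does (generic? M f) then 1ℝ else 0ℝ

private
  maximizing-resp : (M N : Matroid d) → M ≈ᴹᵃᵗ N → ∀ f {B} → Maximizing M f B → Maximizing N f B
  maximizing-resp M N M≈N f {B} (basis , max) =
    Equivalence.to (M≈N B) basis , λ B′ basis′ → max B′ (Equivalence.from (M≈N B′) basis′)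

  generic-resp : (M N : Matroid d) → M ≈ᴹᵃᵗ N → ∀ f → Generic M f → Generic N f
  generic-resp M N M≈N f (B , max , unique) =
    B , maximizing-resp M N M≈N f max , λ max′ → unique (maximizing-resp N M N≈M f max′)
    where N≈M = λ C → ⇔.sym (M≈N C)

genericSeries-cong : (M N : Matroid d) → M ≈ᴹᵃᵗ N → ∀ f → genericSeries M f ≈ℝ genericSeries N f
genericSeries-cong M N M≈N f =
  CommutativeRing.reflexive ℝ-commutativeRing (cong (if_then 1ℝ else 0ℝ)
    (does-⇔ (mk⇔ (generic-resp M N M≈N f) (generic-resp N M (λ B → ⇔.sym (M≈N B)) f))
      (generic? M f) (generic? N f)))

-- Formal real combinations of matroids, two matroids with the same bases being
-- identified.
Mat : (d : ℕ) → ℝ-VectorSpace (lsuc 0ℓ) (lsuc 0ℓ)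
Mat d = Free.vectorSpace (matroidSetoid d)

Ψ : Module.Carrierᴹ (Mat d) → Module.Carrierᴹ (FormalSeries d)
Ψ {d} = Free.Extension.extend (matroidSetoid d) (FormalSeries d) genericSeries

Ψ-isLinear : ModuleMorphisms.LeftModuleMorphisms.IsLeftModuleHomomorphism
  (Module.rawLeftModule (Mat d)) (Module.rawLeftModule (FormalSeries d)) Ψ
Ψ-isLinear {d} = Free.Extension.extend-isLinear (matroidSetoid d) (FormalSeries d)
  genericSeries (λ {M} {N} → genericSeries-cong M N)

⟪_⟫ : Matroid d → Module.Carrierᴹ (Mat d)
⟪ M ⟫ = Free.gen M

imΨ : (d : ℕ) → Pred (Module.Carrierᴹ (FormalSeries d)) (lsuc 0ℓ)
imΨ d c = ∃[ x ] Module._≈ᴹ_ (FormalSeries d) c (Ψ {d} x)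

LooplessNestedSeries : (d : ℕ) → Pred (Module.Carrierᴹ (FormalSeries d)) (lsuc 0ℓ)
LooplessNestedSeries d c = ∃[ N ] Loopless N × Nested N × Module._≈ᴹ_ (FormalSeries d) c (Ψ ⟪ N ⟫)

{-# OPTIONS --safe #-}
-- Let r be the rank function of M.  A set B is the unique basis maximizing f
-- exactly when r(T) = ∣ B ∩ T ∣ for every upper set T of the order that refines f
-- by ranking B last within each level set of f.  So the coefficients of Ψ(M) are
-- integer combinations, the same for all M, of the indicators of systems
-- r(Tᵢ) ≥ bᵢ in which the Tᵢ form a chain.
--
-- For a chain C = (Y₁ ⊂ … ⊂ Yₖ = [d]), the sets I with ∣ I ∩ Y ∣ ≤ r(Y) for all Y
-- in C are the independent sets of a nested matroid N_C, whose rank function is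
-- T ↦ min over Y in C ∪ {∅} of r(Y) + ∣ T ─ Y ∣.  Hence the indicator of
-- r_{N_C}(Tᵢ) ≥ bᵢ is a product over the elements of C ∪ {∅}.  Its alternating sum
-- over all C cancels in pairs (Y , Y ∪ {x}), where x runs through [d] in an order
-- compatible with the Tᵢ, and what remains is ± the indicator for M.  Therefore
-- Ψ(M) is a signed sum of the Ψ(N_C).
--
-- Replacing the loops of M by coloops does not change Ψ(M) and makes the N_C
-- loopless.  After deleting redundant constraints from the chains there are d!
-- of them, and Gaussian elimination over ℚ extracts a basis.
module Submission where

open import Defs
open import Algebra.Bundles using (CommutativeMonoid; CommutativeRing)
open import Algebra.Module.Bundles using (Module)
import Algebra.Properties.CommutativeSemigroup as CommutativeSemigroupProperties
open import Data.Bool.Base using (T; true; false; if_then_else_)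
import Data.Bool.Properties as Boolₚ
open import Data.Empty using (⊥-elim)
open import Data.Fin.Base using (Fin; zero; suc)
open import Data.Fin.Properties using (any?; all?)
open import Data.Fin.Subset
  using (Subset; ⊥; ⊤; ⁅_⁆; _∈_; _∉_; _∩_; _∪_; _─_; _-_; ∣_∣; ∁)
  renaming (_⊆_ to _⊑_; _⊂_ to _⊏_)
open import Data.Fin.Subset.Properties
open import Data.List.Base as List using (List; []; _∷_)
open import Data.List.Membership.Propositional using () renaming (_∈_ to _∈ₗ_)
open import Data.List.Membership.Propositional.Properties
  using (∈-filter⁺; ∈-map⁺; ∈-upTo⁺; ∈-upTo⁻; ∈-cartesianProductWith⁺; ∈-++⁺ˡ; ∈-++⁺ʳ; ∈-concatMap⁺; ∈-lookup)
import Data.List.Properties as Listₚ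
open import Data.List.Relation.Unary.All as All using (All; []; _∷_)
import Data.List.Relation.Unary.All.Properties as Allₚ
open import Data.List.Relation.Unary.AllPairs using (AllPairs; []; _∷_)
import Data.List.Relation.Unary.AllPairs.Properties as AllPairsₚ
open import Data.List.Relation.Unary.Any as Any using (Any)
open import Data.Nat.Base hiding (∣_-_∣)
open import Data.Nat.Properties
open import Data.Product.Base using (Σ-syntax; ∃; ∃-syntax; _×_; _,_; proj₁; proj₂)
open import Data.Rational.Base as ℚ using (ℚ; 0ℚ; 1ℚ)
import Data.Rational.Properties as ℚₚ
open import Data.Rational.Solver using (module +-*-Solver)
open import Data.Sum.Base using (_⊎_; inj₁; inj₂; [_,_]′)
import Data.Unit.Base as Unit
open import Data.Vec.Base as Vec using ([]; _∷_; here; there)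
open import Data.Vec.Functional using (Vector)
open import Data.Vec.Properties as Vecₚ using (lookup∘tabulate; lookup⇒[]=; []=⇒lookup)
open import Function.Base using (_∘_; id; case_of_)
open import Function.Bundles using (_⇔_; mk⇔; module Equivalence)
open import Level using (0ℓ)
open import Relation.Binary.Definitions using (tri<; tri≈; tri>)
open import Relation.Binary.PropositionalEquality hiding (J)
open import Relation.Nullary using (¬_; Dec; yes; no; does; contradiction; ¬?; _×-dec_; _→-dec_)
open import Relation.Nullary.Decidable as Dec using (dec-true; dec-false; decidable-stable; does-⇔)
open import Relation.Unary using (_⊆_; _≐_; Pred; Decidable)

open +-*-Solver using (solve; _:=_; _:+_; _:*_; _:-_; :-_; con)

-- The tie-breaking turns uniqueness into a statement about ranks: with `B` last inside each level
-- set, a basis that ties with `B` for `f` beats it strictly in the refined order. Lower bounds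
-- replace equalities because a minimum is at least `b` exactly when each of its terms is. That
-- makes the indicator multiplicative along a chain; an equality does not factor this way. The
-- pairing needs the system at `Y ∪ {x}` to imply the system at `Y`. An upper set containing `x`
-- gains an element outside `Y` when `x` leaves, which pays for the possible loss of rank. An upper
-- set avoiding `x` gets no such compensation, so its bound must already hold for `M`. Hence
-- elements are treated by descending value, and a bound that fails makes both sides vanish as soon
-- as it is met. Each of the `d` elements contributes a factor -1, the origin of the overall sign. A
-- basis has to be exhibited, yet equality of reals is not decidable. The spanning series have
-- coefficients 0 and 1 and depend only on the order type of a word, so pivots can be sought over
-- the rationals among the finitely many words with values in {1, ..., d}.

private
  variable
    d : ℕ
    X Y Z I J : Subset d

-- Finite sets

∣p∣≡∣p∩q∣+∣p─q∣ : (p q : Subset d) → ∣ p ∣ ≡ ∣ p ∩ q ∣ + ∣ p ─ q ∣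
∣p∣≡∣p∩q∣+∣p─q∣ [] [] = refl
∣p∣≡∣p∩q∣+∣p─q∣ (true ∷ p) (true ∷ q) = cong suc (∣p∣≡∣p∩q∣+∣p─q∣ p q)
∣p∣≡∣p∩q∣+∣p─q∣ (true ∷ p) (false ∷ q) = trans (cong suc (∣p∣≡∣p∩q∣+∣p─q∣ p q)) (sym (+-suc _ _))
∣p∣≡∣p∩q∣+∣p─q∣ (false ∷ p) (true ∷ q) = ∣p∣≡∣p∩q∣+∣p─q∣ p q
∣p∣≡∣p∩q∣+∣p─q∣ (false ∷ p) (false ∷ q) = ∣p∣≡∣p∩q∣+∣p─q∣ p q

∣p∪q∣+∣p∩q∣≡∣p∣+∣q∣ : (p q : Subset d) → ∣ p ∪ q ∣ + ∣ p ∩ q ∣ ≡ ∣ p ∣ + ∣ q ∣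
∣p∪q∣+∣p∩q∣≡∣p∣+∣q∣ [] [] = refl
∣p∪q∣+∣p∩q∣≡∣p∣+∣q∣ (true ∷ p) (true ∷ q) =
  cong suc (trans (+-suc _ _) (trans (cong suc (∣p∪q∣+∣p∩q∣≡∣p∣+∣q∣ p q)) (sym (+-suc _ _))))
∣p∪q∣+∣p∩q∣≡∣p∣+∣q∣ (true ∷ p) (false ∷ q) = cong suc (∣p∪q∣+∣p∩q∣≡∣p∣+∣q∣ p q)
∣p∪q∣+∣p∩q∣≡∣p∣+∣q∣ (false ∷ p) (true ∷ q) =
  trans (cong suc (∣p∪q∣+∣p∩q∣≡∣p∣+∣q∣ p q)) (sym (+-suc _ _))
∣p∪q∣+∣p∩q∣≡∣p∣+∣q∣ (false ∷ p) (false ∷ q) = ∣p∪q∣+∣p∩q∣≡∣p∣+∣q∣ p q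

x∈p─q⁻ : ∀ {x} (p q : Subset d) → x ∈ p ─ q → x ∈ p × x ∉ q
x∈p─q⁻ p q x∈p─q = p─q⊆p p q x∈p─q , λ x∈q → disjoint p q x∈p─q x∈q
  where
  disjoint : ∀ {d} {x : Fin d} p q → x ∈ p ─ q → x ∉ q
  disjoint (_ ∷ p) (false ∷ q) here ()
  disjoint (_ ∷ p) (_ ∷ q) (there i) (there j) = disjoint p q i j

p⊑q⇒p∩q≡p : {p q : Subset d} → p ⊑ q → p ∩ q ≡ p
p⊑q⇒p∩q≡p {p = p} {q} p⊑q =
  ⊆-antisym (p∩q⊆p p q) (λ x∈p → x∈p∩q⁺ (x∈p , p⊑q x∈p))

∩-monoˡ-⊑ : {p q : Subset d} (s : Subset d) → p ⊑ q → p ∩ s ⊑ q ∩ s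
∩-monoˡ-⊑ {p = p} s p⊑q x∈ = let (x∈p , x∈s) = x∈p∩q⁻ p s x∈ in x∈p∩q⁺ (p⊑q x∈p , x∈s)

∩-monoʳ-⊑ : {p q : Subset d} (s : Subset d) → p ⊑ q → s ∩ p ⊑ s ∩ q
∩-monoʳ-⊑ {p = p} s p⊑q x∈ = let (x∈s , x∈p) = x∈p∩q⁻ s p x∈ in x∈p∩q⁺ (x∈s , p⊑q x∈p)

─-monoˡ-⊑ : {p q : Subset d} (s : Subset d) → p ⊑ q → p ─ s ⊑ q ─ s
─-monoˡ-⊑ {p = p} s p⊑q x∈ = let (x∈p , x∉s) = x∈p─q⁻ p s x∈ in x∈p∧x∉q⇒x∈p─q (p⊑q x∈p) x∉s

p∪⁅x⁆⊑q : {p q : Subset d} {x : Fin d} → p ⊑ q → x ∈ q → p ∪ ⁅ x ⁆ ⊑ q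
p∪⁅x⁆⊑q {p = p} {x = x} p⊑q x∈q y∈ with x∈p∪q⁻ p ⁅ x ⁆ y∈
... | inj₁ y∈p = p⊑q y∈p
... | inj₂ y∈x rewrite x∈⁅y⁆⇒x≡y x y∈x = x∈q

x∈p∪⁅x⁆ : (p : Subset d) (x : Fin d) → x ∈ p ∪ ⁅ x ⁆
x∈p∪⁅x⁆ p x = q⊆p∪q p ⁅ x ⁆ (x∈⁅x⁆ x)

∣p∪⁅x⁆∣≡1+∣p∣ : {p : Subset d} {x : Fin d} → x ∉ p → ∣ p ∪ ⁅ x ⁆ ∣ ≡ suc ∣ p ∣
∣p∪⁅x⁆∣≡1+∣p∣ {d} {p} {x} x∉p = begin
  ∣ p ∪ ⁅ x ⁆ ∣                         ≡⟨ +-identityʳ _ ⟨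
  ∣ p ∪ ⁅ x ⁆ ∣ + 0                     ≡⟨ cong (∣ p ∪ ⁅ x ⁆ ∣ +_) (trans (cong ∣_∣ empty) (∣⊥∣≡0 d)) ⟨
  ∣ p ∪ ⁅ x ⁆ ∣ + ∣ p ∩ ⁅ x ⁆ ∣         ≡⟨ ∣p∪q∣+∣p∩q∣≡∣p∣+∣q∣ p ⁅ x ⁆ ⟩
  ∣ p ∣ + ∣ ⁅ x ⁆ ∣                     ≡⟨ cong (∣ p ∣ +_) (∣⁅x⁆∣≡1 x) ⟩
  ∣ p ∣ + 1                             ≡⟨ +-comm ∣ p ∣ 1 ⟩
  suc ∣ p ∣                             ∎
  where
  open ≡-Reasoning
  empty : p ∩ ⁅ x ⁆ ≡ ⊥
  empty = Empty-unique λ (y , y∈) → let (y∈p , y∈x) = x∈p∩q⁻ p ⁅ x ⁆ y∈ in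
    x∉p (subst (_∈ p) (x∈⁅y⁆⇒x≡y x y∈x) y∈p)

∣p∪⁅x⁆∣≤1+∣p∣ : (p : Subset d) (x : Fin d) → ∣ p ∪ ⁅ x ⁆ ∣ ≤ suc ∣ p ∣
∣p∪⁅x⁆∣≤1+∣p∣ p x = begin
  ∣ p ∪ ⁅ x ⁆ ∣                   ≤⟨ m≤m+n _ _ ⟩
  ∣ p ∪ ⁅ x ⁆ ∣ + ∣ p ∩ ⁅ x ⁆ ∣   ≡⟨ ∣p∪q∣+∣p∩q∣≡∣p∣+∣q∣ p ⁅ x ⁆ ⟩
  ∣ p ∣ + ∣ ⁅ x ⁆ ∣               ≡⟨ cong (∣ p ∣ +_) (∣⁅x⁆∣≡1 x) ⟩
  ∣ p ∣ + 1                       ≡⟨ +-comm ∣ p ∣ 1 ⟩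
  suc ∣ p ∣                       ∎
  where open ≤-Reasoning

p-x∪⁅x⁆≡p : {p : Subset d} {x : Fin d} → x ∈ p → (p - x) ∪ ⁅ x ⁆ ≡ p
p-x∪⁅x⁆≡p {p = p} {x} x∈p = ⊆-antisym (p∪⁅x⁆⊑q (p─q⊆p p ⁅ x ⁆) x∈p) λ {y} y∈p →
  case y ∈? ⁅ x ⁆ of λ where
    (yes y∈x) → q⊆p∪q (p - x) ⁅ x ⁆ y∈x
    (no y∉x) → p⊆p∪q ⁅ x ⁆ (x∈p∧x∉q⇒x∈p─q y∈p y∉x)

x∉p-x : (p : Subset d) (x : Fin d) → x ∉ p - x
x∉p-x p x x∈ = proj₂ (x∈p─q⁻ p ⁅ x ⁆ x∈) (x∈⁅x⁆ x)

1+∣p-x∣≡∣p∣ : {p : Subset d} {x : Fin d} → x ∈ p → suc ∣ p - x ∣ ≡ ∣ p ∣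
1+∣p-x∣≡∣p∣ {p = p} {x} x∈p =
  trans (sym (∣p∪⁅x⁆∣≡1+∣p∣ (x∉p-x p x))) (cong ∣_∣ (p-x∪⁅x⁆≡p x∈p))

∣p-x∪⁅y⁆∣≡∣p∣ : {p : Subset d} {x y : Fin d} → x ∈ p → y ∉ p → ∣ (p - x) ∪ ⁅ y ⁆ ∣ ≡ ∣ p ∣
∣p-x∪⁅y⁆∣≡∣p∣ {p = p} {x} x∈p y∉p =
  trans (∣p∪⁅x⁆∣≡1+∣p∣ (y∉p ∘ p─q⊆p p ⁅ x ⁆)) (1+∣p-x∣≡∣p∣ x∈p)

⊑∧∣∣≥⇒≡ : {p q : Subset d} → p ⊑ q → ∣ q ∣ ≤ ∣ p ∣ → p ≡ q
⊑∧∣∣≥⇒≡ {p = p} {q} p⊑q ∣q∣≤∣p∣ = ⊆-antisym p⊑q λ {x} x∈q → case x ∈? p of λ where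
  (yes x∈p) → x∈p
  (no x∉p) → contradiction (p⊂q⇒∣p∣<∣q∣ (p⊑q , x , x∈q , x∉p)) (≤⇒≯ ∣q∣≤∣p∣)

⊑⊎∃∉ : (p q : Subset d) → p ⊑ q ⊎ ∃[ x ] x ∈ p × x ∉ q
⊑⊎∃∉ p q with nonempty? (p ─ q)
... | yes (x , x∈) = inj₂ (x , x∈p─q⁻ p q x∈)
... | no empty = inj₁ λ {x} x∈p → case x ∈? q of λ where
  (yes x∈q) → x∈q
  (no x∉q) → contradiction (x , x∈p∧x∉q⇒x∈p─q x∈p x∉q) empty

∣p∣<∣q∣⇒∃∉ : (p q : Subset d) → ∣ p ∣ < ∣ q ∣ → ∃[ x ] x ∈ q × x ∉ p
∣p∣<∣q∣⇒∃∉ p q p<q with ⊑⊎∃∉ q p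
... | inj₁ q⊑p = contradiction (p⊆q⇒∣p∣≤∣q∣ q⊑p) (<⇒≱ p<q)
... | inj₂ x = x

-- The termination measure whenever one basis is moved towards another set by exchanges.
exchange-closer : {p q : Subset d} {x y : Fin d} → x ∈ p → x ∉ q → y ∈ q →
  ((p - x) ∪ ⁅ y ⁆) ─ q ⊏ p ─ q
exchange-closer {p = p} {q} {x} {y} x∈p x∉q y∈q = incl , x , x∈p∧x∉q⇒x∈p─q x∈p x∉q , x∉
  where
  incl : ((p - x) ∪ ⁅ y ⁆) ─ q ⊑ p ─ q
  incl z∈ with x∈p─q⁻ ((p - x) ∪ ⁅ y ⁆) q z∈
  ... | z∈′ , z∉q with x∈p∪q⁻ (p - x) ⁅ y ⁆ z∈′
  ... | inj₁ z∈p-x = x∈p∧x∉q⇒x∈p─q (p─q⊆p p ⁅ x ⁆ z∈p-x) z∉q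
  ... | inj₂ z∈y rewrite x∈⁅y⁆⇒x≡y y z∈y = contradiction y∈q z∉q
  x∉ : x ∉ ((p - x) ∪ ⁅ y ⁆) ─ q
  x∉ x∈ with x∈p∪q⁻ (p - x) ⁅ y ⁆ (proj₁ (x∈p─q⁻ ((p - x) ∪ ⁅ y ⁆) q x∈))
  ... | inj₁ x∈p-x = x∉p-x p x x∈p-x
  ... | inj₂ x∈y rewrite x∈⁅y⁆⇒x≡y y x∈y = x∉q y∈q

-- Sets cut out by decidable predicates, and exhaustive search

subset : {P : Pred (Fin d) 0ℓ} → Decidable P → Subset d
subset P? = Vec.tabulate (does ∘ P?)

module _ {P : Pred (Fin d) 0ℓ} (P? : Decidable P) where

  ∈-subset⁺ : ∀ {x} → P x → x ∈ subset P?
  ∈-subset⁺ {x} Px = lookup⇒[]= x (subset P?)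
    (trans (lookup∘tabulate (does ∘ P?) x) (dec-true (P? x) Px))

  ∈-subset⁻ : ∀ {x} → x ∈ subset P? → P x
  ∈-subset⁻ {x} x∈ with P? x in eq
  ... | yes Px = Px
  ... | no ¬Px = case trans (sym ([]=⇒lookup x∈))
      (trans (lookup∘tabulate (does ∘ P?) x) (cong does eq)) of λ ()

subset-cong : {P Q : Pred (Fin d) 0ℓ} (P? : Decidable P) (Q? : Decidable Q) →
  (∀ x → P x → Q x) → (∀ x → Q x → P x) → subset P? ≡ subset Q?
subset-cong P? Q? P⇒Q Q⇒P = ⊆-antisym
  (λ {x} x∈ → ∈-subset⁺ Q? (P⇒Q x (∈-subset⁻ P? x∈)))
  (λ {x} x∈ → ∈-subset⁺ P? (Q⇒P x (∈-subset⁻ Q? x∈)))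

-- The value can be improved at most `b` times. The search procedure is a parameter because the
-- lemma serves both subsets and elements of `Fin d`.
argmax : {A : Set} {P : Pred A 0ℓ} → (∀ {Q : Pred A 0ℓ} → Decidable Q → Dec (∃ Q)) → Decidable P →
  (μ : A → ℕ) (b : ℕ) → (∀ a → μ a ≤ b) → ∃ P → ∃[ a ] P a × (∀ {a′} → P a′ → μ a′ ≤ μ a)
argmax {A} {P} ∃? P? μ b μ≤b (a₀ , Pa₀) = search b a₀ Pa₀ (m≤n+m b (μ a₀))
  where
  search : ∀ n a → P a → b ≤ μ a + n → ∃[ a ] P a × (∀ {a′} → P a′ → μ a′ ≤ μ a)
  search zero a Pa h = a , Pa , λ {a′} _ → ≤-trans (μ≤b a′) (subst (b ≤_) (+-identityʳ _) h)
  search (suc n) a Pa h with ∃? (λ a′ → P? a′ ×-dec suc (μ a) ≤? μ a′)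
  ... | yes (a′ , Pa′ , a<a′) = search n a′ Pa′
    (≤-trans h (≤-trans (≤-reflexive (+-suc (μ a) n)) (+-monoˡ-≤ n a<a′)))
  ... | no ¬∃ = a , Pa , λ {a′} Pa′ → ≮⇒≥ λ a<a′ → ¬∃ (a′ , Pa′ , a<a′)

allSubsets? : {P : Pred (Subset d) 0ℓ} → Decidable P → Dec (∀ S → P S)
allSubsets? P? = Dec.map′
  (λ ¬∃¬P S → decidable-stable (P? S) (λ ¬PS → ¬∃¬P (S , ¬PS)))
  (λ ∀P (S , ¬PS) → ¬PS (∀P S))
  (¬? (anySubset? (¬? ∘ P?)))

-- Independent sets, bases and rank

Augmentable : Pred (Subset d) 0ℓ → Set
Augmentable {d} P = ∀ {I J} → P I → P J → ∣ I ∣ < ∣ J ∣ →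
  ∃[ y ] y ∈ J × y ∉ I × P (I ∪ ⁅ y ⁆)

extend-to : {P : Pred (Subset d) 0ℓ} → Augmentable P → ∀ {I J} → P I → P J → ∣ I ∣ ≤ ∣ J ∣ →
  ∃[ K ] P K × I ⊑ K × K ⊑ I ∪ J × ∣ K ∣ ≡ ∣ J ∣
extend-to {d} {P} augment {I} {J} PI PJ I≤J = grow (∣ J ∣ ∸ ∣ I ∣) PI (m+[n∸m]≡n I≤J)
  where
  grow : ∀ n {I} → P I → ∣ I ∣ + n ≡ ∣ J ∣ →
    ∃[ K ] P K × I ⊑ K × K ⊑ I ∪ J × ∣ K ∣ ≡ ∣ J ∣
  grow zero {I} PI eq = I , PI , id , p⊆p∪q J , trans (sym (+-identityʳ _)) eq
  grow (suc n) {I} PI eq with augment PI PJ (subst (∣ I ∣ <_) eq (m<m+n ∣ I ∣ z<s))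
  ... | y , y∈J , y∉I , PI+y
    with grow n PI+y (trans (cong (_+ n) (∣p∪⁅x⁆∣≡1+∣p∣ y∉I)) (trans (sym (+-suc _ n)) eq))
  ... | K , PK , I+y⊑K , K⊑ , eqK = K , PK , (λ x∈I → I+y⊑K (p⊆p∪q ⁅ y ⁆ x∈I)) , K⊑I∪J , eqK
    where
    K⊑I∪J : K ⊑ I ∪ J
    K⊑I∪J z∈K with x∈p∪q⁻ (I ∪ ⁅ y ⁆) J (K⊑ z∈K)
    ... | inj₁ z∈I+y = p∪⁅x⁆⊑q (p⊆p∪q J) (q⊆p∪q I J y∈J) z∈I+y
    ... | inj₂ z∈J = q⊆p∪q I J z∈J

module _ (M : Matroid d) where

  -- Exchanges keep the size of `A` and end with `A ⊑ B`. An element of `B` outside `A` would then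
  -- have to be traded for an element of `A` outside `B`, and there is none.
  bases-equicardinal : ∀ {A B} → IsBasis M A → IsBasis M B → ∣ A ∣ ≡ ∣ B ∣
  bases-equicardinal {A} {B} = go ∣ A ─ B ∣ ≤-refl
    where
    go : ∀ n {A} → ∣ A ─ B ∣ ≤ n → IsBasis M A → IsBasis M B → ∣ A ∣ ≡ ∣ B ∣
    go n {A} bound bA bB with ⊑⊎∃∉ A B
    ... | inj₂ (x , x∈A , x∉B) with exchange M bA bB x∈A x∉B
    ...   | y , y∈B , y∉A , bA′ with n | ≤-trans (p⊂q⇒∣p∣<∣q∣ (exchange-closer x∈A x∉B y∈B)) bound
    ...     | suc n | s≤s bound′ = trans (sym (∣p-x∪⁅y⁆∣≡∣p∣ x∈A y∉A)) (go n bound′ bA′ bB)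
    go n {A} bound bA bB | inj₁ A⊑B with ⊑⊎∃∉ B A
    ... | inj₁ B⊑A = cong ∣_∣ (⊆-antisym A⊑B B⊑A)
    ... | inj₂ (x , x∈B , x∉A) = let (y , y∈A , y∉B , _) = exchange M bB bA x∈B x∉A in
      contradiction (A⊑B y∈A) y∉B

  -- Only elements of `A` outside `I ∪ B` are exchanged away, and for elements of `B`, so `I` is
  -- never touched.
  basis-within : ∀ {I A B} → IsBasis M A → I ⊑ A → IsBasis M B →
    ∃[ C ] IsBasis M C × I ⊑ C × C ⊑ I ∪ B
  basis-within {I} {A} {B} = go ∣ A ─ (I ∪ B) ∣ ≤-refl
    where
    go : ∀ n {A} → ∣ A ─ (I ∪ B) ∣ ≤ n → IsBasis M A → I ⊑ A → IsBasis M B →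
      ∃[ C ] IsBasis M C × I ⊑ C × C ⊑ I ∪ B
    go n {A} bound bA I⊑A bB with ⊑⊎∃∉ A (I ∪ B)
    ... | inj₁ A⊑ = A , bA , I⊑A , A⊑
    ... | inj₂ (x , x∈A , x∉) with exchange M bA bB x∈A (x∉ ∘ q⊆p∪q I B)
    ... | y , y∈B , y∉A , bA′
      with n | ≤-trans (p⊂q⇒∣p∣<∣q∣ (exchange-closer x∈A x∉ (q⊆p∪q I B y∈B))) bound
    ... | suc n | s≤s bound′ = go n bound′ bA′ I⊑A′ bB
      where
      I⊑A′ : I ⊑ (A - x) ∪ ⁅ y ⁆
      I⊑A′ z∈I = p⊆p∪q ⁅ y ⁆ (x∈p∧x≢y⇒x∈p-y (I⊑A z∈I) λ z≡x → x∉ (p⊆p∪q B (subst (_∈ I) z≡x z∈I)))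

  -- Take a basis `C` with `I ⊑ C ⊑ I ∪ B`. If it contained no element of `J` outside `I`, then
  -- `C ─ I ⊑ B ─ J`, and `C` would be smaller than `B`.
  independent-augment : Augmentable (Independent M)
  independent-augment {I} {J} (A , bA , I⊑A) (B , bB , J⊑B) I<J with basis-within bA I⊑A bB
  ... | C , bC , I⊑C , C⊑I∪B with ⊑⊎∃∉ (C ∩ J) I
  ... | inj₂ (y , y∈ , y∉I) = let (y∈C , y∈J) = x∈p∩q⁻ C J y∈ in
    y , y∈J , y∉I , C , bC , p∪⁅x⁆⊑q I⊑C y∈C
  ... | inj₁ C∩J⊑I = contradiction (bases-equicardinal bC bB) (<⇒≢ (begin-strict
      ∣ C ∣                       ≡⟨ ∣p∣≡∣p∩q∣+∣p─q∣ C I ⟩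
      ∣ C ∩ I ∣ + ∣ C ─ I ∣       ≤⟨ +-mono-≤ (∣p∩q∣≤∣q∣ C I) (p⊆q⇒∣p∣≤∣q∣ C─I⊑B─J) ⟩
      ∣ I ∣ + ∣ B ─ J ∣           <⟨ +-monoˡ-< ∣ B ─ J ∣ I<J ⟩
      ∣ J ∣ + ∣ B ─ J ∣           ≤⟨ +-monoˡ-≤ ∣ B ─ J ∣ (p⊆q⇒∣p∣≤∣q∣ (λ x∈J → x∈p∩q⁺ (J⊑B x∈J , x∈J))) ⟩
      ∣ B ∩ J ∣ + ∣ B ─ J ∣       ≡⟨ ∣p∣≡∣p∩q∣+∣p─q∣ B J ⟨
      ∣ B ∣                       ∎))
    where
    open ≤-Reasoning
    C─I⊑B─J : C ─ I ⊑ B ─ J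
    C─I⊑B─J z∈ with x∈p─q⁻ C I z∈
    ... | z∈C , z∉I with x∈p∪q⁻ I B (C⊑I∪B z∈C)
    ... | inj₁ z∈I = contradiction z∈I z∉I
    ... | inj₂ z∈B = x∈p∧x∉q⇒x∈p─q z∈B (λ z∈J → z∉I (C∩J⊑I (x∈p∩q⁺ (z∈C , z∈J))))

  independent-⊑ : ∀ {I J} → I ⊑ J → Independent M J → Independent M I
  independent-⊑ I⊑J (B , bB , J⊑B) = B , bB , λ x∈I → J⊑B (I⊑J x∈I)

  basis⇒independent : ∀ {B} → IsBasis M B → Independent M B
  basis⇒independent {B} bB = B , bB , id

  independent⇒basis : ∀ {I B} → Independent M I → IsBasis M B → ∣ B ∣ ≤ ∣ I ∣ → IsBasis M I
  independent⇒basis (A , bA , I⊑A) bB B≤I =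
    subst (IsBasis M) (sym (⊑∧∣∣≥⇒≡ I⊑A (≤-trans (≤-reflexive (bases-equicardinal bA bB)) B≤I))) bA

  ∣independent∣≤∣basis∣ : ∀ {I B} → Independent M I → IsBasis M B → ∣ I ∣ ≤ ∣ B ∣
  ∣independent∣≤∣basis∣ (A , bA , I⊑A) bB =
    ≤-trans (p⊆q⇒∣p∣≤∣q∣ I⊑A) (≤-reflexive (bases-equicardinal bA bB))

  private
    max-basis : ∀ S → ∃[ B ] IsBasis M B × (∀ {A} → IsBasis M A → ∣ A ∩ S ∣ ≤ ∣ B ∩ S ∣)
    max-basis S = argmax anySubset? (isBasis? M) (λ A → ∣ A ∩ S ∣) d (λ A → ∣p∣≤n (A ∩ S)) (nonempty M)

  rank : Subset d → ℕ
  rank S = ∣ proj₁ (max-basis S) ∩ S ∣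

  rank-attained : ∀ S → ∃[ B ] IsBasis M B × ∣ B ∩ S ∣ ≡ rank S
  rank-attained S = let (B , bB , _) = max-basis S in B , bB , refl

  ∣basis∩S∣≤rank : ∀ S {B} → IsBasis M B → ∣ B ∩ S ∣ ≤ rank S
  ∣basis∩S∣≤rank S = proj₂ (proj₂ (max-basis S))

  rank-least : ∀ S {n} → (∀ {B} → IsBasis M B → ∣ B ∩ S ∣ ≤ n) → rank S ≤ n
  rank-least S bound = bound (proj₁ (proj₂ (max-basis S)))

  ∣independent∣≤rank : ∀ {I S} → Independent M I → I ⊑ S → ∣ I ∣ ≤ rank S
  ∣independent∣≤rank {I} {S} (B , bB , I⊑B) I⊑S =
    ≤-trans (p⊆q⇒∣p∣≤∣q∣ (λ x∈I → x∈p∩q⁺ (I⊑B x∈I , I⊑S x∈I))) (∣basis∩S∣≤rank S bB)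

  rank-mono : ∀ {S T} → S ⊑ T → rank S ≤ rank T
  rank-mono {S} {T} S⊑T = rank-least S λ {B} bB →
    ≤-trans (p⊆q⇒∣p∣≤∣q∣ (∩-monoʳ-⊑ B S⊑T)) (∣basis∩S∣≤rank T bB)

  rank≤rank+∣─∣ : ∀ S T → rank T ≤ rank S + ∣ T ─ S ∣
  rank≤rank+∣─∣ S T = rank-least T λ {B} bB → begin
    ∣ B ∩ T ∣                               ≡⟨ ∣p∣≡∣p∩q∣+∣p─q∣ (B ∩ T) S ⟩
    ∣ (B ∩ T) ∩ S ∣ + ∣ (B ∩ T) ─ S ∣       ≤⟨ +-mono-≤ (p⊆q⇒∣p∣≤∣q∣ (∩-monoˡ-⊑ S (p∩q⊆p B T)))
                                                        (p⊆q⇒∣p∣≤∣q∣ (─-monoˡ-⊑ S (p∩q⊆q B T))) ⟩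
    ∣ B ∩ S ∣ + ∣ T ─ S ∣                   ≤⟨ +-monoˡ-≤ ∣ T ─ S ∣ (∣basis∩S∣≤rank S bB) ⟩
    rank S + ∣ T ─ S ∣                      ∎
    where open ≤-Reasoning

  rank≤∣S∣ : ∀ S → rank S ≤ ∣ S ∣
  rank≤∣S∣ S = rank-least S λ {B} _ → ∣p∩q∣≤∣q∣ B S

-- Genericity in terms of ranks

total : (Fin d → ℕ) → Subset d → ℕ
total v [] = 0
total v (b ∷ S) = (if b then v zero else 0) + total (v ∘ suc) S

total-cong : {u v : Fin d → ℕ} → (∀ x → u x ≡ v x) → ∀ S → total u S ≡ total v S
total-cong eq [] = refl
total-cong eq (b ∷ S) = cong₂ _+_ (cong (if b then_else 0) (eq zero)) (total-cong (eq ∘ suc) S)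

total-zero : (S : Subset d) → total (λ _ → 0) S ≡ 0
total-zero [] = refl
total-zero (true ∷ S) = total-zero S
total-zero (false ∷ S) = total-zero S

total-∪⁅x⁆ : (v : Fin d → ℕ) {S : Subset d} {x : Fin d} → x ∉ S →
  total v (S ∪ ⁅ x ⁆) ≡ total v S + v x
total-∪⁅x⁆ v {true ∷ S} {zero} x∉S = contradiction here x∉S
total-∪⁅x⁆ v {false ∷ S} {zero} x∉S =
  trans (+-comm (v zero) _) (cong (λ T → total (v ∘ suc) T + v zero) (∪-identityʳ S))
total-∪⁅x⁆ v {b ∷ S} {suc x} x∉S rewrite Boolₚ.∨-identityʳ b =
  trans (cong ((if b then v zero else 0) +_) (total-∪⁅x⁆ (v ∘ suc) (x∉S ∘ there)))
    (sym (+-assoc (if b then v zero else 0) _ _))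

total-remove : (v : Fin d → ℕ) {S : Subset d} {x : Fin d} → x ∈ S →
  total v (S - x) + v x ≡ total v S
total-remove v {S} {x} x∈S =
  trans (sym (total-∪⁅x⁆ v (x∉p-x S x))) (cong (total v) (p-x∪⁅x⁆≡p x∈S))

total-exchange : (v : Fin d → ℕ) {S : Subset d} {x y : Fin d} → x ∈ S → y ∉ S →
  total v ((S - x) ∪ ⁅ y ⁆) + v x ≡ total v S + v y
total-exchange v {S} {x} {y} x∈S y∉S = begin
  total v ((S - x) ∪ ⁅ y ⁆) + v x    ≡⟨ cong (_+ v x) (total-∪⁅x⁆ v (y∉S ∘ p─q⊆p S ⁅ x ⁆)) ⟩
  total v (S - x) + v y + v x        ≡⟨ +-assoc _ (v y) (v x) ⟩
  total v (S - x) + (v y + v x)      ≡⟨ cong (total v (S - x) +_) (+-comm (v y) (v x)) ⟩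
  total v (S - x) + (v x + v y)      ≡⟨ +-assoc _ (v x) (v y) ⟨
  total v (S - x) + v x + v y        ≡⟨ cong (_+ v y) (total-remove v x∈S) ⟩
  total v S + v y                    ∎
  where open ≡-Reasoning

upper : (Fin d → ℕ) → ℕ → Subset d
upper v t = subset (λ x → t ≤? v x)

∈-upper⁺ : (v : Fin d → ℕ) {t : ℕ} {x : Fin d} → t ≤ v x → x ∈ upper v t
∈-upper⁺ v {t} = ∈-subset⁺ (λ x → t ≤? v x)

∈-upper⁻ : (v : Fin d → ℕ) {t : ℕ} {x : Fin d} → x ∈ upper v t → t ≤ v x
∈-upper⁻ v {t} = ∈-subset⁻ (λ x → t ≤? v x)

total-⊓-suc : (v : Fin d → ℕ) (t : ℕ) (S : Subset d) →
  total (λ x → v x ⊓ suc t) S ≡ total (λ x → v x ⊓ t) S + ∣ S ∩ upper v (suc t) ∣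
total-⊓-suc v t [] = refl
total-⊓-suc v t (false ∷ S) = total-⊓-suc (v ∘ suc) t S
total-⊓-suc v t (true ∷ S) with t <ᵇ v zero in eq
... | true = begin
  v zero ⊓ suc t + total (λ x → v (suc x) ⊓ suc t) S   ≡⟨ cong₂ _+_ (m≥n⇒m⊓n≡n t<v) (total-⊓-suc (v ∘ suc) t S) ⟩
  suc (t + (rest + n))                                 ≡⟨ cong suc (+-assoc t rest n) ⟨
  suc (t + rest + n)                                   ≡⟨ +-suc (t + rest) n ⟨
  t + rest + suc n                                     ≡⟨ cong (λ k → k + rest + suc n) (m≥n⇒m⊓n≡n (<⇒≤ t<v)) ⟨
  v zero ⊓ t + rest + suc n                            ∎
  where
  open ≡-Reasoning
  t<v = <ᵇ⇒< t (v zero) (subst T (sym eq) _)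
  rest = total (λ x → v (suc x) ⊓ t) S
  n = ∣ S ∩ upper (v ∘ suc) (suc t) ∣
... | false = begin
  v zero ⊓ suc t + total (λ x → v (suc x) ⊓ suc t) S   ≡⟨ cong₂ _+_ (m≤n⇒m⊓n≡m (m≤n⇒m≤1+n v≤t)) (total-⊓-suc (v ∘ suc) t S) ⟩
  v zero + (rest + n)                                  ≡⟨ +-assoc (v zero) rest n ⟨
  v zero + rest + n                                    ≡⟨ cong (λ k → k + rest + n) (m≤n⇒m⊓n≡m v≤t) ⟨
  v zero ⊓ t + rest + n                                ∎
  where
  open ≡-Reasoning
  v≤t = ≮⇒≥ λ t<v → subst T eq (<⇒<ᵇ t<v)
  rest = total (λ x → v (suc x) ⊓ t) S
  n = ∣ S ∩ upper (v ∘ suc) (suc t) ∣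

bound : (v : Fin d → ℕ) → ∃[ m ] ∀ x → v x ≤ m
bound {zero} v = 0 , λ ()
bound {suc d} v = let (m , v≤m) = bound (v ∘ suc) in v zero ⊔ m , λ where
  zero → m≤m⊔n (v zero) m
  (suc x) → ≤-trans (v≤m x) (m≤n⊔m (v zero) m)

-- By the layer-cake formula: total v S is the sum over t of ∣ S ∩ upper v (suc t) ∣.
total-mono : (v : Fin d → ℕ) {S T : Subset d} → (∀ t → ∣ S ∩ upper v t ∣ ≤ ∣ T ∩ upper v t ∣) →
  total v S ≤ total v T
total-mono v {S} {T} S≤T = begin
  total v S                   ≡⟨ total-cong (λ x → m≤n⇒m⊓n≡m (v≤m x)) S ⟨
  total (λ x → v x ⊓ m) S     ≤⟨ truncated m ⟩
  total (λ x → v x ⊓ m) T     ≡⟨ total-cong (λ x → m≤n⇒m⊓n≡m (v≤m x)) T ⟩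
  total v T                   ∎
  where
  open ≤-Reasoning
  m = proj₁ (bound v)
  v≤m = proj₂ (bound v)
  truncated : ∀ t → total (λ x → v x ⊓ t) S ≤ total (λ x → v x ⊓ t) T
  truncated zero = ≤-reflexive (trans (total-⊓-zero S) (sym (total-⊓-zero T)))
    where
    total-⊓-zero : ∀ S → total (λ x → v x ⊓ 0) S ≡ 0
    total-⊓-zero S = trans (total-cong (λ x → ⊓-zeroʳ (v x)) S) (total-zero S)
  truncated (suc t) = begin
    total (λ x → v x ⊓ suc t) S                            ≡⟨ total-⊓-suc v t S ⟩
    total (λ x → v x ⊓ t) S + ∣ S ∩ upper v (suc t) ∣      ≤⟨ +-mono-≤ (truncated t) (S≤T (suc t)) ⟩
    total (λ x → v x ⊓ t) T + ∣ T ∩ upper v (suc t) ∣      ≡⟨ total-⊓-suc v t T ⟨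
    total (λ x → v x ⊓ suc t) T                            ∎

upper-suc : (v : Fin d → ℕ) (t : ℕ) → (∀ x → v x ≢ t) → upper v t ≡ upper v (suc t)
upper-suc v t v≢t = subset-cong (λ x → t ≤? v x) (λ x → suc t ≤? v x)
  (λ x t≤v → ≤∧≢⇒< t≤v (v≢t x ∘ sym)) (λ x → <⇒≤)

upper-empty : (v : Fin d → ℕ) {t : ℕ} → (∀ x → v x < t) → upper v t ≡ ⊥
upper-empty v {t} v<t = Empty-unique λ (x , x∈) → <⇒≱ (v<t x) (∈-upper⁻ v x∈)

-- Raising the threshold past a value that `v` omits changes nothing, so the finitely many
-- thresholds `v x` stand for all of them.
upper-trichotomy : (v : Fin d → ℕ) (t : ℕ) → upper v t ≡ ⊥ ⊎ ∃[ x ] upper v t ≡ upper v (v x)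
upper-trichotomy {d} v t = go (suc m) t (m≤m+n (suc m) t)
  where
  m = proj₁ (bound v)
  go : ∀ n t → m < n + t → upper v t ≡ ⊥ ⊎ ∃[ x ] upper v t ≡ upper v (v x)
  go zero t m<t = inj₁ (upper-empty v λ x → ≤-<-trans (proj₂ (bound v) x) m<t)
  go (suc n) t m<n+t with any? (λ x → v x ≟ t)
  ... | yes (x , refl) = inj₂ (x , refl)
  ... | no v≢t rewrite upper-suc v t (λ x eq → v≢t (x , eq)) =
    go n (suc t) (subst (m <_) (sym (+-suc n t)) m<n+t)

value : Word d → Fin d → ℕ
value f x = proj₁ (Vec.lookup f x)

weight≡total : (f : Word d) (B : Subset d) → weight f B ≡ total (value f) B
weight≡total [] [] = refl
weight≡total (a ∷ f) (b ∷ B) = cong ((if b then proj₁ a else 0) +_) (weight≡total f B)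

-- The order refining f that ranks B last within each level set of f; its level
-- sets lie inside B or outside B according to parity.
refine : Word d → Subset d → Fin d → ℕ
refine f B x = if does (x ∈? B) then 2 * value f x else suc (2 * value f x)

module _ (f : Word d) (B : Subset d) where

  refine-∈ : ∀ {x} → x ∈ B → refine f B x ≡ 2 * value f x
  refine-∈ {x} x∈B = cong (if_then 2 * value f x else suc (2 * value f x)) (dec-true (x ∈? B) x∈B)

  refine-∉ : ∀ {x} → x ∉ B → refine f B x ≡ suc (2 * value f x)
  refine-∉ {x} x∉B = cong (if_then 2 * value f x else suc (2 * value f x)) (dec-false (x ∈? B) x∉B)

  refine-level : ∀ {x y} → refine f B x ≡ refine f B y → x ∈ B → y ∈ B
  refine-level {x} {y} eq x∈B = case y ∈? B of λ where
    (yes y∈B) → y∈B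
    (no y∉B) → contradiction (trans (sym (refine-∈ x∈B)) (trans eq (refine-∉ y∉B)))
      (even≢odd (value f x) (value f y))

-- Doubling leaves room for a surcharge of one per element outside `B`, too small to reverse a
-- strict comparison of two values of `f`.
total-refine : (f : Word d) (B S : Subset d) → total (refine f B) S ≡ 2 * total (value f) S + ∣ S ─ B ∣
total-refine [] [] [] = refl
total-refine (a ∷ f) (b ∷ B) (false ∷ S) with b
... | true = total-refine f B S
... | false = total-refine f B S
total-refine (a ∷ f) (true ∷ B) (true ∷ S) =
  trans (cong (2 * proj₁ a +_) (total-refine f B S))
  (trans (sym (+-assoc (2 * proj₁ a) _ _))
    (cong (_+ ∣ S ─ B ∣) (sym (*-distribˡ-+ 2 (proj₁ a) (total (value f) S)))))
total-refine (a ∷ f) (false ∷ B) (true ∷ S) =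
  trans (cong (suc (2 * proj₁ a) +_) (total-refine f B S))
  (trans (cong suc (sym (+-assoc (2 * proj₁ a) _ _)))
  (trans (cong (λ n → suc (n + ∣ S ─ B ∣)) (sym (*-distribˡ-+ 2 (proj₁ a) (total (value f) S))))
    (sym (+-suc _ _))))

-- Unique maximizers and saturated upper sets

UniqueMax : Matroid d → Word d → Subset d → Set
UniqueMax M f B = Maximizing M f B × (∀ {A} → Maximizing M f A → B ≡ A)

Saturates : Matroid d → (Fin d → ℕ) → Subset d → Set
Saturates M v B = ∀ x → rank M (upper v (v x)) ≡ ∣ B ∩ upper v (v x) ∣

module _ (M : Matroid d) (f : Word d) {B : Subset d} where
  private
    v = refine f B
    U = upper v

  -- If `B` misses the rank of an upper set, some `y` outside `B` can be added to its trace there.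
  -- Completing inside `B` gives a basis that trades one `x′` below the threshold for `y`, and its
  -- weight is no smaller.
  uniqueMax⇒saturates : UniqueMax M f B → Saturates M v B
  uniqueMax⇒saturates ((bB , max) , unique) x =
    ≤-antisym (≮⇒≥ (impossible (v x))) (∣basis∩S∣≤rank M (U (v x)) bB)
    where
    impossible : ∀ t → ∣ B ∩ U t ∣ ≮ rank M (U t)
    impossible t B<r with rank-attained M (U t)
    ... | A , bA , eqA
      with independent-augment M (B , bB , p∩q⊆p B (U t)) (A , bA , p∩q⊆p A (U t))
             (subst (∣ B ∩ U t ∣ <_) (sym eqA) B<r)
    ... | y , y∈ , y∉ , iI with extend-to (independent-augment M) iI (basis⇒independent M bB) (∣independent∣≤∣basis∣ M iI bB)
    ... | K , iK , I⊑K , K⊑ , ∣K∣≡∣B∣ = y∉B (subst (y ∈_) (sym B≡K) y∈K)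
      where
      y∈U = proj₂ (x∈p∩q⁻ A (U t) y∈)
      y∉B : y ∉ B
      y∉B y∈B = y∉ (x∈p∩q⁺ (y∈B , y∈U))
      y∈K : y ∈ K
      y∈K = I⊑K (x∈p∪⁅x⁆ (B ∩ U t) y)
      bK = independent⇒basis M iK bB (≤-reflexive (sym ∣K∣≡∣B∣))
      missing : ∃[ x ] x ∈ B × x ∉ K
      missing with ⊑⊎∃∉ B K
      ... | inj₂ m = m
      ... | inj₁ B⊑K = contradiction (subst (y ∈_) (sym (⊑∧∣∣≥⇒≡ B⊑K (≤-reflexive ∣K∣≡∣B∣))) y∈K) y∉B
      x′ = proj₁ missing
      x∈B = proj₁ (proj₂ missing)
      x∉K = proj₂ (proj₂ missing)
      vx<vy : v x′ < v y
      vx<vy = <-≤-trans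
        (≰⇒> λ t≤vx → x∉K (I⊑K (p⊆p∪q ⁅ y ⁆ (x∈p∩q⁺ (x∈B , ∈-upper⁺ v {t} t≤vx)))))
        (∈-upper⁻ v {t} y∈U)
      -- Here parity enters: `2 * a < suc (2 * b)` gives only `a ≤ b`, so a tie is allowed, and a
      -- tie already contradicts uniqueness.
      fx≤fy : value f x′ ≤ value f y
      fx≤fy = *-cancelˡ-≤ 2 (s≤s⁻¹ (subst₂ _<_ (refine-∈ f B x∈B) (refine-∉ f B y∉B) vx<vy))
      K⊑exchange : K ⊑ (B - x′) ∪ ⁅ y ⁆
      K⊑exchange {z} z∈K with x∈p∪q⁻ ((B ∩ U t) ∪ ⁅ y ⁆) B (K⊑ z∈K)
      ... | inj₂ z∈B = p⊆p∪q ⁅ y ⁆ (x∈p∧x≢y⇒x∈p-y z∈B λ { refl → x∉K z∈K })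
      ... | inj₁ z∈ with x∈p∪q⁻ (B ∩ U t) ⁅ y ⁆ z∈
      ...   | inj₁ z∈B = p⊆p∪q ⁅ y ⁆ (x∈p∧x≢y⇒x∈p-y (p∩q⊆p B (U t) z∈B) λ { refl → x∉K z∈K })
      ...   | inj₂ z∈y = q⊆p∪q (B - x′) ⁅ y ⁆ z∈y
      K≡ : K ≡ (B - x′) ∪ ⁅ y ⁆
      K≡ = ⊑∧∣∣≥⇒≡ K⊑exchange (≤-reflexive (trans (∣p-x∪⁅y⁆∣≡∣p∣ x∈B y∉B) (sym ∣K∣≡∣B∣)))
      B≤K : total (value f) B ≤ total (value f) K
      B≤K = +-cancelʳ-≤ (value f x′) _ _ (begin
        total (value f) B + value f x′                      ≤⟨ +-monoʳ-≤ (total (value f) B) fx≤fy ⟩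
        total (value f) B + value f y                       ≡⟨ total-exchange (value f) x∈B y∉B ⟨
        total (value f) ((B - x′) ∪ ⁅ y ⁆) + value f x′     ≡⟨ cong (λ S → total (value f) S + value f x′) K≡ ⟨
        total (value f) K + value f x′                      ∎)
        where open ≤-Reasoning
      B≡K : B ≡ K
      B≡K = unique (bK , λ A bA → ≤-trans (max A bA)
        (subst₂ _≤_ (sym (weight≡total f B)) (sym (weight≡total f K)) B≤K))

  private
    module _ (saturated : Saturates M v B) where

      saturated-upper : ∀ t → rank M (U t) ≡ ∣ B ∩ U t ∣
      saturated-upper t with upper-trichotomy v t
      ... | inj₂ (x , eq) rewrite eq = saturated x
      ... | inj₁ eq rewrite eq = trans (n≤0⇒n≡0 (≤-trans (rank≤∣S∣ M ⊥) (≤-reflexive (∣⊥∣≡0 d))))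
        (sym (trans (cong ∣_∣ (∩-zeroʳ B)) (∣⊥∣≡0 d)))

      -- Downward induction on the threshold. If `B` meets level `t`, it contains that whole level.
      -- A largest independent subset `K` of the upper set extending the part of `B` above `t`
      -- cannot gain anything above `t`, where `B` is saturated, so the rest of `K` lies at level
      -- `t` and hence in `B`.
      independent-upper : ∀ n t → proj₁ (bound v) < n + t → Independent M (B ∩ U t)
      independent-upper zero t m<t rewrite upper-empty v (λ x → ≤-<-trans (proj₂ (bound v) x) m<t) =
        let (A , bA) = nonempty M in A , bA , λ x∈ → contradiction (p∩q⊆q B ⊥ x∈) ∉⊥
      independent-upper (suc n) t m<n+t
        with independent-upper n (suc t) (subst (proj₁ (bound v) <_) (sym (+-suc n t)) m<n+t)
           | ⊑⊎∃∉ (B ∩ U t) (U (suc t))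
      ... | iI | inj₁ B∩U⊑ = independent-⊑ M (λ x∈ → x∈p∩q⁺ (p∩q⊆p B (U t) x∈ , B∩U⊑ x∈)) iI
      ... | iI | inj₂ (x , x∈ , x∉) with rank-attained M (U t)
      ... | A , bA , eqA with extend-to (independent-augment M) iI (A , bA , p∩q⊆p A (U t)) I≤A
        where
        U⊑ : U (suc t) ⊑ U t
        U⊑ z∈ = ∈-upper⁺ v (<⇒≤ (∈-upper⁻ v z∈))
        I≤A : ∣ B ∩ U (suc t) ∣ ≤ ∣ A ∩ U t ∣
        I≤A = ≤-trans (p⊆q⇒∣p∣≤∣q∣ (∩-monoʳ-⊑ B U⊑)) (≤-reflexive (sym (trans eqA (saturated-upper t))))
      ... | K , iK , I⊑K , K⊑ , ∣K∣≡ =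
        subst (Independent M) (⊑∧∣∣≥⇒≡ K⊑B (≤-reflexive (sym (trans ∣K∣≡ (trans eqA (saturated-upper t)))))) iK
        where
        x∈B = proj₁ (x∈p∩q⁻ B (U t) x∈)
        at-level : ∀ {z} → z ∈ U t → z ∉ U (suc t) → v z ≡ t
        at-level z∈ z∉ = ≤-antisym (≮⇒≥ (z∉ ∘ ∈-upper⁺ v)) (∈-upper⁻ v z∈)
        vx≡t = at-level (p∩q⊆q B (U t) x∈) x∉
        K⊑U : K ⊑ U t
        K⊑U z∈K with x∈p∪q⁻ (B ∩ U (suc t)) (A ∩ U t) (K⊑ z∈K)
        ... | inj₁ z∈ = ∈-upper⁺ v (<⇒≤ (∈-upper⁻ v (p∩q⊆q B (U (suc t)) z∈)))
        ... | inj₂ z∈ = p∩q⊆q A (U t) z∈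
        K∩U≡ : B ∩ U (suc t) ≡ K ∩ U (suc t)
        K∩U≡ = ⊑∧∣∣≥⇒≡ (λ z∈ → x∈p∩q⁺ (I⊑K z∈ , p∩q⊆q B (U (suc t)) z∈))
          (≤-trans (∣independent∣≤rank M (independent-⊑ M (p∩q⊆p K (U (suc t))) iK) (p∩q⊆q K (U (suc t))))
            (≤-reflexive (saturated-upper (suc t))))
        K⊑B : K ⊑ B ∩ U t
        K⊑B {z} z∈K with z ∈? U (suc t)
        ... | yes z∈U = x∈p∩q⁺ (p∩q⊆p B (U (suc t)) (subst (z ∈_) (sym K∩U≡) (x∈p∩q⁺ (z∈K , z∈U))) , K⊑U z∈K)
        ... | no z∉U = x∈p∩q⁺
          (refine-level f B (trans vx≡t (sym (at-level (K⊑U z∈K) z∉U))) x∈B , K⊑U z∈K)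

      upper-zero : B ⊑ B ∩ U 0
      upper-zero x∈B = x∈p∩q⁺ (x∈B , ∈-upper⁺ v z≤n)

      saturated-basis : IsBasis M B
      saturated-basis with rank-attained M (U 0)
      ... | A , bA , eqA = independent⇒basis M
        (independent-⊑ M upper-zero (independent-upper (suc (proj₁ (bound v))) 0 (m≤m+n _ 0))) bA (begin
          ∣ A ∣          ≤⟨ p⊆q⇒∣p∣≤∣q∣ {p = A} (λ x∈A → x∈p∩q⁺ (x∈A , ∈-upper⁺ v z≤n)) ⟩
          ∣ A ∩ U 0 ∣    ≡⟨ trans eqA (saturated-upper 0) ⟩
          ∣ B ∩ U 0 ∣    ≤⟨ ∣p∩q∣≤∣p∣ B (U 0) ⟩
          ∣ B ∣          ∎)
        where open ≤-Reasoning

      -- The term `∣ A ─ B ∣` is the gap that later separates `B` from every other basis.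
      refined-max : ∀ {A} → IsBasis M A → 2 * total (value f) A + ∣ A ─ B ∣ ≤ 2 * total (value f) B
      refined-max {A} bA = begin
        2 * total (value f) A + ∣ A ─ B ∣    ≡⟨ total-refine f B A ⟨
        total v A                            ≤⟨ total-mono v {A} {B} (λ t → ≤-trans (∣basis∩S∣≤rank M (U t) bA) (≤-reflexive (saturated-upper t))) ⟩
        total v B                            ≡⟨ total-refine f B B ⟩
        2 * total (value f) B + ∣ B ─ B ∣    ≡⟨ cong (λ n → 2 * total (value f) B + n) ∣B─B∣≡0 ⟩
        2 * total (value f) B + 0            ≡⟨ +-identityʳ _ ⟩
        2 * total (value f) B                ∎
        where
        open ≤-Reasoning
        ∣B─B∣≡0 : ∣ B ─ B ∣ ≡ 0
        ∣B─B∣≡0 = trans (cong ∣_∣ (Empty-unique {p = B ─ B} λ (x , x∈) →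
          let (x∈B , x∉B) = x∈p─q⁻ B B x∈ in x∉B x∈B)) (∣⊥∣≡0 d)

  saturates⇒uniqueMax : Saturates M v B → UniqueMax M f B
  saturates⇒uniqueMax s = (bB , max) , unique
    where
    bB = saturated-basis s
    max : ∀ A → IsBasis M A → weight f A ≤ weight f B
    max A bA = subst₂ _≤_ (sym (weight≡total f A)) (sym (weight≡total f B))
      (*-cancelˡ-≤ 2 (≤-trans (m≤m+n _ _) (refined-max s bA)))
    unique : ∀ {A} → Maximizing M f A → B ≡ A
    unique {A} (bA , maxA) with ⊑⊎∃∉ A B
    ... | inj₁ A⊑B = sym (⊑∧∣∣≥⇒≡ A⊑B (≤-reflexive (bases-equicardinal M bB bA)))
    ... | inj₂ (x , x∈A , x∉B) = contradiction (maxA B bB) (<⇒≱ (*-cancelˡ-< 2 _ _ (begin-strict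
      2 * weight f A                       ≡⟨ cong (2 *_) (weight≡total f A) ⟩
      2 * total (value f) A                <⟨ m<m+n _ (≤-<-trans z≤n (p⊂q⇒∣p∣<∣q∣ (⊥⊆ , x , x∈p∧x∉q⇒x∈p─q x∈A x∉B , ∉⊥))) ⟩
      2 * total (value f) A + ∣ A ─ B ∣    ≤⟨ refined-max s bA ⟩
      2 * total (value f) B                ≡⟨ cong (2 *_) (weight≡total f B) ⟨
      2 * weight f B                       ∎)))
      where open ≤-Reasoning

-- Laminar matroids of chains

module _ {P : Pred (Subset d) 0ℓ} (P? : Decidable P) (P⊥ : P ⊥)
         (hereditary : ∀ {I J} → I ⊑ J → P J → P I) (augment : Augmentable P) where

  private
    Max : Pred (Subset d) 0ℓ
    Max B = P B × (∀ A → P A → ∣ A ∣ ≤ ∣ B ∣)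

    max : ∃ Max
    max = let (B , PB , maximal) = argmax anySubset? P? ∣_∣ d ∣p∣≤n (⊥ , P⊥) in
      B , PB , λ A → maximal {A}

  maximalIndependents : Matroid d
  IsBasis maximalIndependents = Max
  isBasis? maximalIndependents B = P? B ×-dec allSubsets? (λ A → P? A →-dec ∣ A ∣ ≤? ∣ B ∣)
  nonempty maximalIndependents = max
  exchange maximalIndependents {A} {B} (PA , maxA) (PB , maxB) {x} x∈A x∉B
    with augment (hereditary (p─q⊆p A ⁅ x ⁆) PA) PB (<-≤-trans (x∈p⇒∣p-x∣<∣p∣ x∈A) (maxB A PA))
  ... | y , y∈B , y∉A-x , PA′ = y , y∈B , y∉A , PA′ , λ C PC →
    ≤-trans (maxA C PC) (≤-reflexive (sym (∣p-x∪⁅y⁆∣≡∣p∣ x∈A y∉A)))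
    where
    y∉A : y ∉ A
    y∉A y∈A = y∉A-x (x∈p∧x≢y⇒x∈p-y y∈A λ { refl → x∉B y∈B })

  independent⁺ : ∀ {I} → P I → Independent maximalIndependents I
  independent⁺ {I} PI = let (B , PB , maxB) = max
                            (K , PK , I⊑K , _ , eq) = extend-to augment PI PB (maxB I PI) in
    K , (PK , λ A PA → ≤-trans (maxB A PA) (≤-reflexive (sym eq))) , I⊑K

  independent⁻ : ∀ {I} → Independent maximalIndependents I → P I
  independent⁻ (B , (PB , _) , I⊑B) = hereditary I⊑B PB

-- X ⊑ Y₁ ⊑ … ⊑ Yₖ, where σᵢ bounds the rank of Yᵢ.
data Chain {d : ℕ} (X : Subset d) : Set where
  []   : Chain {d} X
  step : (Y : Subset d) (σ : ℕ) → X ⊑ Y → Chain Y → Chain {d} X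

AllC : (Subset d → ℕ → Set) → Chain {d} X → Set
AllC P [] = Unit.⊤
AllC P (step Y σ _ c) = P Y σ × AllC P c

AllC-map : {P Q : Subset d → ℕ → Set} → (∀ Y σ → P Y σ → Q Y σ) → (c : Chain {d} X) → AllC P c → AllC Q c
AllC-map f [] _ = _
AllC-map f (step Y σ _ c) (p , ps) = f Y σ p , AllC-map f c ps

AllC-zip : {P Q R : Subset d → ℕ → Set} → (∀ Y σ → P Y σ → Q Y σ → R Y σ) →
  (c : Chain {d} X) → AllC P c → AllC Q c → AllC R c
AllC-zip f [] _ _ = _
AllC-zip f (step Y σ _ c) (p , ps) (q , qs) = f Y σ p q , AllC-zip f c ps qs

allC? : {P : Subset d → ℕ → Set} → (∀ Y σ → Dec (P Y σ)) → (c : Chain {d} X) → Dec (AllC P c)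
allC? P? [] = yes _
allC? P? (step Y σ _ c) = P? Y σ ×-dec allC? P? c

Sat : Chain {d} X → Pred (Subset d) 0ℓ
Sat c I = AllC (λ Y σ → ∣ I ∩ Y ∣ ≤ σ) c

sat? : (c : Chain {d} X) → Decidable (Sat c)
sat? c I = allC? (λ Y σ → ∣ I ∩ Y ∣ ≤? σ) c

sat-⊑ : (c : Chain {d} X) → I ⊑ J → Sat c J → Sat c I
sat-⊑ c I⊑J = AllC-map (λ Y σ → ≤-trans (p⊆q⇒∣p∣≤∣q∣ (∩-monoˡ-⊑ Y I⊑J))) c

sat-⊥ : (c : Chain {d} X) → Sat c ⊥
sat-⊥ [] = _
sat-⊥ {d} (step Y σ _ c) =
  ≤-trans (∣p∩q∣≤∣p∣ ⊥ Y) (≤-trans (≤-reflexive (∣⊥∣≡0 d)) z≤n) , sat-⊥ c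

-- The element to add lies outside the largest tight member of the chain.
chain-augment : (c : Chain Z) → X ⊑ Z → Sat c I →
  AllC (λ Y σ → σ ≤ ∣ I ∩ Y ∣ → ∣ I ─ Y ∣ < ∣ J ─ Y ∣) c → ∣ I ─ X ∣ < ∣ J ─ X ∣ →
  ∃[ y ] y ∈ J × y ∉ I × y ∉ X × Sat c (I ∪ ⁅ y ⁆)
chain-augment {X = X} {I} {J} [] _ _ _ I<J with ∣p∣<∣q∣⇒∃∉ (I ─ X) (J ─ X) I<J
... | y , y∈ , y∉ = let (y∈J , y∉X) = x∈p─q⁻ J X y∈ in
  y , y∈J , (λ y∈I → y∉ (x∈p∧x∉q⇒x∈p─q y∈I y∉X)) , y∉X , _
chain-augment {X = X} {I} {J} (step Y σ Z⊑Y c) X⊑Z (I≤σ , sat) (tight , hyp) I<J with σ ≤? ∣ I ∩ Y ∣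
-- A tight `Y` replaces `X` as the set to avoid. An element outside `Y` also lies outside every
-- earlier tight member, since the chain increases.
... | yes σ≤I with chain-augment c id sat hyp (tight σ≤I)
...   | y , y∈J , y∉I , y∉Y , sat′ = y , y∈J , y∉I , (λ y∈X → y∉Y (Z⊑Y (X⊑Z y∈X))) ,
  ≤-trans (p⊆q⇒∣p∣≤∣q∣ I+y∩Y⊑) I≤σ , sat′
  where
  I+y∩Y⊑ : (I ∪ ⁅ y ⁆) ∩ Y ⊑ I ∩ Y
  I+y∩Y⊑ z∈ with x∈p∩q⁻ (I ∪ ⁅ y ⁆) Y z∈
  ... | z∈I+y , z∈Y with x∈p∪q⁻ I ⁅ y ⁆ z∈I+y
  ... | inj₁ z∈I = x∈p∩q⁺ (z∈I , z∈Y)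
  ... | inj₂ z∈y rewrite x∈⁅y⁆⇒x≡y y z∈y = contradiction z∈Y y∉Y
chain-augment {X = X} {I} {J} (step Y σ Z⊑Y c) X⊑Z (I≤σ , sat) (tight , hyp) I<J | no σ≰I
  with chain-augment c (λ z∈X → Z⊑Y (X⊑Z z∈X)) sat hyp I<J
... | y , y∈J , y∉I , y∉X , sat′ = y , y∈J , y∉I , y∉X ,
  ≤-trans (≤-trans (p⊆q⇒∣p∣≤∣q∣ I+y∩Y⊑) (∣p∪⁅x⁆∣≤1+∣p∣ (I ∩ Y) y)) (≰⇒> σ≰I) , sat′
  where
  I+y∩Y⊑ : (I ∪ ⁅ y ⁆) ∩ Y ⊑ (I ∩ Y) ∪ ⁅ y ⁆
  I+y∩Y⊑ z∈ with x∈p∩q⁻ (I ∪ ⁅ y ⁆) Y z∈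
  ... | z∈I+y , z∈Y with x∈p∪q⁻ I ⁅ y ⁆ z∈I+y
  ... | inj₁ z∈I = p⊆p∪q ⁅ y ⁆ (x∈p∩q⁺ (z∈I , z∈Y))
  ... | inj₂ z∈y = q⊆p∪q (I ∩ Y) ⁅ y ⁆ z∈y

sat-augment : (c : Chain {d} ⊥) → Augmentable (Sat c)
sat-augment c {I} {J} satI satJ I<J =
  let (y , y∈J , y∉I , _ , sat) = chain-augment c id satI
        (AllC-map tight c satJ) (subst₂ _<_ (cong ∣_∣ (sym (p─⊥≡p I))) (cong ∣_∣ (sym (p─⊥≡p J))) I<J)
  in y , y∈J , y∉I , sat
  where
  tight : ∀ Y σ → ∣ J ∩ Y ∣ ≤ σ → σ ≤ ∣ I ∩ Y ∣ → ∣ I ─ Y ∣ < ∣ J ─ Y ∣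
  tight Y σ J≤σ σ≤I = +-cancelˡ-< ∣ I ∩ Y ∣ _ _ (begin-strict
    ∣ I ∩ Y ∣ + ∣ I ─ Y ∣    ≡⟨ ∣p∣≡∣p∩q∣+∣p─q∣ I Y ⟨
    ∣ I ∣                    <⟨ I<J ⟩
    ∣ J ∣                    ≡⟨ ∣p∣≡∣p∩q∣+∣p─q∣ J Y ⟩
    ∣ J ∩ Y ∣ + ∣ J ─ Y ∣    ≤⟨ +-monoˡ-≤ ∣ J ─ Y ∣ (≤-trans J≤σ σ≤I) ⟩
    ∣ I ∩ Y ∣ + ∣ J ─ Y ∣    ∎)
    where open ≤-Reasoning

laminar : Chain {d} ⊥ → Matroid d
laminar c = maximalIndependents (sat? c) (sat-⊥ c) (sat-⊑ c) (sat-augment c)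

laminar-independent⁺ : (c : Chain {d} ⊥) → Sat c I → Independent (laminar c) I
laminar-independent⁺ c = independent⁺ (sat? c) (sat-⊥ c) (sat-⊑ c) (sat-augment c)

laminar-independent⁻ : (c : Chain {d} ⊥) → Independent (laminar c) I → Sat c I
laminar-independent⁻ c = independent⁻ (sat? c) (sat-⊥ c) (sat-⊑ c) (sat-augment c)

-- `chain-augment` does not ask that `J` satisfy the constraints, so it applies with `J = S`: a
-- largest independent subset of `S` with fewer than `n` elements could still be enlarged inside
-- `S`.
rank-laminar⁺ : (c : Chain {d} ⊥) (S : Subset d) {n : ℕ} →
  n ≤ ∣ S ∣ → AllC (λ Y σ → n ≤ σ + ∣ S ─ Y ∣) c → n ≤ rank (laminar c) S
rank-laminar⁺ c S {n} n≤S n≤c with rank-attained (laminar c) S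
... | B , bB , eq = ≮⇒≥ λ r<n → extendable (subst (_< n) (sym eq) r<n)
  where
  K = B ∩ S
  satK : Sat c K
  satK = sat-⊑ c (p∩q⊆p B S) (proj₁ bB)
  extendable : ¬ (∣ K ∣ < n)
  extendable K<n with chain-augment {I = K} {S} c id satK (AllC-map tight c n≤c)
    (subst₂ _<_ (cong ∣_∣ (sym (p─⊥≡p K))) (cong ∣_∣ (sym (p─⊥≡p S))) (<-≤-trans K<n n≤S))
    where
    open ≤-Reasoning
    tight : ∀ Y σ → n ≤ σ + ∣ S ─ Y ∣ → σ ≤ ∣ K ∩ Y ∣ → ∣ K ─ Y ∣ < ∣ S ─ Y ∣
    tight Y σ n≤ σ≤K = +-cancelˡ-< ∣ K ∩ Y ∣ _ _ (begin-strict
      ∣ K ∩ Y ∣ + ∣ K ─ Y ∣    ≡⟨ ∣p∣≡∣p∩q∣+∣p─q∣ K Y ⟨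
      ∣ K ∣                    <⟨ K<n ⟩
      n                        ≤⟨ n≤ ⟩
      σ + ∣ S ─ Y ∣            ≤⟨ +-monoˡ-≤ ∣ S ─ Y ∣ σ≤K ⟩
      ∣ K ∩ Y ∣ + ∣ S ─ Y ∣    ∎)
  ... | y , y∈S , y∉K , _ , sat = <⇒≱ (≤-reflexive (sym (∣p∪⁅x⁆∣≡1+∣p∣ y∉K)))
    (≤-trans (∣independent∣≤rank (laminar c) (laminar-independent⁺ c sat) (p∪⁅x⁆⊑q (p∩q⊆q B S) y∈S))
      (≤-reflexive (sym eq)))

rank-laminar⁻ : (c : Chain {d} ⊥) (S : Subset d) →
  AllC (λ Y σ → rank (laminar c) S ≤ σ + ∣ S ─ Y ∣) c
rank-laminar⁻ c S with rank-attained (laminar c) S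
... | B , (satB , _) , eq = AllC-map (λ Y σ B≤σ → begin
    rank (laminar c) S                    ≡⟨ eq ⟨
    ∣ B ∩ S ∣                             ≡⟨ ∣p∣≡∣p∩q∣+∣p─q∣ (B ∩ S) Y ⟩
    ∣ (B ∩ S) ∩ Y ∣ + ∣ (B ∩ S) ─ Y ∣     ≤⟨ +-mono-≤ (p⊆q⇒∣p∣≤∣q∣ (∩-monoˡ-⊑ Y (p∩q⊆p B S)))
                                               (p⊆q⇒∣p∣≤∣q∣ (─-monoˡ-⊑ Y (p∩q⊆q B S))) ⟩
    ∣ B ∩ Y ∣ + ∣ S ─ Y ∣                 ≤⟨ +-monoˡ-≤ ∣ S ─ Y ∣ B≤σ ⟩
    σ + ∣ S ─ Y ∣                         ∎) c satB
  where open ≤-Reasoning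

-- Sums over subsets and over chains

infix 8 ⟦_⟧

⟦_⟧ : {P : Set} → Dec P → ℚ
⟦ P? ⟧ = if does P? then 1ℚ else 0ℚ

module _ {P : Set} (P? : Dec P) where

  ⟦⟧-true : P → ⟦ P? ⟧ ≡ 1ℚ
  ⟦⟧-true p = cong (if_then 1ℚ else 0ℚ) (dec-true P? p)

  ⟦⟧-false : ¬ P → ⟦ P? ⟧ ≡ 0ℚ
  ⟦⟧-false ¬p = cong (if_then 1ℚ else 0ℚ) (dec-false P? ¬p)

  ⟦⟧-cong : {Q : Set} (Q? : Dec Q) → (P → Q) → (Q → P) → ⟦ P? ⟧ ≡ ⟦ Q? ⟧
  ⟦⟧-cong Q? P⇒Q Q⇒P = cong (if_then 1ℚ else 0ℚ) (does-⇔ (mk⇔ P⇒Q Q⇒P) P? Q?)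

  ⟦⟧-× : {Q : Set} (Q? : Dec Q) → ⟦ P? ×-dec Q? ⟧ ≡ ⟦ P? ⟧ ℚ.* ⟦ Q? ⟧
  ⟦⟧-× Q? with does P?
  ... | true = sym (ℚₚ.*-identityˡ ⟦ Q? ⟧)
  ... | false = sym (ℚₚ.*-zeroˡ ⟦ Q? ⟧)

neg≡-1* : ∀ q → ℚ.- q ≡ ℚ.- 1ℚ ℚ.* q
neg≡-1* q = trans (cong ℚ.-_ (sym (ℚₚ.*-identityˡ q))) (ℚₚ.neg-distribˡ-* 1ℚ q)

∑ : (Subset d → ℚ) → ℚ
∑ {zero} g = g []
∑ {suc d} g = ∑ (g ∘ (false ∷_)) ℚ.+ ∑ (g ∘ (true ∷_))

∑-cong : {g h : Subset d → ℚ} → (∀ Y → g Y ≡ h Y) → ∑ g ≡ ∑ h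
∑-cong {zero} eq = eq []
∑-cong {suc d} eq = cong₂ ℚ._+_ (∑-cong (eq ∘ (false ∷_))) (∑-cong (eq ∘ (true ∷_)))

∑-+ : (g h : Subset d → ℚ) → ∑ (λ Y → g Y ℚ.+ h Y) ≡ ∑ g ℚ.+ ∑ h
∑-+ {zero} g h = refl
∑-+ {suc d} g h = trans
  (cong₂ ℚ._+_ (∑-+ (g ∘ (false ∷_)) (h ∘ (false ∷_))) (∑-+ (g ∘ (true ∷_)) (h ∘ (true ∷_))))
  (solve 4 (λ a b c e → (a :+ b) :+ (c :+ e) := (a :+ c) :+ (b :+ e)) refl
    (∑ (g ∘ (false ∷_))) (∑ (h ∘ (false ∷_))) (∑ (g ∘ (true ∷_))) (∑ (h ∘ (true ∷_))))

∑-* : (k : ℚ) (g : Subset d → ℚ) → ∑ (λ Y → k ℚ.* g Y) ≡ k ℚ.* ∑ g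
∑-* {zero} k g = refl
∑-* {suc d} k g = trans (cong₂ ℚ._+_ (∑-* k (g ∘ (false ∷_))) (∑-* k (g ∘ (true ∷_))))
  (sym (ℚₚ.*-distribˡ-+ k _ _))

∑-zero : {g : Subset d → ℚ} → (∀ Y → g Y ≡ 0ℚ) → ∑ g ≡ 0ℚ
∑-zero {zero} eq = eq []
∑-zero {suc d} eq = trans (cong₂ ℚ._+_ (∑-zero (eq ∘ (false ∷_))) (∑-zero (eq ∘ (true ∷_)))) (ℚₚ.+-identityˡ 0ℚ)

∑-single : {g : Subset d → ℚ} (Z : Subset d) → (∀ Y → Y ≢ Z → g Y ≡ 0ℚ) → ∑ g ≡ g Z
∑-single [] eq = refl
∑-single (false ∷ Z) eq = trans
  (cong₂ ℚ._+_ (∑-single Z λ Y Y≢Z → eq (false ∷ Y) λ { refl → Y≢Z refl }) (∑-zero λ Y → eq (true ∷ Y) λ ()))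
  (ℚₚ.+-identityʳ _)
∑-single (true ∷ Z) eq = trans
  (cong₂ ℚ._+_ (∑-zero λ Y → eq (false ∷ Y) λ ()) (∑-single Z λ Y Y≢Z → eq (true ∷ Y) λ { refl → Y≢Z refl }))
  (ℚₚ.+-identityˡ _)

∑-pairs : (x : Fin d) (g : Subset d → ℚ) →
  ∑ g ≡ ∑ (λ Y → if does (x ∈? Y) then 0ℚ else g Y ℚ.+ g (Y ∪ ⁅ x ⁆))
∑-pairs {suc d} zero g = begin
  ∑ (g ∘ (false ∷_)) ℚ.+ ∑ (g ∘ (true ∷_))                       ≡⟨ ∑-+ (g ∘ (false ∷_)) (g ∘ (true ∷_)) ⟨
  ∑ (λ Y → g (false ∷ Y) ℚ.+ g (true ∷ Y))                       ≡⟨ ∑-cong (λ Y → cong (λ Z → g (false ∷ Y) ℚ.+ g (true ∷ Z)) (∪-identityʳ Y)) ⟨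
  ∑ (λ Y → g (false ∷ Y) ℚ.+ g (true ∷ (Y ∪ ⊥)))                 ≡⟨ ℚₚ.+-identityʳ _ ⟨
  ∑ (λ Y → g (false ∷ Y) ℚ.+ g (true ∷ (Y ∪ ⊥))) ℚ.+ 0ℚ          ≡⟨ cong (∑ (λ Y → g (false ∷ Y) ℚ.+ g (true ∷ (Y ∪ ⊥))) ℚ.+_) (∑-zero {d} (λ Y → refl)) ⟨
  _                                                              ∎
  where open ≡-Reasoning
∑-pairs (suc x) g = cong₂ ℚ._+_ (∑-pairs x (g ∘ (false ∷_))) (∑-pairs x (g ∘ (true ∷_)))

module _ (r : Subset d → ℕ) where

  -- The sum over chains X ⊏ Y₁ ⊏ … ⊏ Yₖ = ⊤ of (-1)ᵏ F, for n larger than d − ∣ X ∣.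
  chainSum : ℕ → (X : Subset d) → (Chain X → ℚ) → ℚ
  chainTerm : ℕ → (X Y : Subset d) → Dec (X ⊏ Y) → (Chain X → ℚ) → ℚ

  chainSum zero X F = 0ℚ
  chainSum (suc n) X F = ⟦ Vecₚ.≡-dec Boolₚ._≟_ X ⊤ ⟧ ℚ.* F [] ℚ.- ∑ (λ Y → chainTerm n X Y (X ⊂? Y) F)

  chainTerm n X Y (yes X⊏Y) F = chainSum n Y (λ c → F (step Y (r Y) (p⊂q⇒p⊆q X⊏Y) c))
  chainTerm n X Y (no _) F = 0ℚ

  private
    δ : Subset d → ℚ
    δ X = ⟦ Vecₚ.≡-dec Boolₚ._≟_ X ⊤ ⟧

  chainSum-cong : ∀ n X {F F′ : Chain X → ℚ} → (∀ c → F c ≡ F′ c) → chainSum n X F ≡ chainSum n X F′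
  chainTerm-cong : ∀ n X Y X⊂?Y {F F′ : Chain X → ℚ} → (∀ c → F c ≡ F′ c) →
    chainTerm n X Y X⊂?Y F ≡ chainTerm n X Y X⊂?Y F′
  chainSum-cong zero X eq = refl
  chainSum-cong (suc n) X eq = cong₂ ℚ._-_ (cong (δ X ℚ.*_) (eq []))
    (∑-cong λ Y → chainTerm-cong n X Y (X ⊂? Y) eq)
  chainTerm-cong n X Y (yes X⊏Y) eq = chainSum-cong n Y (λ c → eq _)
  chainTerm-cong n X Y (no _) eq = refl

  chainSum-+ : ∀ n X (F F′ : Chain X → ℚ) →
    chainSum n X (λ c → F c ℚ.+ F′ c) ≡ chainSum n X F ℚ.+ chainSum n X F′
  chainTerm-+ : ∀ n X Y X⊂?Y (F F′ : Chain X → ℚ) →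
    chainTerm n X Y X⊂?Y (λ c → F c ℚ.+ F′ c) ≡ chainTerm n X Y X⊂?Y F ℚ.+ chainTerm n X Y X⊂?Y F′
  chainSum-+ zero X F F′ = sym (ℚₚ.+-identityˡ 0ℚ)
  chainSum-+ (suc n) X F F′ = trans
    (cong (λ s → δ X ℚ.* (F [] ℚ.+ F′ []) ℚ.- s)
      (trans (∑-cong λ Y → chainTerm-+ n X Y (X ⊂? Y) F F′) (∑-+ {d} _ _)))
    (solve 5 (λ e a b s t → e :* (a :+ b) :- (s :+ t) := (e :* a :- s) :+ (e :* b :- t)) refl
      (δ X) (F []) (F′ []) (∑ (λ Y → chainTerm n X Y (X ⊂? Y) F)) (∑ (λ Y → chainTerm n X Y (X ⊂? Y) F′)))
  chainTerm-+ n X Y (yes _) F F′ = chainSum-+ n Y _ _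
  chainTerm-+ n X Y (no _) F F′ = sym (ℚₚ.+-identityˡ 0ℚ)

  chainSum-* : ∀ n X k (F : Chain X → ℚ) → chainSum n X (λ c → k ℚ.* F c) ≡ k ℚ.* chainSum n X F
  chainTerm-* : ∀ n X Y X⊂?Y k (F : Chain X → ℚ) →
    chainTerm n X Y X⊂?Y (λ c → k ℚ.* F c) ≡ k ℚ.* chainTerm n X Y X⊂?Y F
  chainSum-* zero X k F = sym (ℚₚ.*-zeroʳ k)
  chainSum-* (suc n) X k F = trans
    (cong (λ s → δ X ℚ.* (k ℚ.* F []) ℚ.- s)
      (trans (∑-cong λ Y → chainTerm-* n X Y (X ⊂? Y) k F) (∑-* {d} k _)))
    (solve 4 (λ e k a s → e :* (k :* a) :- k :* s := k :* (e :* a :- s)) refl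
      (δ X) k (F []) (∑ (λ Y → chainTerm n X Y (X ⊂? Y) F)))
  chainTerm-* n X Y (yes _) k F = chainSum-* n Y k _
  chainTerm-* n X Y (no _) k F = sym (ℚₚ.*-zeroʳ k)

  chainSum-- : ∀ n X (F F′ : Chain X → ℚ) →
    chainSum n X (λ c → F c ℚ.- F′ c) ≡ chainSum n X F ℚ.- chainSum n X F′
  chainSum-- n X F F′ = begin
    chainSum n X (λ c → F c ℚ.- F′ c)                                 ≡⟨ chainSum-cong n X (λ c → cong (F c ℚ.+_) (neg≡-1* (F′ c))) ⟩
    chainSum n X (λ c → F c ℚ.+ ℚ.- 1ℚ ℚ.* F′ c)                      ≡⟨ chainSum-+ n X F _ ⟩
    chainSum n X F ℚ.+ chainSum n X (λ c → ℚ.- 1ℚ ℚ.* F′ c)           ≡⟨ cong (chainSum n X F ℚ.+_) (chainSum-* n X (ℚ.- 1ℚ) F′) ⟩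
    chainSum n X F ℚ.+ ℚ.- 1ℚ ℚ.* chainSum n X F′                     ≡⟨ cong (chainSum n X F ℚ.+_) (neg≡-1* _) ⟨
    chainSum n X F ℚ.- chainSum n X F′                                ∎
    where open ≡-Reasoning

  chainSum-∑ : ∀ {e} n X (F : Subset e → Chain X → ℚ) →
    chainSum n X (λ c → ∑ (λ B → F B c)) ≡ ∑ (λ B → chainSum n X (F B))
  chainSum-∑ {zero} n X F = refl
  chainSum-∑ {suc e} n X F = trans (chainSum-+ n X _ _)
    (cong₂ ℚ._+_ (chainSum-∑ n X (F ∘ (false ∷_))) (chainSum-∑ n X (F ∘ (true ∷_))))

  -- Each link enlarges the set, so fuel beyond `d − ∣ X ∣` is never spent. This lets terms with
  -- different fuel be compared in the cancellation.
  chainSum-stable : ∀ n m X (F : Chain X → ℚ) → d < n + ∣ X ∣ → d < m + ∣ X ∣ →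
    chainSum n X F ≡ chainSum m X F
  chainSum-stable zero m X F d<n _ = contradiction (∣p∣≤n X) (<⇒≱ d<n)
  chainSum-stable (suc n) zero X F _ d<m = contradiction (∣p∣≤n X) (<⇒≱ d<m)
  chainSum-stable (suc n) (suc m) X F d<n d<m = cong (λ s → δ X ℚ.* F [] ℚ.- s) (∑-cong λ Y → same Y (X ⊂? Y))
    where
    same : ∀ Y X⊂?Y → chainTerm n X Y X⊂?Y F ≡ chainTerm m X Y X⊂?Y F
    same Y (yes X⊏Y) = chainSum-stable n m Y _ (raise n d<n) (raise m d<m)
      where
      raise : ∀ k → d < suc k + ∣ X ∣ → d < k + ∣ Y ∣
      raise k d<k = <-≤-trans d<k (≤-trans (≤-reflexive (sym (+-suc k ∣ X ∣))) (+-monoʳ-≤ k (p⊂q⇒∣p∣<∣q∣ X⊏Y)))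
    same Y (no _) = refl

-- The alternating sum over chains

chainProduct : (Subset d → ℕ → ℚ) → Chain {d} X → ℚ
chainProduct a [] = 1ℚ
chainProduct a (step Y σ _ c) = a Y σ ℚ.* chainProduct a c

⊏-∪⁅x⁆ : {x : Fin d} → x ∉ Z → Z ⊏ Z ∪ ⁅ x ⁆
⊏-∪⁅x⁆ {Z = Z} {x} x∉Z = p⊆p∪q ⁅ x ⁆ , x , x∈p∪⁅x⁆ Z x , x∉Z

⊑∧≢⇒⊏ : X ⊑ Y → Y ≢ X → X ⊏ Y
⊑∧≢⇒⊏ {X = X} {Y} X⊑Y Y≢X with ⊑⊎∃∉ Y X
... | inj₁ Y⊑X = contradiction (⊆-antisym Y⊑X X⊑Y) Y≢X
... | inj₂ missing = X⊑Y , missing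

module _ (r : Subset d → ℕ) (a : Subset d → ℕ → ℚ) where

  α : Subset d → ℚ
  α Y = a Y (r Y)

  G : ℕ → Subset d → ℚ
  G n Y = chainSum r n Y (chainProduct a)

  -- Up to sign, the contribution of the chains whose next member is `Y`.
  H : ℕ → Subset d → ℚ
  H n Y = α Y ℚ.* G n Y

  private
    term : ℕ → (X Y : Subset d) → ℚ
    term n X Y = chainTerm r n X Y (X ⊂? Y) (chainProduct a)

    term-⊏ : ∀ n {X Y} → X ⊏ Y → term n X Y ≡ H n Y
    term-⊏ n {X} {Y} X⊏Y with X ⊂? Y
    ... | yes X⊏′Y = chainSum-* r n Y (α Y) (chainProduct a)
    ... | no X⊄Y = contradiction X⊏Y X⊄Y

    term-⊄ : ∀ n {X Y} → ¬ (X ⊏ Y) → term n X Y ≡ 0ℚ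
    term-⊄ n {X} {Y} X⊄Y with X ⊂? Y
    ... | yes X⊏Y = contradiction X⊏Y X⊄Y
    ... | no _ = refl

  H-stable : ∀ n m X → d < n + ∣ X ∣ → d < m + ∣ X ∣ → H n X ≡ H m X
  H-stable n m X d<n d<m = cong (α X ℚ.*_) (chainSum-stable r n m X (chainProduct a) d<n d<m)

  -- All terms of the recursion for H n Z cancel in pairs (Y , Y ∪ ⁅ x ⁆) except for H n (Z ∪ ⁅ x ⁆).
  H-cancel : (W : Subset d) (x : Fin d) →
    (∀ Z → W ⊑ Z → x ∉ Z → α (Z ∪ ⁅ x ⁆) ≡ α Z ℚ.* α (Z ∪ ⁅ x ⁆)) →
    ∀ n Z → W ⊑ Z → x ∉ Z → d < n + ∣ Z ∣ → H n Z ℚ.+ H n (Z ∪ ⁅ x ⁆) ≡ 0ℚ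
  H-cancel W x closed zero Z W⊑Z x∉Z d<n = contradiction (∣p∣≤n Z) (<⇒≱ d<n)
  -- Since only `H` at `Z ∪ ⁅ x ⁆` survives in the recursion, the claim reduces to `closed`: the
  -- factor at `Z ∪ ⁅ x ⁆` absorbs the factor at `Z`.
  H-cancel W x closed (suc n) Z W⊑Z x∉Z d<n = begin
    α Z ℚ.* (⟦ Z≟⊤ ⟧ ℚ.* 1ℚ ℚ.- ∑ (term n Z)) ℚ.+ H (suc n) Z+x       ≡⟨ cong₂ (λ e s → α Z ℚ.* (e ℚ.* 1ℚ ℚ.- s) ℚ.+ H (suc n) Z+x) (⟦⟧-false Z≟⊤ Z≢⊤) sum≡ ⟩
    α Z ℚ.* (0ℚ ℚ.* 1ℚ ℚ.- H (suc n) Z+x) ℚ.+ H (suc n) Z+x           ≡⟨ solve 3 (λ a b g → a :* (con 0ℚ :* con 1ℚ :- b :* g) :+ b :* g := b :* g :- a :* b :* g) refl (α Z) (α Z+x) (G (suc n) Z+x) ⟩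
    H (suc n) Z+x ℚ.- α Z ℚ.* α Z+x ℚ.* G (suc n) Z+x                 ≡⟨ cong (λ b → H (suc n) Z+x ℚ.- b ℚ.* G (suc n) Z+x) (closed Z W⊑Z x∉Z) ⟨
    H (suc n) Z+x ℚ.- H (suc n) Z+x                                   ≡⟨ ℚₚ.+-inverseʳ (H (suc n) Z+x) ⟩
    0ℚ                                                                ∎
    where
    open ≡-Reasoning
    Z+x = Z ∪ ⁅ x ⁆
    Z≟⊤ = Vecₚ.≡-dec Boolₚ._≟_ Z ⊤
    Z≢⊤ : Z ≢ ⊤
    Z≢⊤ refl = x∉Z ∈⊤
    raise : ∀ {Y} → Z ⊏ Y → d < n + ∣ Y ∣
    raise Z⊏Y = <-≤-trans d<n (≤-trans (≤-reflexive (sym (+-suc n ∣ Z ∣))) (+-monoʳ-≤ n (p⊂q⇒∣p∣<∣q∣ Z⊏Y)))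
    pair : Subset d → ℚ
    pair Y = if does (x ∈? Y) then 0ℚ else term n Z Y ℚ.+ term n Z (Y ∪ ⁅ x ⁆)
    pair-∉ : ∀ {Y} → x ∉ Y → pair Y ≡ term n Z Y ℚ.+ term n Z (Y ∪ ⁅ x ⁆)
    pair-∉ {Y} x∉Y = cong (if_then 0ℚ else (term n Z Y ℚ.+ term n Z (Y ∪ ⁅ x ⁆))) (dec-false (x ∈? Y) x∉Y)
    remove-x : ∀ {Y} → Z ⊑ Y ∪ ⁅ x ⁆ → Z ⊑ Y
    remove-x {Y} Z⊑Y+x {z} z∈Z with x∈p∪q⁻ Y ⁅ x ⁆ (Z⊑Y+x z∈Z)
    ... | inj₁ z∈Y = z∈Y
    ... | inj₂ z∈x = contradiction (subst (_∈ Z) (x∈⁅y⁆⇒x≡y x z∈x) z∈Z) x∉Z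
    -- Above `Z`, a pair cancels by induction on the fuel. Elsewhere both terms are absent: as
    -- `x ∉ Z`, adding `x` to `Y` cannot help it contain `Z`.
    vanish : ∀ Y → Y ≢ Z → pair Y ≡ 0ℚ
    vanish Y Y≢Z = case x ∈? Y of λ where
      (yes x∈Y) → cong (if_then 0ℚ else (term n Z Y ℚ.+ term n Z (Y ∪ ⁅ x ⁆))) (dec-true (x ∈? Y) x∈Y)
      (no x∉Y) → trans (pair-∉ x∉Y) (case Z ⊆? Y of λ where
        (yes Z⊑Y) → let Z⊏Y = ⊑∧≢⇒⊏ Z⊑Y Y≢Z in trans
          (cong₂ ℚ._+_ (term-⊏ n Z⊏Y) (term-⊏ n (⊂-⊆-trans Z⊏Y (p⊆p∪q ⁅ x ⁆))))
          (H-cancel W x closed n Y (λ w∈W → Z⊑Y (W⊑Z w∈W)) x∉Y (raise Z⊏Y))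
        (no Z⋢Y) → trans
          (cong₂ ℚ._+_ (term-⊄ n (λ Z⊏Y → Z⋢Y (proj₁ Z⊏Y))) (term-⊄ n λ Z⊏Y+x → Z⋢Y (remove-x (proj₁ Z⊏Y+x))))
          (ℚₚ.+-identityˡ 0ℚ))
    sum≡ : ∑ (term n Z) ≡ H (suc n) Z+x
    sum≡ = begin
      ∑ (term n Z)                       ≡⟨ ∑-pairs x (term n Z) ⟩
      ∑ pair                             ≡⟨ ∑-single Z vanish ⟩
      pair Z                             ≡⟨ pair-∉ x∉Z ⟩
      term n Z Z ℚ.+ term n Z Z+x        ≡⟨ cong₂ ℚ._+_ (term-⊄ n {Z} {Z} (⊂-irref refl)) (term-⊏ n (⊏-∪⁅x⁆ x∉Z)) ⟩
      0ℚ ℚ.+ H n Z+x                     ≡⟨ ℚₚ.+-identityˡ _ ⟩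
      H n Z+x                            ≡⟨ H-stable n (suc n) Z+x (raise (⊏-∪⁅x⁆ x∉Z)) (m≤n⇒m≤1+n (raise (⊏-∪⁅x⁆ x∉Z))) ⟩
      H (suc n) Z+x                      ∎

-- Rank bounds on upper sets, one element at a time

sign : ℕ → ℚ
sign zero = 1ℚ
sign (suc n) = ℚ.- sign n

RankBound : (Subset d → ℕ) → (Fin d → ℕ) → ℕ × ℕ → Set
RankBound r v (t , b) = b ≤ r (upper v t)

module _ (M : Matroid d) (v : Fin d → ℕ) (Φ : List (ℕ × ℕ)) where
  private
    r = rank M
    U = upper v

  rankBounds? : (r : Subset d → ℕ) → Dec (All (RankBound r v) Φ)
  rankBounds? r = All.all? (λ (t , b) → b ≤? r (U t)) Φ

  Admits : Subset d → ℕ → Set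
  Admits Y σ = All (λ (t , b) → b ≤ σ + ∣ U t ─ Y ∣) Φ

  admits? : ∀ Y σ → Dec (Admits Y σ)
  admits? Y σ = All.all? (λ (t , b) → b ≤? σ + ∣ U t ─ Y ∣) Φ

  admitsIndicator : Subset d → ℕ → ℚ
  admitsIndicator Y σ = ⟦ admits? Y σ ⟧

  private
    -- The part of the system already verified when the elements of `W` have been processed. At `⊥`
    -- it is a condition on the empty upper sets only, at `⊤` it is the whole system.
    BoundedBelow : Subset d → Set
    BoundedBelow W = All (λ (t , b) → U t ⊑ W → b ≤ r (U t)) Φ

    boundedBelow? : ∀ W → Dec (BoundedBelow W)
    boundedBelow? W = All.all? (λ (t , b) → U t ⊆? W →-dec b ≤? r (U t)) Φ

    Comparable : Subset d → Set
    Comparable W = ∀ t → U t ⊑ W ⊎ W ⊑ U t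

    H′ : ℕ → Subset d → ℚ
    H′ = H r admitsIndicator

    rankBounds⇒admits : All (RankBound r v) Φ → ∀ Y → Admits Y (r Y)
    rankBounds⇒admits bounds Y = All.map (λ {(t , b)} b≤r → ≤-trans b≤r (rank≤rank+∣─∣ M Y (U t))) bounds

    module _ (W : Subset d) (x : Fin d) (x∉W : x ∉ W) (x-max : ∀ {y} → y ∉ W → v y ≤ v x)
             (comparable : Comparable W) where

      below-or-above : ∀ t → U t ⊑ W ⊎ W ∪ ⁅ x ⁆ ⊑ U t
      below-or-above t with ⊑⊎∃∉ (U t) W | comparable t
      ... | inj₁ U⊑W | _ = inj₁ U⊑W
      ... | inj₂ (y , y∈U , y∉W) | inj₁ U⊑W = contradiction (U⊑W y∈U) y∉W
      ... | inj₂ (y , y∈U , y∉W) | inj₂ W⊑U =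
        inj₂ (p∪⁅x⁆⊑q W⊑U (∈-upper⁺ v {t} (≤-trans (∈-upper⁻ v {t} y∈U) (x-max y∉W))))

      comparable-∪ : Comparable (W ∪ ⁅ x ⁆)
      comparable-∪ t with below-or-above t
      ... | inj₁ U⊑W = inj₁ λ z∈U → p⊆p∪q ⁅ x ⁆ (U⊑W z∈U)
      ... | inj₂ W+x⊑U = inj₂ W+x⊑U

      -- An upper set inside `W ∪ ⁅ x ⁆` but not inside `W` equals `W ∪ ⁅ x ⁆`. Nothing of it lies
      -- outside, so admissibility there is the rank bound itself.
      admits-∪⇒boundedBelow : BoundedBelow W → Admits (W ∪ ⁅ x ⁆) (r (W ∪ ⁅ x ⁆)) → BoundedBelow (W ∪ ⁅ x ⁆)
      admits-∪⇒boundedBelow below admits = All.zipWith (λ {(t , b)} (below , admits) → bounded t below admits) (below , admits)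
        where
        bounded : ∀ t {b} → (U t ⊑ W → b ≤ r (U t)) → b ≤ r (W ∪ ⁅ x ⁆) + ∣ U t ─ (W ∪ ⁅ x ⁆) ∣ →
          U t ⊑ W ∪ ⁅ x ⁆ → b ≤ r (U t)
        bounded t {b} below admits U⊑W+x with below-or-above t
        ... | inj₁ U⊑W = below U⊑W
        ... | inj₂ W+x⊑U = begin
          b                                          ≤⟨ admits ⟩
          r (W ∪ ⁅ x ⁆) + ∣ U t ─ (W ∪ ⁅ x ⁆) ∣      ≡⟨ cong (r (W ∪ ⁅ x ⁆) +_) (trans (cong ∣_∣ empty) (∣⊥∣≡0 d)) ⟩
          r (W ∪ ⁅ x ⁆) + 0                          ≡⟨ +-identityʳ _ ⟩
          r (W ∪ ⁅ x ⁆)                              ≤⟨ rank-mono M W+x⊑U ⟩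
          r (U t)                                    ∎
          where
          open ≤-Reasoning
          empty : U t ─ (W ∪ ⁅ x ⁆) ≡ ⊥
          empty = Empty-unique λ (z , z∈) → let (z∈U , z∉) = x∈p─q⁻ (U t) (W ∪ ⁅ x ⁆) z∈ in z∉ (U⊑W+x z∈U)

      -- Upper sets inside `W` are covered by `BoundedBelow`. All others contain `x`, so removing
      -- `x` costs at most one in rank and returns one in `∣ U t ─ Z ∣`.
      admits-shrink : BoundedBelow W → ∀ Z → W ⊑ Z → x ∉ Z →
        Admits (Z ∪ ⁅ x ⁆) (r (Z ∪ ⁅ x ⁆)) → Admits Z (r Z)
      admits-shrink below Z W⊑Z x∉Z admits =
        All.zipWith (λ {(t , b)} (below , admits) → bounded t below admits) (below , admits)
        where
        bounded : ∀ t {b} → (U t ⊑ W → b ≤ r (U t)) → b ≤ r (Z ∪ ⁅ x ⁆) + ∣ U t ─ (Z ∪ ⁅ x ⁆) ∣ →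
          b ≤ r Z + ∣ U t ─ Z ∣
        bounded t {b} below admits with below-or-above t
        ... | inj₁ U⊑W = ≤-trans (below U⊑W)
          (≤-trans (rank-mono M (λ z∈U → W⊑Z (U⊑W z∈U))) (m≤m+n (r Z) _))
        ... | inj₂ W+x⊑U = begin
          b                                           ≤⟨ admits ⟩
          r (Z ∪ ⁅ x ⁆) + ∣ U t ─ (Z ∪ ⁅ x ⁆) ∣       ≤⟨ +-monoˡ-≤ _ rank-∪ ⟩
          r Z + 1 + ∣ U t ─ (Z ∪ ⁅ x ⁆) ∣             ≡⟨ +-assoc (r Z) 1 _ ⟩
          r Z + suc ∣ U t ─ (Z ∪ ⁅ x ⁆) ∣             ≡⟨ cong (λ S → r Z + suc ∣ S ∣) (p─q─r≡p─q∪r (U t) Z ⁅ x ⁆) ⟨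
          r Z + suc ∣ (U t ─ Z) - x ∣                 ≡⟨ cong (r Z +_) (1+∣p-x∣≡∣p∣ (x∈p∧x∉q⇒x∈p─q (W+x⊑U (x∈p∪⁅x⁆ W x)) x∉Z)) ⟩
          r Z + ∣ U t ─ Z ∣                           ∎
          where
          open ≤-Reasoning
          ⊑x : (Z ∪ ⁅ x ⁆) ─ Z ⊑ ⁅ x ⁆
          ⊑x z∈ with x∈p─q⁻ (Z ∪ ⁅ x ⁆) Z z∈
          ... | z∈Z+x , z∉Z with x∈p∪q⁻ Z ⁅ x ⁆ z∈Z+x
          ... | inj₁ z∈Z = contradiction z∈Z z∉Z
          ... | inj₂ z∈x = z∈x
          rank-∪ : r (Z ∪ ⁅ x ⁆) ≤ r Z + 1
          rank-∪ = ≤-trans (rank≤rank+∣─∣ M Z (Z ∪ ⁅ x ⁆))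
            (+-monoʳ-≤ (r Z) (≤-trans (p⊆q⇒∣p∣≤∣q∣ ⊑x) (≤-reflexive (∣⁅x⁆∣≡1 x))))

    -- Adding an element of largest value outside `W` keeps `W` comparable with all upper sets and
    -- flips the sign by `H-cancel`. If a bound fails at the enlarged set, the indicator there and
    -- the right-hand side are both zero; otherwise the induction runs up to `⊤`.
    H-value : ∀ k W → ∣ W ∣ + k ≡ d → Comparable W → BoundedBelow W → ∀ n → d < n + ∣ W ∣ →
      H′ n W ≡ sign k ℚ.* ⟦ rankBounds? r ⟧
    H-value k W eq comparable below zero d<n = contradiction (∣p∣≤n W) (<⇒≱ d<n)
    H-value zero W eq comparable below (suc n) d<n
      with refl ← ∣p∣≡n⇒p≡⊤ {p = W} (trans (sym (+-identityʳ ∣ W ∣)) eq) = begin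
      ⟦ admits? ⊤ (r ⊤) ⟧ ℚ.* (⟦ ⊤≟⊤ ⟧ ℚ.* 1ℚ ℚ.- ∑ (λ Y → chainTerm r n ⊤ Y (⊤ ⊂? Y) _))
        ≡⟨ cong₂ ℚ._*_ (⟦⟧-true (admits? ⊤ (r ⊤)) (rankBounds⇒admits bounds ⊤))
             (cong₂ (λ e s → e ℚ.* 1ℚ ℚ.- s) (⟦⟧-true ⊤≟⊤ refl) (∑-zero λ Y → no-term Y (⊤ ⊂? Y))) ⟩
      1ℚ ℚ.* 1ℚ
        ≡⟨ cong (1ℚ ℚ.*_) (⟦⟧-true (rankBounds? r) bounds) ⟨
      1ℚ ℚ.* ⟦ rankBounds? r ⟧ ∎
      where
      open ≡-Reasoning
      ⊤≟⊤ = Vecₚ.≡-dec Boolₚ._≟_ (⊤ {d}) ⊤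
      bounds : All (RankBound r v) Φ
      bounds = All.map (λ {(t , b)} below → below ⊆⊤) below
      no-term : ∀ Y ⊤⊂?Y → chainTerm r n ⊤ Y ⊤⊂?Y (chainProduct admitsIndicator) ≡ 0ℚ
      no-term Y (yes (_ , _ , _ , x∉⊤)) = contradiction ∈⊤ x∉⊤
      no-term Y (no _) = refl
    H-value (suc k) W eq comparable below (suc n) d<n
      with argmax any? (λ y → ¬? (y ∈? W)) v (proj₁ (bound v)) (proj₂ (bound v)) outside-W
      where
      outside-W : ∃[ x ] x ∉ W
      outside-W with ∣p∣<∣q∣⇒∃∉ W ⊤ (subst (∣ W ∣ <_) (trans eq (sym (∣⊤∣≡n d))) (m<m+n ∣ W ∣ z<s))
      ... | x , _ , x∉W = x , x∉W
    ... | x , x∉W , x-max = begin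
      H′ (suc n) W                                                        ≡⟨ solve 2 (λ a b → a := (a :+ b) :- b) refl _ (H′ (suc n) W+x) ⟩
      (H′ (suc n) W ℚ.+ H′ (suc n) W+x) ℚ.- H′ (suc n) W+x                ≡⟨ cong₂ ℚ._-_ cancel (value-∪ (boundedBelow? W+x)) ⟩
      0ℚ ℚ.- sign k ℚ.* ⟦ rankBounds? r ⟧                                 ≡⟨ solve 2 (λ s g → con 0ℚ :- s :* g := (:- s) :* g) refl (sign k) ⟦ rankBounds? r ⟧ ⟩
      sign (suc k) ℚ.* ⟦ rankBounds? r ⟧                                  ∎
      where
      open ≡-Reasoning
      W+x = W ∪ ⁅ x ⁆
      ∣W+x∣ = ∣p∪⁅x⁆∣≡1+∣p∣ x∉W
      closed : ∀ Z → W ⊑ Z → x ∉ Z → ⟦ admits? (Z ∪ ⁅ x ⁆) (r (Z ∪ ⁅ x ⁆)) ⟧ ≡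
        ⟦ admits? Z (r Z) ⟧ ℚ.* ⟦ admits? (Z ∪ ⁅ x ⁆) (r (Z ∪ ⁅ x ⁆)) ⟧
      closed Z W⊑Z x∉Z = trans
        (⟦⟧-cong A+ (A ×-dec A+) (λ a → admits-shrink W x x∉W x-max comparable below Z W⊑Z x∉Z a , a) proj₂)
        (⟦⟧-× A A+)
        where
        A = admits? Z (r Z)
        A+ = admits? (Z ∪ ⁅ x ⁆) (r (Z ∪ ⁅ x ⁆))
      cancel : H′ (suc n) W ℚ.+ H′ (suc n) W+x ≡ 0ℚ
      cancel = H-cancel r admitsIndicator W x closed (suc n) W id x∉W d<n
      value-∪ : Dec (BoundedBelow W+x) → H′ (suc n) W+x ≡ sign k ℚ.* ⟦ rankBounds? r ⟧
      value-∪ (yes below′) = H-value k W+x (trans (cong (_+ k) ∣W+x∣) (trans (sym (+-suc ∣ W ∣ k)) eq))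
        (comparable-∪ W x x∉W x-max comparable) below′ (suc n)
        (<-≤-trans d<n (+-monoʳ-≤ (suc n) (∣p∣≤∣p∪q∣ W ⁅ x ⁆)))
      value-∪ (no ¬below) = trans
        (cong (ℚ._* G r admitsIndicator (suc n) W+x)
          (⟦⟧-false (admits? W+x (r W+x)) (¬below ∘ admits-∪⇒boundedBelow W x x∉W x-max comparable below)))
        (trans (ℚₚ.*-zeroˡ (G r admitsIndicator (suc n) W+x)) (sym (trans (cong (sign k ℚ.*_)
          (⟦⟧-false (rankBounds? r) (λ bounds → ¬below (All.map (λ b≤r _ → b≤r) bounds))))
          (ℚₚ.*-zeroʳ (sign k)))))

  -- The empty set is the start of every chain rather than a link, so its constraint `b ≤ ∣ U t ∣`
  -- appears as a separate factor. It is the factor of `H` at `⊥` because the rank of `⊥` is 0.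
  chainSum-admits : ⟦ admits? ⊥ 0 ⟧ ℚ.* chainSum r (suc d) ⊥ (chainProduct admitsIndicator) ≡
    sign d ℚ.* ⟦ rankBounds? r ⟧
  chainSum-admits = trans (cong (λ ρ → ⟦ admits? ⊥ ρ ⟧ ℚ.* G r admitsIndicator (suc d) ⊥) (sym r⊥≡0))
    (result (boundedBelow? ⊥))
    where
    r⊥≡0 : r ⊥ ≡ 0
    r⊥≡0 = n≤0⇒n≡0 (≤-trans (rank≤∣S∣ M ⊥) (≤-reflexive (∣⊥∣≡0 d)))
    admits⇒below : Admits ⊥ (r ⊥) → BoundedBelow ⊥
    admits⇒below = All.map λ {(t , b)} b≤ U⊑⊥ → ≤-trans b≤ (≤-trans
      (+-mono-≤ (≤-reflexive r⊥≡0) (≤-trans (∣p─q∣≤∣p∣ (U t) ⊥)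
        (≤-trans (p⊆q⇒∣p∣≤∣q∣ U⊑⊥) (≤-reflexive (∣⊥∣≡0 d))))) z≤n)
    result : Dec (BoundedBelow ⊥) → H′ (suc d) ⊥ ≡ sign d ℚ.* ⟦ rankBounds? r ⟧
    result (yes below) = H-value d ⊥ (cong (_+ d) (∣⊥∣≡0 d)) (λ t → inj₂ ⊥⊆) below (suc d) (s≤s (m≤m+n d _))
    result (no ¬below) = trans
      (cong (ℚ._* G r admitsIndicator (suc d) ⊥) (⟦⟧-false (admits? ⊥ (r ⊥)) (¬below ∘ admits⇒below)))
      (trans (ℚₚ.*-zeroˡ (G r admitsIndicator (suc d) ⊥)) (sym (trans (cong (sign d ℚ.*_)
        (⟦⟧-false (rankBounds? r) (λ bounds → ¬below (All.map (λ b≤r _ → b≤r) bounds))))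
        (ℚₚ.*-zeroʳ (sign d)))))

-- Ψ(M) as a signed sum over chains of the series of laminar matroids

allC-swap : {A : Set} {P : A → Subset d → ℕ → Set} {Φ : List A} (c : Chain {d} X) →
  All (λ k → AllC (P k) c) Φ → AllC (λ Y σ → All (λ k → P k Y σ) Φ) c
allC-swap [] _ = _
allC-swap (step Y σ _ c) ps = All.map proj₁ ps , allC-swap c (All.map proj₂ ps)

all-swap : {A : Set} {P : A → Subset d → ℕ → Set} {Φ : List A} (c : Chain {d} X) →
  AllC (λ Y σ → All (λ k → P k Y σ) Φ) c → All (λ k → AllC (P k) c) Φ
all-swap [] _ = All.tabulate λ _ → _
all-swap (step Y σ _ c) (p , ps) = All.zip (p , all-swap c ps)

chainProduct-⟦⟧ : {P : Subset d → ℕ → Set} (P? : ∀ Y σ → Dec (P Y σ)) (c : Chain {d} X) →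
  chainProduct (λ Y σ → ⟦ P? Y σ ⟧) c ≡ ⟦ allC? P? c ⟧
chainProduct-⟦⟧ P? [] = refl
chainProduct-⟦⟧ P? (step Y σ _ c) = trans (cong (⟦ P? Y σ ⟧ ℚ.*_) (chainProduct-⟦⟧ P? c))
  (sym (⟦⟧-× (P? Y σ) (allC? P? c)))

⟦≟⟧ : ∀ r b → ⟦ r ≟ b ⟧ ≡ ⟦ b ≤? r ⟧ ℚ.- ⟦ suc b ≤? r ⟧
⟦≟⟧ r b with <-cmp r b
... | tri< r<b r≢b _ = trans (⟦⟧-false (r ≟ b) r≢b) (sym (cong₂ ℚ._-_
  (⟦⟧-false (b ≤? r) (<⇒≱ r<b)) (⟦⟧-false (suc b ≤? r) (<⇒≱ (m<n⇒m<1+n r<b)))))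
... | tri≈ _ refl _ = trans (⟦⟧-true (r ≟ r) refl) (sym (cong₂ ℚ._-_
  (⟦⟧-true (r ≤? r) ≤-refl) (⟦⟧-false (suc r ≤? r) 1+n≰n)))
... | tri> _ r≢b b<r = trans (⟦⟧-false (r ≟ b) r≢b) (sym (cong₂ ℚ._-_
  (⟦⟧-true (b ≤? r) (<⇒≤ b<r)) (⟦⟧-true (suc b ≤? r) b<r)))

module _ (v : Fin d → ℕ) where

  rankValues? : (Γ : List (ℕ × ℕ)) (r : Subset d → ℕ) → Dec (All (λ (t , b) → r (upper v t) ≡ b) Γ)
  rankValues? Γ r = All.all? (λ (t , b) → r (upper v t) ≟ b) Γ

  bounds? : (Φ : List (ℕ × ℕ)) (r : Subset d → ℕ) → Dec (All (RankBound r v) Φ)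
  bounds? Φ r = All.all? (λ (t , b) → b ≤? r (upper v t)) Φ

  -- `Γ` holds the equalities still to be expanded, `Φ` the lower bounds already obtained from
  -- expanded ones.
  rankIndicator : (Γ Φ : List (ℕ × ℕ)) (r : Subset d → ℕ) → ℚ
  rankIndicator Γ Φ r = ⟦ rankValues? Γ r ⟧ ℚ.* ⟦ bounds? Φ r ⟧

  rankIndicator-∷ : ∀ t b Γ Φ r → rankIndicator ((t , b) ∷ Γ) Φ r ≡
    rankIndicator Γ ((t , b) ∷ Φ) r ℚ.- rankIndicator Γ ((t , suc b) ∷ Φ) r
  rankIndicator-∷ t b Γ Φ r = begin
    ⟦ rankValues? ((t , b) ∷ Γ) r ⟧ ℚ.* φ               ≡⟨ cong (ℚ._* φ) (trans (⟦⟧-cong (rankValues? ((t , b) ∷ Γ) r) (ρ ≟ b ×-dec rankValues? Γ r)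
                                                            (λ { (p ∷ ps) → p , ps }) (λ (p , ps) → p ∷ ps)) (⟦⟧-× (ρ ≟ b) (rankValues? Γ r))) ⟩
    ⟦ ρ ≟ b ⟧ ℚ.* γ ℚ.* φ                               ≡⟨ cong (λ e → e ℚ.* γ ℚ.* φ) (⟦≟⟧ ρ b) ⟩
    (⟦ b ≤? ρ ⟧ ℚ.- ⟦ suc b ≤? ρ ⟧) ℚ.* γ ℚ.* φ         ≡⟨ solve 4 (λ e e′ g h → (e :- e′) :* g :* h := g :* (e :* h) :- g :* (e′ :* h)) refl ⟦ b ≤? ρ ⟧ ⟦ suc b ≤? ρ ⟧ γ φ ⟩
    γ ℚ.* (⟦ b ≤? ρ ⟧ ℚ.* φ) ℚ.- γ ℚ.* (⟦ suc b ≤? ρ ⟧ ℚ.* φ)   ≡⟨ cong₂ (λ e e′ → γ ℚ.* e ℚ.- γ ℚ.* e′) (cons b) (cons (suc b)) ⟨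
    rankIndicator Γ ((t , b) ∷ Φ) r ℚ.- rankIndicator Γ ((t , suc b) ∷ Φ) r ∎
    where
    open ≡-Reasoning
    ρ = r (upper v t)
    γ = ⟦ rankValues? Γ r ⟧
    φ = ⟦ bounds? Φ r ⟧
    cons : ∀ b → ⟦ bounds? ((t , b) ∷ Φ) r ⟧ ≡ ⟦ b ≤? ρ ⟧ ℚ.* φ
    cons b = trans (⟦⟧-cong (bounds? ((t , b) ∷ Φ) r) (b ≤? ρ ×-dec bounds? Φ r)
      (λ { (p ∷ ps) → p , ps }) (λ (p , ps) → p ∷ ps)) (⟦⟧-× (b ≤? ρ) (bounds? Φ r))

  module _ (M : Matroid d) where

    laminar-bounds : (Φ : List (ℕ × ℕ)) (c : Chain ⊥) →
      ⟦ bounds? Φ (rank (laminar c)) ⟧ ≡ ⟦ admits? M v Φ ⊥ 0 ⟧ ℚ.* chainProduct (admitsIndicator M v Φ) c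
    laminar-bounds Φ c = begin
      ⟦ bounds? Φ (rank (laminar c)) ⟧                    ≡⟨ ⟦⟧-cong (bounds? Φ (rank (laminar c))) (admits? M v Φ ⊥ 0 ×-dec allC? (admits? M v Φ) c) to from ⟩
      ⟦ admits? M v Φ ⊥ 0 ×-dec allC? (admits? M v Φ) c ⟧   ≡⟨ ⟦⟧-× (admits? M v Φ ⊥ 0) (allC? (admits? M v Φ) c) ⟩
      ⟦ admits? M v Φ ⊥ 0 ⟧ ℚ.* ⟦ allC? (admits? M v Φ) c ⟧ ≡⟨ cong (⟦ admits? M v Φ ⊥ 0 ⟧ ℚ.*_) (chainProduct-⟦⟧ (admits? M v Φ) c) ⟨
      ⟦ admits? M v Φ ⊥ 0 ⟧ ℚ.* chainProduct (admitsIndicator M v Φ) c ∎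
      where
      open ≡-Reasoning
      to : All (RankBound (rank (laminar c)) v) Φ → Admits M v Φ ⊥ 0 × AllC (Admits M v Φ) c
      to bounds =
        All.map (λ {(t , b)} b≤r → ≤-trans b≤r (≤-trans (rank≤∣S∣ (laminar c) (upper v t))
          (≤-reflexive (cong ∣_∣ (sym (p─⊥≡p (upper v t))))))) bounds ,
        allC-swap c (All.map (λ {(t , b)} b≤r →
          AllC-map (λ Y σ → ≤-trans b≤r) c (rank-laminar⁻ c (upper v t))) bounds)
      from : Admits M v Φ ⊥ 0 × AllC (Admits M v Φ) c → All (RankBound (rank (laminar c)) v) Φ
      from (bounds , boundsC) = All.zipWith (λ {(t , b)} (b≤ , b≤c) → rank-laminar⁺ c (upper v t)
        (≤-trans b≤ (≤-reflexive (cong ∣_∣ (p─⊥≡p (upper v t))))) b≤c) (bounds , all-swap c boundsC)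

    chainSum-rankIndicator : (Γ Φ : List (ℕ × ℕ)) →
      chainSum (rank M) (suc d) ⊥ (λ c → rankIndicator Γ Φ (rank (laminar c))) ≡
      sign d ℚ.* rankIndicator Γ Φ (rank M)
    chainSum-rankIndicator [] Φ = begin
      S (λ c → 1ℚ ℚ.* ⟦ bounds? Φ (rank (laminar c)) ⟧)          ≡⟨ chainSum-cong (rank M) (suc d) ⊥ (λ c → trans (ℚₚ.*-identityˡ _) (laminar-bounds Φ c)) ⟩
      S (λ c → a⊥ ℚ.* chainProduct (admitsIndicator M v Φ) c)    ≡⟨ chainSum-* (rank M) (suc d) ⊥ a⊥ _ ⟩
      a⊥ ℚ.* S (chainProduct (admitsIndicator M v Φ))            ≡⟨ chainSum-admits M v Φ ⟩
      sign d ℚ.* ⟦ bounds? Φ (rank M) ⟧                          ≡⟨ cong (sign d ℚ.*_) (ℚₚ.*-identityˡ ⟦ bounds? Φ (rank M) ⟧) ⟨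
      sign d ℚ.* (1ℚ ℚ.* ⟦ bounds? Φ (rank M) ⟧)                 ∎
      where
      open ≡-Reasoning
      S = chainSum (rank M) (suc d) ⊥
      a⊥ = ⟦ admits? M v Φ ⊥ 0 ⟧
    chainSum-rankIndicator ((t , b) ∷ Γ) Φ = begin
      S (λ c → rankIndicator ((t , b) ∷ Γ) Φ (rank (laminar c)))                 ≡⟨ chainSum-cong (rank M) (suc d) ⊥ (λ c → rankIndicator-∷ t b Γ Φ (rank (laminar c))) ⟩
      S (λ c → R b (rank (laminar c)) ℚ.- R (suc b) (rank (laminar c)))          ≡⟨ chainSum-- (rank M) (suc d) ⊥ _ _ ⟩
      S (R b ∘ rank ∘ laminar) ℚ.- S (R (suc b) ∘ rank ∘ laminar)                ≡⟨ cong₂ ℚ._-_ (chainSum-rankIndicator Γ ((t , b) ∷ Φ)) (chainSum-rankIndicator Γ ((t , suc b) ∷ Φ)) ⟩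
      sign d ℚ.* R b (rank M) ℚ.- sign d ℚ.* R (suc b) (rank M)                  ≡⟨ solve 3 (λ s x y → s :* x :- s :* y := s :* (x :- y)) refl (sign d) (R b (rank M)) (R (suc b) (rank M)) ⟩
      sign d ℚ.* (R b (rank M) ℚ.- R (suc b) (rank M))                           ≡⟨ cong (sign d ℚ.*_) (rankIndicator-∷ t b Γ Φ (rank M)) ⟨
      sign d ℚ.* rankIndicator ((t , b) ∷ Γ) Φ (rank M)                          ∎
      where
      open ≡-Reasoning
      S = chainSum (rank M) (suc d) ⊥
      R : ℕ → (Subset d → ℕ) → ℚ
      R b = rankIndicator Γ ((t , b) ∷ Φ)

∑-unique : {P : Pred (Subset d) 0ℓ} (P? : Decidable P) → (∀ {A B} → P A → P B → A ≡ B) →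
  (∃P? : Dec (∃ P)) → ∑ (λ B → ⟦ P? B ⟧) ≡ ⟦ ∃P? ⟧
∑-unique P? unique ∃P? = case ∃P? of λ where
  (yes (B , PB)) → trans (∑-single B λ A A≢B → ⟦⟧-false (P? A) λ PA → A≢B (unique PA PB))
    (trans (⟦⟧-true (P? B) PB) (sym (⟦⟧-true ∃P? (B , PB))))
  (no ¬∃P) → trans (∑-zero λ B → ⟦⟧-false (P? B) λ PB → ¬∃P (B , PB)) (sym (⟦⟧-false ∃P? ¬∃P))

module _ (f : Word d) (B : Subset d) where
  private
    v = refine f B

  saturation : List (ℕ × ℕ)
  saturation = List.map (λ x → v x , ∣ B ∩ upper v (v x) ∣) (List.allFin d)

  saturatesIndicator : (Subset d → ℕ) → ℚ
  saturatesIndicator = rankIndicator v saturation []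

  module _ (M : Matroid d) where

    saturates? : Dec (Saturates M v B)
    saturates? = all? λ x → rank M (upper v (v x)) ≟ ∣ B ∩ upper v (v x) ∣

    saturatesIndicator≡ : saturatesIndicator (rank M) ≡ ⟦ saturates? ⟧
    saturatesIndicator≡ = trans (ℚₚ.*-identityʳ _)
      (⟦⟧-cong (rankValues? v saturation (rank M)) saturates?
        (λ all x → Allₚ.tabulate⁻ (Allₚ.map⁻ all) x)
        (λ s → Allₚ.map⁺ (Allₚ.tabulate⁺ s)))

-- A saturated `B` is the unique maximizer, so at most one summand is nonzero.
generic-expansion : (M : Matroid d) (f : Word d) →
  ⟦ generic? M f ⟧ ≡ ∑ (λ B → saturatesIndicator f B (rank M))
generic-expansion M f = sym (trans (∑-cong λ B → saturatesIndicator≡ f B M)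
  (∑-unique (λ B → saturates? f B M)
    (λ sA sB → proj₂ (saturates⇒uniqueMax M f sA) (proj₁ (saturates⇒uniqueMax M f sB)))
    (Dec.map′ (λ (B , max , unique) → B , uniqueMax⇒saturates M f (max , unique))
      (λ (B , s) → B , saturates⇒uniqueMax M f s) (generic? M f))))

chainSum-generic : (M : Matroid d) (f : Word d) →
  chainSum (rank M) (suc d) ⊥ (λ c → ⟦ generic? (laminar c) f ⟧) ≡ sign d ℚ.* ⟦ generic? M f ⟧
chainSum-generic {d} M f = begin
  S (λ c → ⟦ generic? (laminar c) f ⟧)                                   ≡⟨ chainSum-cong (rank M) (suc d) ⊥ (λ c → generic-expansion (laminar c) f) ⟩
  S (λ c → ∑ (λ B → saturatesIndicator f B (rank (laminar c))))          ≡⟨ chainSum-∑ (rank M) {d} (suc d) ⊥ _ ⟩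
  ∑ (λ B → S (λ c → saturatesIndicator f B (rank (laminar c))))          ≡⟨ ∑-cong (λ B → chainSum-rankIndicator (refine f B) M (saturation f B) []) ⟩
  ∑ (λ B → sign d ℚ.* saturatesIndicator f B (rank M))                   ≡⟨ ∑-* {d} (sign d) _ ⟩
  sign d ℚ.* ∑ (λ B → saturatesIndicator f B (rank M))                   ≡⟨ cong (sign d ℚ.*_) (generic-expansion M f) ⟨
  sign d ℚ.* ⟦ generic? M f ⟧                                            ∎
  where
  open ≡-Reasoning
  S = chainSum (rank M) (suc d) ⊥

-- Genericity depends only on the set composition type

infix 4 _≼_

_≼_ : Word d → Word d → Set
f ≼ g = ∀ {x y} → value f x < value f y → value g x < value g y

module _ {f g : Word d} (f≼g : f ≼ g) (g≼f : g ≼ f) where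

  ≼-≤ : ∀ {x y} → value f x ≤ value f y → value g x ≤ value g y
  ≼-≤ fx≤fy = ≮⇒≥ λ gy<gx → <⇒≱ (g≼f gy<gx) fx≤fy

  refine-mono : ∀ B {x y} → refine f B x ≤ refine f B y → refine g B x ≤ refine g B y
  refine-mono B {x} {y} with x ∈? B | y ∈? B
  ... | yes _ | yes _ = λ p → *-monoʳ-≤ 2 (≼-≤ (*-cancelˡ-≤ 2 p))
  ... | yes _ | no _ = λ p → m≤n⇒m≤1+n (*-monoʳ-≤ 2 (≼-≤ (≮⇒≥ λ fy<fx →
    <⇒≱ (≤-trans (≤-reflexive (cong suc (sym (+-suc (value f y) _)))) (*-monoʳ-≤ 2 fy<fx)) p)))
  ... | no _ | yes _ = λ p → *-monoʳ-< 2 (f≼g (*-cancelˡ-< 2 _ _ p))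
  ... | no _ | no _ = λ p → s≤s (*-monoʳ-≤ 2 (≼-≤ (*-cancelˡ-≤ 2 (s≤s⁻¹ p))))

upper-refine : {f g : Word d} → f ≼ g → g ≼ f → ∀ B x →
  upper (refine f B) (refine f B x) ≡ upper (refine g B) (refine g B x)
upper-refine {f = f} {g} f≼g g≼f B x = subset-cong
  (λ y → refine f B x ≤? refine f B y) (λ y → refine g B x ≤? refine g B y)
  (λ y → refine-mono {f = f} {g} f≼g g≼f B {x} {y}) (λ y → refine-mono {f = g} {f} g≼f f≼g B {x} {y})

-- Saturation sees the word only through the upper sets at the thresholds `refine f B x`, and these
-- depend only on the order of the values.
generic-≼ : (M : Matroid d) {f g : Word d} → f ≼ g → g ≼ f → Generic M f → Generic M g
generic-≼ M {f} {g} f≼g g≼f (B , max , unique) = B , saturates⇒uniqueMax M g λ x →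
  subst (λ S → rank M S ≡ ∣ B ∩ S ∣) (upper-refine {f = f} {g} f≼g g≼f B x)
    (uniqueMax⇒saturates M f (max , unique) x)

∈-levelSet⁺ : (f : Word d) {x : Fin d} {t : ℕ} → value f x ≡ t → x ∈ levelSet f t
∈-levelSet⁺ f {x} {t} eq = lookup⇒[]= x _ (trans (Vecₚ.lookup-map x _ f) (dec-true (value f x ≟ t) eq))

∈-levelSet⁻ : (f : Word d) {x : Fin d} {t : ℕ} → x ∈ levelSet f t → value f x ≡ t
∈-levelSet⁻ f {x} {t} x∈ = case value f x ≟ t of λ where
  (yes eq) → eq
  (no neq) → case trans (sym ([]=⇒lookup x∈)) (trans (Vecₚ.lookup-map x _ f) (dec-false (value f x ≟ t) neq)) of λ ()

value≤maxValue : (f : Word d) (x : Fin d) → value f x ≤ maxValue f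
value≤maxValue (a ∷ f) zero = m≤m⊔n (proj₁ a) _
value≤maxValue (a ∷ f) (suc x) = ≤-trans (value≤maxValue f x) (m≤n⊔m (proj₁ a) _)

private
  Below : Word d → Subset d → Subset d → Set
  Below f S T = ∀ {x y} → x ∈ S → y ∈ T → value f x < value f y

  Constant : Word d → Subset d → Set
  Constant f S = ∀ {x y} → x ∈ S → y ∈ S → value f x ≡ value f y

  composition-increasing : (f : Word d) → AllPairs (Below f) (setComposition f)
  composition-increasing f = AllPairsₚ.filter⁺ nonempty? (AllPairsₚ.map⁺
    (AllPairsₚ.applyUpTo⁺₁ id (suc (maxValue f)) λ i<j _ x∈ y∈ →
      subst₂ _<_ (sym (∈-levelSet⁻ f x∈)) (sym (∈-levelSet⁻ f y∈)) i<j))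

  composition-constant : (f : Word d) → All (Constant f) (setComposition f)
  composition-constant f = Allₚ.filter⁺ nonempty? (Allₚ.map⁺ {P = Constant f}
    (All.tabulate {xs = List.upTo (suc (maxValue f))} λ _ x∈ y∈ →
      trans (∈-levelSet⁻ f x∈) (sym (∈-levelSet⁻ f y∈))))

  composition-covers : (f : Word d) (x : Fin d) → Any (x ∈_) (setComposition f)
  composition-covers f x = Any.map (λ { refl → ∈-levelSet⁺ f refl })
    (∈-filter⁺ nonempty? (∈-map⁺ (levelSet f) (∈-upTo⁺ (s≤s (value≤maxValue f x)))) (x , ∈-levelSet⁺ f refl))

  -- Both words increase strictly along the same list of blocks, so the positions of `x` and `y` in
  -- it decide both comparisons; a common block is excluded because `f` is constant there.
  compare-positions : {f g : Word d} {x y : Fin d} {L : List (Subset d)} →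
    All (Constant f) L → AllPairs (Below f) L → AllPairs (Below g) L →
    Any (x ∈_) L → Any (y ∈_) L → value f x < value f y → value g x < value g y
  compare-positions (const ∷ _) _ _ (Any.here x∈) (Any.here y∈) fx<fy =
    contradiction (const x∈ y∈) (<⇒≢ fx<fy)
  compare-positions _ _ (below ∷ _) (Any.here x∈) (Any.there y∈) fx<fy =
    All.lookupWith (λ b y∈ → b x∈ y∈) below y∈
  compare-positions _ (below ∷ _) _ (Any.there x∈) (Any.here y∈) fx<fy =
    contradiction (All.lookupWith (λ b x∈ → b y∈ x∈) below x∈) (<⇒≯ fx<fy)
  compare-positions {f = f} {g} (_ ∷ const) (_ ∷ f↑) (_ ∷ g↑) (Any.there x∈) (Any.there y∈) fx<fy =
    compare-positions {f = f} {g} const f↑ g↑ x∈ y∈ fx<fy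

setComposition⇒≼ : (f g : Word d) → setComposition f ≡ setComposition g → f ≼ g
setComposition⇒≼ f g eq {x} {y} = compare-positions {f = f} {g} (composition-constant f) (composition-increasing f)
  (subst (AllPairs (Below g)) (sym eq) (composition-increasing g)) (composition-covers f x) (composition-covers f y)

-- The representative of the order type of f with values in {1, …, d}.
pack : Word d → Word d
pack f = Vec.tabulate λ x → suc ∣ subset (λ y → value f y <? value f x) ∣ , _

module _ (f : Word d) where
  private
    before : Fin d → Subset d
    before x = subset (λ y → value f y <? value f x)

    value-pack : ∀ x → value (pack f) x ≡ suc ∣ before x ∣
    value-pack x = cong proj₁ (lookup∘tabulate _ x)

  ≼-pack : f ≼ pack f
  ≼-pack {x} {y} fx<fy = subst₂ _<_ (sym (value-pack x)) (sym (value-pack y)) (s≤s (p⊂q⇒∣p∣<∣q∣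
    ( (λ {z} z∈ → ∈-subset⁺ (λ z → value f z <? value f y) (<-trans (∈-subset⁻ (λ z → value f z <? value f x) z∈) fx<fy))
    , x , ∈-subset⁺ (λ z → value f z <? value f y) fx<fy
    , λ x∈ → <-irrefl refl (∈-subset⁻ (λ z → value f z <? value f x) x∈))))

  pack-≼ : pack f ≼ f
  pack-≼ {x} {y} px<py = ≰⇒> λ fy≤fx → <⇒≱ (subst₂ _<_ (value-pack x) (value-pack y) px<py)
    (s≤s (p⊆q⇒∣p∣≤∣q∣ λ {z} z∈ → ∈-subset⁺ (λ z → value f z <? value f x)
      (<-≤-trans (∈-subset⁻ (λ z → value f z <? value f y) z∈) fy≤fx)))

  pack-bounded : ∀ x → ∣ before x ∣ < d
  pack-bounded x = subst (∣ before x ∣ <_) (∣⊤∣≡n d)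
    (p⊂q⇒∣p∣<∣q∣ (⊆⊤ , x , ∈⊤ , λ x∈ → <-irrefl refl (∈-subset⁻ (λ z → value f z <? value f x) x∈)))

words : (m n : ℕ) → List (Word n)
words m zero = [] ∷ []
words m (suc n) = List.cartesianProductWith _∷_ (List.map (λ k → suc k , _) (List.upTo m)) (words m n)

∈-words : {m n : ℕ} (h : Fin n → ℕ) → (∀ x → h x < m) → Vec.tabulate (λ x → suc (h x) , _) ∈ₗ words m n
∈-words {n = zero} h h<m = Any.here refl
∈-words {n = suc n} h h<m = ∈-cartesianProductWith⁺ _∷_ (∈-map⁺ _ (∈-upTo⁺ (h<m zero))) (∈-words (h ∘ suc) (h<m ∘ suc))

pack∈words : (f : Word d) → pack f ∈ₗ words d d
pack∈words f = ∈-words _ (pack-bounded f)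

-- Turning loops into coloops

total-split : (v : Fin d → ℕ) (p q : Subset d) → total v p ≡ total v (p ─ q) + total v (p ∩ q)
total-split v [] [] = refl
total-split v (false ∷ p) (true ∷ q) = total-split (v ∘ suc) p q
total-split v (false ∷ p) (false ∷ q) = total-split (v ∘ suc) p q
total-split v (true ∷ p) (false ∷ q) =
  trans (cong (v zero +_) (total-split (v ∘ suc) p q)) (sym (+-assoc (v zero) _ _))
total-split v (true ∷ p) (true ∷ q) = begin
  v zero + total (v ∘ suc) p                                           ≡⟨ cong (v zero +_) (total-split (v ∘ suc) p q) ⟩
  v zero + (total (v ∘ suc) (p ─ q) + total (v ∘ suc) (p ∩ q))         ≡⟨ +-assoc (v zero) _ _ ⟨
  v zero + total (v ∘ suc) (p ─ q) + total (v ∘ suc) (p ∩ q)           ≡⟨ cong (_+ total (v ∘ suc) (p ∩ q)) (+-comm (v zero) _) ⟩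
  total (v ∘ suc) (p ─ q) + v zero + total (v ∘ suc) (p ∩ q)           ≡⟨ +-assoc (total (v ∘ suc) (p ─ q)) (v zero) _ ⟩
  total (v ∘ suc) (p ─ q) + (v zero + total (v ∘ suc) (p ∩ q))         ∎
  where open ≡-Reasoning

module _ (M : Matroid d) where
  private
    loop? : ∀ x → Dec (Loop M x)
    loop? x = Dec.map′ (λ h {B} → h B) (λ h B → h {B}) (allSubsets? (λ B → isBasis? M B →-dec ¬? (x ∈? B)))

    L : Subset d
    L = subset loop?

    basis-disjoint : ∀ {B} → IsBasis M B → ∀ {x} → x ∈ B → x ∉ L
    basis-disjoint bB x∈B x∈L = ∈-subset⁻ loop? x∈L bB x∈B

    ∪L─L : ∀ {B} → IsBasis M B → (B ∪ L) ─ L ≡ B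
    ∪L─L {B} bB = ⊆-antisym
      (λ x∈ → let (x∈B∪L , x∉L) = x∈p─q⁻ (B ∪ L) L x∈ in
        [ id , (λ x∈L → contradiction x∈L x∉L) ]′ (x∈p∪q⁻ B L x∈B∪L))
      (λ x∈B → x∈p∧x∉q⇒x∈p─q (p⊆p∪q L x∈B) (basis-disjoint bB x∈B))

    ─L∪L : ∀ {B} → L ⊑ B → (B ─ L) ∪ L ≡ B
    ─L∪L {B} L⊑B = ⊆-antisym
      (λ x∈ → [ p─q⊆p B L , L⊑B ]′ (x∈p∪q⁻ (B ─ L) L x∈))
      (λ {x} x∈B → case x ∈? L of λ where
        (yes x∈L) → q⊆p∪q (B ─ L) L x∈L
        (no x∉L) → p⊆p∪q L (x∈p∧x∉q⇒x∈p─q x∈B x∉L))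

  loops⇒coloops : Matroid d
  IsBasis loops⇒coloops B = L ⊑ B × IsBasis M (B ─ L)
  isBasis? loops⇒coloops B = L ⊆? B ×-dec isBasis? M (B ─ L)
  nonempty loops⇒coloops = let (B , bB) = nonempty M in
    B ∪ L , q⊆p∪q B L , subst (IsBasis M) (sym (∪L─L bB)) bB
  exchange loops⇒coloops {A} {B} (L⊑A , bA) (L⊑B , bB) {x} x∈A x∉B
    with exchange M bA bB (x∈p∧x∉q⇒x∈p─q x∈A (x∉B ∘ L⊑B)) (x∉B ∘ p─q⊆p B L)
  ... | y , y∈B─L , y∉A─L , bA′ = y , y∈B , y∉A , L⊑A′ , subst (IsBasis M) A′≡ bA′
    where
    y∈B = proj₁ (x∈p─q⁻ B L y∈B─L)
    y∉L = proj₂ (x∈p─q⁻ B L y∈B─L)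
    y∉A : y ∉ A
    y∉A y∈A = y∉A─L (x∈p∧x∉q⇒x∈p─q y∈A y∉L)
    L⊑A′ : L ⊑ (A - x) ∪ ⁅ y ⁆
    L⊑A′ z∈L = p⊆p∪q ⁅ y ⁆ (x∈p∧x≢y⇒x∈p-y (L⊑A z∈L) λ { refl → x∉B (L⊑B z∈L) })
    A′≡ : ((A ─ L) - x) ∪ ⁅ y ⁆ ≡ ((A - x) ∪ ⁅ y ⁆) ─ L
    A′≡ = ⊆-antisym
      (λ z∈ → [ (λ z∈′ → let (z∈A─L , z∉x) = x∈p─q⁻ (A ─ L) ⁅ x ⁆ z∈′
                             (z∈A , z∉L) = x∈p─q⁻ A L z∈A─L in
                  x∈p∧x∉q⇒x∈p─q (p⊆p∪q ⁅ y ⁆ (x∈p∧x∉q⇒x∈p─q z∈A z∉x)) z∉L)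
              , (λ z∈y → x∈p∧x∉q⇒x∈p─q (q⊆p∪q (A - x) ⁅ y ⁆ z∈y)
                  λ z∈L → y∉L (subst (_∈ L) (x∈⁅y⁆⇒x≡y y z∈y) z∈L))
              ]′ (x∈p∪q⁻ ((A ─ L) - x) ⁅ y ⁆ z∈))
      (λ z∈ → let (z∈A′ , z∉L) = x∈p─q⁻ ((A - x) ∪ ⁅ y ⁆) L z∈ in
        [ (λ z∈A-x → let (z∈A , z∉x) = x∈p─q⁻ A ⁅ x ⁆ z∈A-x in
            p⊆p∪q ⁅ y ⁆ (x∈p∧x∉q⇒x∈p─q (x∈p∧x∉q⇒x∈p─q z∈A z∉L) z∉x))
        , q⊆p∪q ((A ─ L) - x) ⁅ y ⁆ ]′ (x∈p∪q⁻ (A - x) ⁅ y ⁆ z∈A′))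

  private
    M′ = loops⇒coloops

    ∪L-basis : ∀ {B} → IsBasis M B → IsBasis M′ (B ∪ L)
    ∪L-basis {B} bB = q⊆p∪q B L , subst (IsBasis M) (sym (∪L─L bB)) bB

  loops⇒coloops-loopless : Loopless M′
  loops⇒coloops-loopless x loop = case x ∈? L of λ where
    (yes x∈L) → let (B , bB) = nonempty M in loop (∪L-basis bB) (q⊆p∪q B L x∈L)
    (no x∉L) → x∉L (∈-subset⁺ loop? λ {B} bB x∈B → loop (∪L-basis bB) (p⊆p∪q L x∈B))

  module _ (f : Word d) where
    private
      weight-─L : ∀ {B} → L ⊑ B → weight f B ≡ weight f (B ─ L) + total (value f) L
      weight-─L {B} L⊑B = begin
        weight f B                                             ≡⟨ weight≡total f B ⟩
        total (value f) B                                      ≡⟨ total-split (value f) B L ⟩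
        total (value f) (B ─ L) + total (value f) (B ∩ L)      ≡⟨ cong₂ _+_ (weight≡total f (B ─ L)) (cong (total (value f)) (trans (sym (p⊑q⇒p∩q≡p L⊑B)) (∩-comm L B))) ⟨
        weight f (B ─ L) + total (value f) L                   ∎
        where open ≡-Reasoning

      weight-∪L : ∀ {B} → IsBasis M B → weight f (B ∪ L) ≡ weight f B + total (value f) L
      weight-∪L {B} bB = trans (weight-─L (q⊆p∪q B L)) (cong (λ S → weight f S + total (value f) L) (∪L─L bB))

      max-∪L : ∀ {B} → Maximizing M f B → Maximizing M′ f (B ∪ L)
      max-∪L (bB , max) = ∪L-basis bB , λ A (L⊑A , bA) →
        subst₂ _≤_ (sym (weight-─L L⊑A)) (sym (weight-∪L bB)) (+-monoˡ-≤ _ (max (A ─ L) bA))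

      max-─L : ∀ {B} → Maximizing M′ f B → Maximizing M f (B ─ L)
      max-─L ((L⊑B , bB) , max) = bB , λ A bA → +-cancelʳ-≤ (total (value f) L) _ _
        (subst₂ _≤_ (weight-∪L bA) (weight-─L L⊑B) (max (A ∪ L) (∪L-basis bA)))

    -- `B ↦ B ∪ L` is a bijection between the bases that raises every weight by the same amount, the
    -- weight of `L`.
    generic-loops⇒coloops : Generic M f → Generic M′ f
    generic-loops⇒coloops (B , max , unique) = B ∪ L , max-∪L max , λ maxA →
      trans (cong (_∪ L) (unique (max-─L maxA))) (─L∪L (proj₁ (proj₁ maxA)))

    generic-coloops⇒loops : Generic M′ f → Generic M f
    generic-coloops⇒loops (B , max , unique) = B ─ L , max-─L max , λ maxA →
      trans (cong (_─ L) (unique (max-∪L maxA))) (∪L─L (proj₁ maxA))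

rank-positive : (M : Matroid d) → Loopless M → ∀ {x} → x ∈ Y → 1 ≤ rank M Y
rank-positive {Y = Y} M loopless {x} x∈Y = n≢0⇒n>0 λ r≡0 → loopless x λ {B} bB x∈B →
  <⇒≱ (≤-<-trans z≤n (p⊂q⇒∣p∣<∣q∣ {p = ⊥} {B ∩ Y} (⊥⊆ , x , x∈p∩q⁺ (x∈B , x∈Y) , ∉⊥)))
    (≤-trans (∣basis∩S∣≤rank M Y bB) (≤-reflexive r≡0))

-- Laminar matroids of chains are nested

-- The start counts as a member because the empty set can be a cyclic flat too.
Member : Subset d → Chain {d} X → Set
Member {X = X} Z [] = Z ≡ X
Member {X = X} Z (step Y σ X⊑Y c) = Z ≡ X ⊎ Member Z c

member-start : (c : Chain {d} X) → Member X c
member-start [] = refl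
member-start (step Y σ X⊑Y c) = inj₁ refl

member-above : (c : Chain {d} X) → Member Z c → X ⊑ Z
member-above [] refl = id
member-above (step Y σ X⊑Y c) (inj₁ refl) = id
member-above (step Y σ X⊑Y c) (inj₂ m) x∈X = member-above c m (X⊑Y x∈X)

members-comparable : (c : Chain {d} X) → Member Y c → Member Z c → Y ⊑ Z ⊎ Z ⊑ Y
members-comparable [] refl refl = inj₁ id
members-comparable c@(step _ _ _ _) (inj₁ refl) m = inj₁ (member-above c m)
members-comparable c@(step _ _ _ _) (inj₂ m) (inj₁ refl) = inj₂ (member-above c (inj₂ m))
members-comparable (step _ _ _ c) (inj₂ m) (inj₂ m′) = members-comparable c m m′

failing-member : {P : Subset d → ℕ → Set} → (∀ Y σ → Dec (P Y σ)) → (c : Chain {d} X) → ¬ AllC P c →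
  ∃[ Y ] ∃[ σ ] Member Y c × (∀ I → Sat c I → ∣ I ∩ Y ∣ ≤ σ) × ¬ P Y σ
failing-member P? [] ¬all = contradiction _ ¬all
failing-member P? (step Y σ X⊑Y c) ¬all with P? Y σ
... | no ¬p = Y , σ , inj₂ (member-start c) , (λ I → proj₁) , ¬p
... | yes p with failing-member P? c (λ ps → ¬all (p , ps))
...   | Z , τ , m , sat , ¬q = Z , τ , inj₂ m , (λ I → sat I ∘ proj₂) , ¬q

module _ (c : Chain {d} ⊥) where
  private
    N = laminar c

  -- `Z` is where the minimum in the rank formula for `S` is attained. It is `⊥` when `I = S`, and
  -- otherwise a constraint that stops `chain-augment` from enlarging `I` inside `S`.
  tight-member : ∀ {S I} → Sat c I → I ⊑ S → (∀ {y} → y ∈ S → y ∉ I → ¬ Sat c (I ∪ ⁅ y ⁆)) →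
    ∃[ Z ] Member Z c × S ─ Z ⊑ I × (∀ J → Sat c J → ∣ J ∩ Z ∣ ≤ ∣ I ∩ Z ∣)
  tight-member {S} {I} satI I⊑S maximal with ∣ I ∣ <? ∣ S ∣
  ... | no I≮S rewrite ⊑∧∣∣≥⇒≡ I⊑S (≮⇒≥ I≮S) = ⊥ , member-start c , p─q⊆p S ⊥ ,
    λ J _ → ≤-trans (∣p∩q∣≤∣q∣ J ⊥) (≤-trans (≤-reflexive (∣⊥∣≡0 d)) z≤n)
  ... | yes I<S with allC? loose? c
    where
    loose? : ∀ Y σ → Dec (σ ≤ ∣ I ∩ Y ∣ → ∣ I ─ Y ∣ < ∣ S ─ Y ∣)
    loose? Y σ = σ ≤? ∣ I ∩ Y ∣ →-dec ∣ I ─ Y ∣ <? ∣ S ─ Y ∣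
  ... | yes loose = let (y , y∈S , y∉I , _ , sat) = chain-augment {I = I} {S} c id satI loose
                          (subst₂ _<_ (cong ∣_∣ (sym (p─⊥≡p I))) (cong ∣_∣ (sym (p─⊥≡p S))) I<S) in
    contradiction sat (maximal y∈S y∉I)
  ... | no ¬loose with failing-member (λ Y σ → σ ≤? ∣ I ∩ Y ∣ →-dec ∣ I ─ Y ∣ <? ∣ S ─ Y ∣) c ¬loose
  ...   | Z , σ , m , satZ , ¬loose′ = Z , m , S─Z⊑I , λ J satJ → ≤-trans (satZ J satJ) tight
    where
    tight : σ ≤ ∣ I ∩ Z ∣
    tight = ≮⇒≥ λ I<σ → ¬loose′ λ σ≤I → contradiction σ≤I (<⇒≱ I<σ)
    S─Z⊑I : S ─ Z ⊑ I
    S─Z⊑I x∈ = p─q⊆p I Z (subst (_ ∈_)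
      (sym (⊑∧∣∣≥⇒≡ (─-monoˡ-⊑ Z I⊑S) (≮⇒≥ λ I<S → ¬loose′ λ _ → I<S))) x∈)

  -- With `Z` tight for `F`, an element of `Z` outside `F` would not raise the rank, so flatness
  -- gives `Z ⊑ F`. An element of `F` outside `Z` lies in every largest independent subset of `F`,
  -- hence in no circuit inside `F`, so cyclicity gives `F ⊑ Z`.
  cyclicFlat-member : ∀ {F} → CyclicFlat N F → Member F c
  cyclicFlat-member {F} (flat , cyclic) with rank-attained N F
  ... | B , bB , eq with tight-member {F} (laminar-independent⁻ c (B , bB , p∩q⊆p B F)) (p∩q⊆q B F) maximal
    where
    maximal : ∀ {y} → y ∈ F → y ∉ B ∩ F → ¬ Sat c ((B ∩ F) ∪ ⁅ y ⁆)
    maximal y∈F y∉ sat = <⇒≱ (≤-reflexive (sym (∣p∪⁅x⁆∣≡1+∣p∣ y∉)))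
      (≤-trans (∣independent∣≤rank N (laminar-independent⁺ c sat) (p∪⁅x⁆⊑q (p∩q⊆q B F) y∈F)) (≤-reflexive (sym eq)))
  ... | Z , m , F─Z⊑K , tight = subst (λ S → Member S c) (⊆-antisym Z⊑F F⊑Z) m
    where
    K = B ∩ F
    iK : Independent N K
    iK = B , bB , p∩q⊆p B F
    ─Z-bound : ∀ {J} → Independent N J → ∣ J ─ Z ∣ ≤ ∣ K ─ Z ∣ → ∣ J ∣ ≤ ∣ K ∣
    ─Z-bound {J} iJ J≤K = begin
      ∣ J ∣                      ≡⟨ ∣p∣≡∣p∩q∣+∣p─q∣ J Z ⟩
      ∣ J ∩ Z ∣ + ∣ J ─ Z ∣      ≤⟨ +-mono-≤ (tight J (laminar-independent⁻ c iJ)) J≤K ⟩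
      ∣ K ∩ Z ∣ + ∣ K ─ Z ∣      ≡⟨ ∣p∣≡∣p∩q∣+∣p─q∣ K Z ⟨
      ∣ K ∣                      ∎
      where open ≤-Reasoning
    hasRank : HasRank N F ∣ K ∣
    hasRank = (K , iK , p∩q⊆q B F , refl) ,
      λ iJ J⊑F → ≤-trans (∣independent∣≤rank N iJ J⊑F) (≤-reflexive (sym eq))
    F⊑Z : F ⊑ Z
    F⊑Z {x} x∈F = (case x ∈? Z of λ where
      (yes x∈Z) → x∈Z
      (no x∉Z) → case Equivalence.to (cyclic x) x∈F of λ where
        (C , (dependent , minimal) , C⊑F , x∈C) → case
          extend-to (independent-augment N) (minimal (x∈p⇒p-x⊂p x∈C)) iK
            (proj₂ hasRank (minimal (x∈p⇒p-x⊂p x∈C)) (λ z∈ → C⊑F (p─q⊆p C ⁅ x ⁆ z∈))) of λ where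
          (J , iJ , C-x⊑J , J⊑ , ∣J∣≡) → contradiction
            (independent-⊑ N (C⊑J x∉Z x∈C C⊑F iJ C-x⊑J J⊑ ∣J∣≡) iJ) dependent)
      where
      -- `J` is as large as `K`, and tightness leaves it no advantage inside `Z`; so outside `Z` it
      -- must contain all of `F ─ Z`, including `x`. The circuit would then be independent.
      C⊑J : x ∉ Z → ∀ {C J} → x ∈ C → C ⊑ F → Independent N J → C - x ⊑ J → J ⊑ (C - x) ∪ K → ∣ J ∣ ≡ ∣ K ∣ → C ⊑ J
      C⊑J x∉Z {C} {J} x∈C C⊑F iJ C-x⊑J J⊑ ∣J∣≡ = subst (_⊑ J) (p-x∪⁅x⁆≡p x∈C) (p∪⁅x⁆⊑q C-x⊑J x∈J)
        where
        J⊑F : J ⊑ F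
        J⊑F z∈J = [ (λ z∈ → C⊑F (p─q⊆p C ⁅ x ⁆ z∈)) , p∩q⊆q B F ]′ (x∈p∪q⁻ (C - x) K (J⊑ z∈J))
        J─Z⊑K─Z : J ─ Z ⊑ K ─ Z
        J─Z⊑K─Z z∈ = let (z∈J , z∉Z) = x∈p─q⁻ J Z z∈ in
          x∈p∧x∉q⇒x∈p─q (F─Z⊑K (x∈p∧x∉q⇒x∈p─q (J⊑F z∈J) z∉Z)) z∉Z
        K─Z≤J─Z : ∣ K ─ Z ∣ ≤ ∣ J ─ Z ∣
        K─Z≤J─Z = +-cancelˡ-≤ ∣ K ∩ Z ∣ _ _ (begin
          ∣ K ∩ Z ∣ + ∣ K ─ Z ∣      ≡⟨ ∣p∣≡∣p∩q∣+∣p─q∣ K Z ⟨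
          ∣ K ∣                      ≡⟨ ∣J∣≡ ⟨
          ∣ J ∣                      ≡⟨ ∣p∣≡∣p∩q∣+∣p─q∣ J Z ⟩
          ∣ J ∩ Z ∣ + ∣ J ─ Z ∣      ≤⟨ +-monoˡ-≤ ∣ J ─ Z ∣ (tight J (laminar-independent⁻ c iJ)) ⟩
          ∣ K ∩ Z ∣ + ∣ J ─ Z ∣      ∎)
          where open ≤-Reasoning
        x∈J : x ∈ J
        x∈J = p─q⊆p J Z (subst (x ∈_) (sym (⊑∧∣∣≥⇒≡ J─Z⊑K─Z K─Z≤J─Z))
          (x∈p∧x∉q⇒x∈p─q (F─Z⊑K (x∈p∧x∉q⇒x∈p─q x∈F x∉Z)) x∉Z))
    Z⊑F : Z ⊑ F
    Z⊑F {y} y∈Z = (case y ∈? F of λ where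
      (yes y∈F) → y∈F
      (no y∉F) → ⊥-elim (flat y∉F hasRank
        ((K , iK , (λ z∈K → p⊆p∪q ⁅ y ⁆ (p∩q⊆q B F z∈K)) , refl) ,
         λ {J} iJ J⊑F+y → ─Z-bound iJ (p⊆q⇒∣p∣≤∣q∣ (J─Z⊑K─Z {J} J⊑F+y)))))
      where
      J─Z⊑K─Z : ∀ {J} → J ⊑ F ∪ ⁅ y ⁆ → J ─ Z ⊑ K ─ Z
      J─Z⊑K─Z {J} J⊑F+y z∈ with x∈p─q⁻ J Z z∈
      ... | z∈J , z∉Z with x∈p∪q⁻ F ⁅ y ⁆ (J⊑F+y z∈J)
      ... | inj₁ z∈F = x∈p∧x∉q⇒x∈p─q (F─Z⊑K (x∈p∧x∉q⇒x∈p─q z∈F z∉Z)) z∉Z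
      ... | inj₂ z∈y = contradiction (subst (_∈ Z) (sym (x∈⁅y⁆⇒x≡y y z∈y)) y∈Z) z∉Z

  laminar-nested : Nested N
  laminar-nested cF cG = members-comparable c (cyclicFlat-member cF) (cyclicFlat-member cG)

  laminar-loopless : AllC (λ _ σ → 1 ≤ σ) c → Loopless N
  laminar-loopless positive x loop =
    let (B , bB , x⊑B) = laminar-independent⁺ {I = ⁅ x ⁆} c (AllC-map (λ Y σ → ≤-trans (≤-trans (∣p∩q∣≤∣p∣ ⁅ x ⁆ Y)
          (≤-reflexive (∣⁅x⁆∣≡1 x)))) c positive) in
    loop bB (x⊑B (x∈⁅x⁆ x))

-- Normal forms of chains

-- The two strict inequalities remove the two redundancies between consecutive constraints: `σ = ρ`
-- makes the new one imply the old, `σ = ρ + ∣ V ─ U ∣` makes it follow from the old.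
data Normal {d : ℕ} (U : Subset d) (ρ : ℕ) : Chain U → Set where
  []   : Normal U ρ []
  step : ∀ {V σ} {U⊑V : U ⊑ V} {c : Chain V} → ρ < σ → σ < ρ + ∣ V ─ U ∣ → Normal V σ c →
    Normal U ρ (step V σ U⊑V c)

-- The bounds of the chain grow like the ranks of a matroid, starting from bound σ on V.
Growing : Subset d → ℕ → Chain {d} X → Set
Growing V σ [] = Unit.⊤
Growing V σ (step Y τ _ c) = V ⊑ Y × σ ≤ τ × τ ≤ σ + ∣ Y ─ V ∣ × Growing Y τ c

∣─∣-telescope : X ⊑ Y → Y ⊑ Z → ∣ Z ─ X ∣ ≡ ∣ Y ─ X ∣ + ∣ Z ─ Y ∣
∣─∣-telescope {X = X} {Y} {Z} X⊑Y Y⊑Z = trans (∣p∣≡∣p∩q∣+∣p─q∣ (Z ─ X) Y) (cong₂ _+_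
  (cong ∣_∣ (⊆-antisym
    (λ x∈ → let (x∈Z─X , x∈Y) = x∈p∩q⁻ (Z ─ X) Y x∈ in
      x∈p∧x∉q⇒x∈p─q x∈Y (proj₂ (x∈p─q⁻ Z X x∈Z─X)))
    (λ x∈ → let (x∈Y , x∉X) = x∈p─q⁻ Y X x∈ in
      x∈p∩q⁺ (x∈p∧x∉q⇒x∈p─q (Y⊑Z x∈Y) x∉X , x∈Y))))
  (cong ∣_∣ (⊆-antisym
    (λ x∈ → let (x∈Z─X , x∉Y) = x∈p─q⁻ (Z ─ X) Y x∈ in
      x∈p∧x∉q⇒x∈p─q (p─q⊆p Z X x∈Z─X) x∉Y)
    (λ x∈ → let (x∈Z , x∉Y) = x∈p─q⁻ Z Y x∈ in
      x∈p∧x∉q⇒x∈p─q (x∈p∧x∉q⇒x∈p─q x∈Z (x∉Y ∘ X⊑Y)) x∉Y))))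

-- Dropping an implied constraint preserves growth because the differences of nested sets add up.
growing-skip : ∀ {σ τ} (c : Chain {d} X) → Y ⊑ Z → τ ≡ σ + ∣ Z ─ Y ∣ → Growing Z τ c → Growing Y σ c
growing-skip [] _ _ _ = _
growing-skip {Y = Y} {Z} {σ} {τ} (step W υ _ c) Y⊑Z refl (Z⊑W , τ≤υ , υ≤ , g) =
  (λ x∈Y → Z⊑W (Y⊑Z x∈Y)) , ≤-trans (m≤m+n σ _) τ≤υ , ≤-trans υ≤ (≤-reflexive
    (trans (+-assoc σ _ _) (cong (σ +_) (sym (∣─∣-telescope Y⊑Z Z⊑W))))) , g

∣I∩Y∣-bound : ∀ (I : Subset d) {V Y σ} → ∣ I ∩ V ∣ ≤ σ → ∣ I ∩ Y ∣ ≤ σ + ∣ Y ─ V ∣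
∣I∩Y∣-bound I {V} {Y} {σ} I≤σ = begin
  ∣ I ∩ Y ∣                             ≡⟨ ∣p∣≡∣p∩q∣+∣p─q∣ (I ∩ Y) V ⟩
  ∣ (I ∩ Y) ∩ V ∣ + ∣ (I ∩ Y) ─ V ∣     ≤⟨ +-mono-≤ (≤-trans (p⊆q⇒∣p∣≤∣q∣ (∩-monoˡ-⊑ V (p∩q⊆p I Y))) I≤σ)
                                             (p⊆q⇒∣p∣≤∣q∣ (─-monoˡ-⊑ V (p∩q⊆q I Y))) ⟩
  σ + ∣ Y ─ V ∣                         ∎
  where open ≤-Reasoning

-- The constraint (V , σ) is kept pending until it is known not to be implied by the next one.
normalise-pending : ∀ {U V : Subset d} {ρ σ} → U ⊑ V → ρ < σ → σ < ρ + ∣ V ─ U ∣ →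
  (c : Chain {d} X) → Growing V σ c →
  ∃[ c′ ] Normal U ρ c′ × (∀ I → (∣ I ∩ V ∣ ≤ σ × Sat c I) ⇔ Sat c′ I)
normalise-pending {V = V} {σ = σ} U⊑V ρ<σ σ< [] _ =
  step V σ U⊑V [] , step ρ<σ σ< [] , λ I → mk⇔ (λ (I≤σ , _) → I≤σ , _) (λ (I≤σ , _) → I≤σ , _)
normalise-pending {U = U} {V} {ρ} {σ} U⊑V ρ<σ σ< (step Y τ _ c) (V⊑Y , σ≤τ , τ≤ , g) with σ ≟ τ | τ ≟ σ + ∣ Y ─ V ∣
-- Equal bounds: the constraint on the larger set implies the pending one, which is replaced.
... | yes refl | _ with normalise-pending (λ x∈U → V⊑Y (U⊑V x∈U)) ρ<σ
                          (<-≤-trans σ< (+-monoʳ-≤ ρ (p⊆q⇒∣p∣≤∣q∣ (─-monoˡ-⊑ U V⊑Y)))) c g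
...   | c′ , normal , equiv = c′ , normal , λ I → mk⇔
  (λ (_ , sat) → Equivalence.to (equiv I) sat)
  (λ sat′ → let (I≤τ , sat) = Equivalence.from (equiv I) sat′ in
    ≤-trans (p⊆q⇒∣p∣≤∣q∣ (∩-monoʳ-⊑ I V⊑Y)) I≤τ , I≤τ , sat)
-- The bound rises by the full size of the difference, so the new constraint follows from the
-- pending one and is dropped.
normalise-pending {U = U} {V} {ρ} {σ} U⊑V ρ<σ σ< (step Y τ _ c) (V⊑Y , σ≤τ , τ≤ , g) | no _ | yes τ≡
  with normalise-pending U⊑V ρ<σ σ< c (growing-skip c V⊑Y τ≡ g)
... | c′ , normal , equiv = c′ , normal , λ I → mk⇔
  (λ (I≤σ , _ , sat) → Equivalence.to (equiv I) (I≤σ , sat))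
  (λ sat′ → let (I≤σ , sat) = Equivalence.from (equiv I) sat′ in
    I≤σ , ≤-trans (∣I∩Y∣-bound I {V} {Y} I≤σ) (≤-reflexive (sym τ≡)) , sat)
normalise-pending {U = U} {V} {ρ} {σ} U⊑V ρ<σ σ< (step Y τ _ c) (V⊑Y , σ≤τ , τ≤ , g) | no σ≢τ | no τ≢
  with normalise-pending V⊑Y (≤∧≢⇒< σ≤τ σ≢τ) (≤∧≢⇒< τ≤ τ≢) c g
... | c′ , normal , equiv = step V σ U⊑V c′ , step ρ<σ σ< normal , λ I → mk⇔
  (λ (I≤σ , sat) → I≤σ , Equivalence.to (equiv I) sat)
  (λ (I≤σ , sat′) → I≤σ , Equivalence.from (equiv I) sat′)

-- The virtual constraint `(⊥ , 0)` always holds and never enters the result. Positivity rules out a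
-- first bound equal to 0, so only the other redundancy has to be tested against it.
normalise : (c : Chain {d} X) → Growing ⊥ 0 c → AllC (λ _ σ → 1 ≤ σ) c →
  ∃[ c′ ] Normal ⊥ 0 c′ × (∀ I → Sat c I ⇔ Sat c′ I)
normalise [] _ _ = [] , [] , λ I → mk⇔ id id
normalise (step Y τ _ c) (⊥⊑Y , _ , τ≤ , g) (1≤τ , positive) with τ ≟ ∣ Y ─ ⊥ ∣
... | yes τ≡ with normalise c (growing-skip c ⊥⊆ τ≡ g) positive
...   | c′ , normal , equiv = c′ , normal , λ I → mk⇔
  (λ (_ , sat) → Equivalence.to (equiv I) sat)
  (λ sat′ → ≤-trans (∣p∩q∣≤∣q∣ I Y) (≤-reflexive (trans (cong ∣_∣ (sym (p─⊥≡p Y))) (sym τ≡))) ,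
    Equivalence.from (equiv I) sat′)
normalise (step Y τ _ c) (⊥⊑Y , _ , τ≤ , g) (1≤τ , positive) | no τ≢ =
  normalise-pending ⊥⊆ 1≤τ (≤∧≢⇒< τ≤ τ≢) c g

-- Counting normal forms

collectAbove : {A : Set} (U : Subset d) → ((V : Subset d) → U ⊑ V → List A) → List A
collectAbove [] g = g [] id
collectAbove (true ∷ U) g = collectAbove U λ V U⊑V → g (true ∷ V) (s⊆s U⊑V)
collectAbove (false ∷ U) g =
  (collectAbove U λ V U⊑V → g (false ∷ V) (s⊆s U⊑V)) List.++
  (collectAbove U λ V U⊑V → g (true ∷ V) (out⊆ U⊑V))

-- The list is built with its own inclusion proofs, and two such functions cannot be identified.
-- Membership is therefore claimed for some proof, and chains are later found in the list only up to
-- equivalence of `Sat`.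
∈-collectAbove : {A : Set} {U V : Subset d} (g : (V : Subset d) → U ⊑ V → List A) → U ⊑ V →
  Σ[ U⊑V ∈ U ⊑ V ] (∀ {a} → a ∈ₗ g V (λ {x} → U⊑V {x}) → a ∈ₗ collectAbove U g)
∈-collectAbove {U = []} {[]} g U⊑V = id , id
∈-collectAbove {U = true ∷ U} {true ∷ V} g U⊑V =
  let (U⊑V′ , ∈g) = ∈-collectAbove {U = U} {V} (λ V U⊑V → g (true ∷ V) (s⊆s U⊑V)) (drop-∷-⊆ U⊑V) in
  s⊆s U⊑V′ , ∈g
∈-collectAbove {U = true ∷ U} {false ∷ V} g U⊑V with () ← U⊑V {zero} here
∈-collectAbove {U = false ∷ U} {false ∷ V} g U⊑V =
  let (U⊑V′ , ∈g) = ∈-collectAbove {U = U} {V} (λ V U⊑V → g (false ∷ V) (s⊆s U⊑V)) (drop-∷-⊆ U⊑V) in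
  s⊆s U⊑V′ , ∈-++⁺ˡ ∘ ∈g
∈-collectAbove {U = false ∷ U} {true ∷ V} g U⊑V =
  let (U⊑V′ , ∈g) = ∈-collectAbove {U = U} {V} (λ V U⊑V → g (true ∷ V) (out⊆ U⊑V)) (drop-∷-⊆ U⊑V) in
  out⊆ U⊑V′ , ∈-++⁺ʳ (collectAbove U λ V U⊑V → g (false ∷ V) (s⊆s U⊑V)) ∘ ∈g

all-collectAbove : {A : Set} {P : A → Set} {U : Subset d} (g : (V : Subset d) → U ⊑ V → List A) →
  (∀ V (U⊑V : U ⊑ V) → All P (g V U⊑V)) → All P (collectAbove U g)
all-collectAbove {U = []} g all = all [] id
all-collectAbove {U = true ∷ U} g all =
  all-collectAbove {U = U} (λ V U⊑V → g (true ∷ V) (s⊆s U⊑V)) λ V U⊑V → all (true ∷ V) (s⊆s U⊑V)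
all-collectAbove {U = false ∷ U} g all = Allₚ.++⁺
  (all-collectAbove {U = U} (λ V U⊑V → g (false ∷ V) (s⊆s U⊑V)) λ V U⊑V → all (false ∷ V) (s⊆s U⊑V))
  (all-collectAbove {U = U} (λ V U⊑V → g (true ∷ V) (out⊆ U⊑V)) λ V U⊑V → all (true ∷ V) (out⊆ U⊑V))

-- The sum of h ∣ A ∣ (m − ∣ A ∣) over the subsets A of a set with m elements.
subsetSum : ℕ → (ℕ → ℕ → ℕ) → ℕ
subsetSum zero h = h 0 0
subsetSum (suc m) h = subsetSum m (λ n k → h n (suc k)) + subsetSum m (λ n k → h (suc n) k)

subsetSum-cong : ∀ m {h h′ : ℕ → ℕ → ℕ} → (∀ n k → h n k ≡ h′ n k) → subsetSum m h ≡ subsetSum m h′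
subsetSum-cong zero eq = eq 0 0
subsetSum-cong (suc m) eq = cong₂ _+_
  (subsetSum-cong m λ n k → eq n (suc k)) (subsetSum-cong m λ n k → eq (suc n) k)

private
  +-interchange : ∀ a b c e → (a + b) + (c + e) ≡ (a + c) + (b + e)
  +-interchange = CommutativeSemigroupProperties.interchange +-commutativeSemigroup

subsetSum-+ : ∀ m (h h′ : ℕ → ℕ → ℕ) → subsetSum m (λ n k → h n k + h′ n k) ≡ subsetSum m h + subsetSum m h′
subsetSum-+ zero h h′ = refl
subsetSum-+ (suc m) h h′ = trans
  (cong₂ _+_ (subsetSum-+ m (λ n k → h n (suc k)) (λ n k → h′ n (suc k)))
             (subsetSum-+ m (λ n k → h (suc n) k) (λ n k → h′ (suc n) k)))
  (+-interchange (subsetSum m λ n k → h n (suc k)) _ _ _)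

-- Both sides count pairs of a subset A and an element, inside A on the left and outside A on the right.
subsetSum-move : ∀ m (h : ℕ → ℕ → ℕ) →
  subsetSum m (λ n k → n * h n (suc k)) ≡ subsetSum m (λ n k → k * h (suc n) k)
subsetSum-move zero h = refl
subsetSum-move (suc m) h = begin
  S (λ n k → n * h n (2 + k)) + S (λ n k → h′ n k + n * h′ n k)                ≡⟨ cong₂ _+_ (subsetSum-move m λ n k → h n (suc k)) (subsetSum-+ m h′ _) ⟩
  S (λ n k → k * h′ n k) + (S h′ + S (λ n k → n * h′ n k))                     ≡⟨ cong (λ s → S (λ n k → k * h′ n k) + (S h′ + s)) (subsetSum-move m λ n k → h (suc n) k) ⟩
  S (λ n k → k * h′ n k) + (S h′ + S (λ n k → k * h (2 + n) k))                ≡⟨ +-assoc (S λ n k → k * h′ n k) (S h′) _ ⟨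
  S (λ n k → k * h′ n k) + S h′ + S (λ n k → k * h (2 + n) k)                  ≡⟨ cong (_+ S (λ n k → k * h (2 + n) k)) (trans (+-comm (S λ n k → k * h′ n k) (S h′)) (sym (subsetSum-+ m h′ _))) ⟩
  S (λ n k → h′ n k + k * h′ n k) + S (λ n k → k * h (2 + n) k)                ∎
  where
  open ≡-Reasoning
  S = subsetSum m
  h′ : ℕ → ℕ → ℕ
  h′ n k = h (suc n) (suc k)

subsetSum-zero : ∀ m → subsetSum m (λ _ _ → 0) ≡ 0
subsetSum-zero zero = refl
subsetSum-zero (suc m) = cong₂ _+_ (subsetSum-zero m) (subsetSum-zero m)

onEmpty : (ℕ → ℕ) → ℕ → ℕ → ℕ
onEmpty g zero k = g k
onEmpty g (suc n) k = 0

subsetSum-onEmpty : ∀ m g → subsetSum m (onEmpty g) ≡ g m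
subsetSum-onEmpty zero g = refl
subsetSum-onEmpty (suc m) g = trans
  (cong₂ _+_ (trans (subsetSum-cong m shift) (subsetSum-onEmpty m (g ∘ suc))) (subsetSum-zero m))
  (+-identityʳ (g (suc m)))
  where
  shift : ∀ n k → onEmpty g n (suc k) ≡ onEmpty (g ∘ suc) n k
  shift zero k = refl
  shift (suc n) k = refl

-- After one element is split off, `subsetSum-move` turns `n * (suc k) !` into `k * k !`, which
-- combines with `k !` to `(suc k) !`.
subsetSum-n*k! : ∀ m → subsetSum m (λ n k → n * k !) + 1 ≡ subsetSum m (λ _ k → k !)
subsetSum-n*k! zero = refl
subsetSum-n*k! (suc m) = begin
  S (λ n k → n * suc k !) + S (λ n k → k ! + n * k !) + 1        ≡⟨ cong₂ (λ s t → s + t + 1) (subsetSum-move m λ _ k → k !) (subsetSum-+ m (λ _ k → k !) _) ⟩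
  K + (F + S (λ n k → n * k !)) + 1                             ≡⟨ +-assoc K _ 1 ⟩
  K + (F + S (λ n k → n * k !) + 1)                             ≡⟨ cong (K +_) (trans (+-assoc F _ 1) (cong (F +_) (subsetSum-n*k! m))) ⟩
  K + (F + F)                                                   ≡⟨ +-assoc K F F ⟨
  K + F + F                                                     ≡⟨ cong (_+ F) (trans (+-comm K F) (sym (subsetSum-+ m (λ _ k → k !) _))) ⟩
  S (λ _ k → k ! + k * k !) + F                                 ∎
  where
  open ≡-Reasoning
  S = subsetSum m
  K = S λ _ k → k * k !
  F = S λ _ k → k !

-- The recursion for the number of normal chains: 1 for the empty chain, and for a next set with `n`
-- new elements `n ∸ 1` admissible bounds and `k !` continuations.
1+subsetSum≡m! : ∀ m → 1 + subsetSum m (λ n k → (n ∸ 1) * k !) ≡ m !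
1+subsetSum≡m! m = +-cancelˡ-≡ (S λ n k → n * k !) _ _ (begin
  A + (1 + E)                            ≡⟨ +-assoc A 1 E ⟨
  A + 1 + E                              ≡⟨ cong (_+ E) (subsetSum-n*k! m) ⟩
  S (λ _ k → k !) + E                    ≡⟨ subsetSum-+ m (λ _ k → k !) _ ⟨
  S (λ n k → k ! + (n ∸ 1) * k !)        ≡⟨ subsetSum-cong m split ⟩
  S (λ n k → n * k ! + onEmpty _! n k)   ≡⟨ subsetSum-+ m _ (onEmpty _!) ⟩
  A + S (onEmpty _!)                     ≡⟨ cong (A +_) (subsetSum-onEmpty m _!) ⟩
  A + m !                                ∎)
  where
  open ≡-Reasoning
  S = subsetSum m
  A = S λ n k → n * k !
  E = S λ n k → (n ∸ 1) * k !
  -- For `n = 0` the truncated `n ∸ 1` is 0 instead of -1. This excess, met only at the empty subset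
  -- where `k = m`, is the factorial wanted.
  split : ∀ n k → k ! + (n ∸ 1) * k ! ≡ n * k ! + onEmpty _! n k
  split zero k = +-identityʳ (k !)
  split (suc n) k = sym (+-identityʳ _)

length-collectAbove : {A : Set} (U : Subset d) (g : (V : Subset d) → U ⊑ V → List A) {h : ℕ → ℕ → ℕ} →
  (∀ V (U⊑V : U ⊑ V) → List.length (g V U⊑V) ≡ h ∣ V ─ U ∣ ∣ ∁ V ∣) →
  List.length (collectAbove U g) ≡ subsetSum ∣ ∁ U ∣ h
length-collectAbove [] g eq = eq [] id
length-collectAbove (true ∷ U) g eq =
  length-collectAbove U (λ V U⊑V → g (true ∷ V) (s⊆s U⊑V)) λ V U⊑V → eq (true ∷ V) (s⊆s U⊑V)
length-collectAbove (false ∷ U) g eq = trans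
  (Listₚ.length-++ (collectAbove U λ V U⊑V → g (false ∷ V) (s⊆s U⊑V)))
  (cong₂ _+_ (length-collectAbove U (λ V U⊑V → g (false ∷ V) (s⊆s U⊑V)) λ V U⊑V → eq (false ∷ V) (s⊆s U⊑V))
             (length-collectAbove U (λ V U⊑V → g (true ∷ V) (out⊆ U⊑V)) λ V U⊑V → eq (true ∷ V) (out⊆ U⊑V)))

length-concatMap : {A B : Set} (f : A → List B) (xs : List A) {n : ℕ} →
  (∀ x → x ∈ₗ xs → List.length (f x) ≡ n) → List.length (List.concatMap f xs) ≡ List.length xs * n
length-concatMap f [] eq = refl
length-concatMap f (x ∷ xs) eq = trans (Listₚ.length-++ (f x))
  (cong₂ _+_ (eq x (Any.here refl)) (length-concatMap f xs λ y y∈ → eq y (Any.there y∈)))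

∣∁∣-telescope : X ⊑ Y → ∣ ∁ X ∣ ≡ ∣ Y ─ X ∣ + ∣ ∁ Y ∣
∣∁∣-telescope {X = []} {[]} _ = refl
∣∁∣-telescope {X = true ∷ X} {true ∷ Y} X⊑Y = ∣∁∣-telescope {X = X} {Y} (drop-∷-⊆ X⊑Y)
∣∁∣-telescope {X = true ∷ X} {false ∷ Y} X⊑Y with () ← X⊑Y {zero} here
∣∁∣-telescope {X = false ∷ X} {true ∷ Y} X⊑Y = cong suc (∣∁∣-telescope {X = X} {Y} (drop-∷-⊆ X⊑Y))
∣∁∣-telescope {X = false ∷ X} {false ∷ Y} X⊑Y =
  trans (cong suc (∣∁∣-telescope {X = X} {Y} (drop-∷-⊆ X⊑Y))) (sym (+-suc _ _))

-- The normal chains from (U , ρ), for n at least ∣ ∁ U ∣.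
normalForms : ℕ → (U : Subset d) → ℕ → List (Chain U)
stepsTo : ℕ → (U : Subset d) → ℕ → (V : Subset d) → U ⊑ V → List (Chain U)
normalForms zero U ρ = [] ∷ []
normalForms (suc n) U ρ = [] ∷ collectAbove U (stepsTo n U ρ)
stepsTo n U ρ V U⊑V =
  -- The bound `ρ + suc i` lies strictly between `ρ` and `ρ + ∣ V ─ U ∣`. For `V = U` the range is
  -- empty, so each step is proper.
  List.concatMap (λ i → List.map (step V (ρ + suc i) U⊑V) (normalForms n V (ρ + suc i)))
    (List.upTo (∣ V ─ U ∣ ∸ 1))

length-normalForms : ∀ n (U : Subset d) ρ → ∣ ∁ U ∣ ≤ n → List.length (normalForms n U ρ) ≡ ∣ ∁ U ∣ !
length-normalForms zero U ρ ∁≤0 = cong _! (sym (n≤0⇒n≡0 ∁≤0))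
length-normalForms (suc n) U ρ ∁≤n = trans
  (cong suc (length-collectAbove U (stepsTo n U ρ) λ V U⊑V → trans
    (length-concatMap _ (List.upTo (∣ V ─ U ∣ ∸ 1)) λ i i∈ → trans (Listₚ.length-map _ (normalForms n V (ρ + suc i)))
      (length-normalForms n V (ρ + suc i) (smaller V U⊑V (∈-upTo⁻ i∈))))
    (cong (_* ∣ ∁ V ∣ !) (Listₚ.length-upTo (∣ V ─ U ∣ ∸ 1)))))
  (1+subsetSum≡m! ∣ ∁ U ∣)
  where
  smaller : ∀ V {i} → U ⊑ V → i < ∣ V ─ U ∣ ∸ 1 → ∣ ∁ V ∣ ≤ n
  smaller V U⊑V i< = s≤s⁻¹ (≤-trans (+-monoˡ-≤ ∣ ∁ V ∣ (≤-trans (≤-<-trans z≤n i<) (m∸n≤m ∣ V ─ U ∣ 1)))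
    (≤-trans (≤-reflexive (sym (∣∁∣-telescope U⊑V))) ∁≤n))

normalForms-positive : ∀ n (U : Subset d) ρ → All (AllC (λ _ σ → 1 ≤ σ)) (normalForms n U ρ)
normalForms-positive zero U ρ = _ ∷ []
normalForms-positive (suc n) U ρ = _ ∷ all-collectAbove (stepsTo n U ρ) λ V U⊑V →
  Allₚ.concat⁺ (Allₚ.map⁺ (All.tabulate {xs = List.upTo (∣ V ─ U ∣ ∸ 1)} λ {i} _ → Allₚ.map⁺
    (All.map (λ positive → ≤-trans (s≤s z≤n) (m≤n+m (suc i) ρ) , positive) (normalForms-positive n V (ρ + suc i)))))

∈-normalForms : ∀ n {U : Subset d} {ρ} {c : Chain U} → Normal U ρ c → ∣ ∁ U ∣ ≤ n →
  ∃[ c′ ] c′ ∈ₗ normalForms n U ρ × (∀ I → Sat c I ⇔ Sat c′ I)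
∈-normalForms zero [] _ = [] , Any.here refl , λ I → mk⇔ id id
∈-normalForms (suc n) [] _ = [] , Any.here refl , λ I → mk⇔ id id
∈-normalForms n {U} {ρ} (step {V} {σ} {U⊑V} ρ<σ σ< normal) ∁≤n = go n ∁≤n
  where
  i = σ ∸ suc ρ
  σ≡ : ρ + suc i ≡ σ
  σ≡ = trans (+-suc ρ i) (m+[n∸m]≡n ρ<σ)
  si< : suc i < ∣ V ─ U ∣
  si< = +-cancelˡ-< ρ _ _ (subst (_< ρ + ∣ V ─ U ∣) (sym σ≡) σ<)
  go : ∀ n → ∣ ∁ U ∣ ≤ n → ∃[ c′ ] c′ ∈ₗ normalForms n U ρ × (∀ I → Sat (step V σ U⊑V _) I ⇔ Sat c′ I)
  go zero ∁≤0 = contradiction (≤-trans (≤-trans si< (m≤m+n _ _)) (≤-trans (≤-reflexive (sym (∣∁∣-telescope U⊑V))) ∁≤0)) λ ()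
  go (suc n) ∁≤n
    with ∈-normalForms n {V} {ρ + suc i} (subst (λ τ → Normal V τ _) (sym σ≡) normal)
           (s≤s⁻¹ (≤-trans (+-monoˡ-≤ ∣ ∁ V ∣ (≤-trans (s≤s z≤n) si<)) (≤-trans (≤-reflexive (sym (∣∁∣-telescope U⊑V))) ∁≤n)))
       | ∈-collectAbove (stepsTo n U ρ) U⊑V
  ... | c′ , c′∈ , equiv | U⊑V′ , ∈g = step V (ρ + suc i) U⊑V′ c′ ,
    Any.there (∈g (∈-concatMap⁺ _ (Any.map (λ { refl → ∈-map⁺ _ c′∈ }) (∈-upTo⁺ (∸-monoˡ-≤ 1 si<))))) ,
    λ I → mk⇔ (λ (I≤σ , sat) → ≤-trans I≤σ (≤-reflexive (sym σ≡)) , Equivalence.to (equiv I) sat)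
              (λ (I≤σ , sat) → ≤-trans I≤σ (≤-reflexive σ≡) , Equivalence.from (equiv I) sat)

-- Linear combinations

module Spans {m ℓ} (V : ℝ-VectorSpace m ℓ) where
  open Module V
  open LinearAlgebra V

  private
    +ᴹ-interchange : ∀ a b c e → (a +ᴹ b) +ᴹ (c +ᴹ e) ≈ᴹ (a +ᴹ c) +ᴹ (b +ᴹ e)
    +ᴹ-interchange = CommutativeSemigroupProperties.interchange
      (CommutativeMonoid.commutativeSemigroup +ᴹ-commutativeMonoid)

  InSpan : ∀ {n} → Vector Carrierᴹ n → Pred Carrierᴹ ℓ
  InSpan {n} b w = Σ[ c ∈ Vector ℝ n ] w ≈ᴹ linearCombination c b

  inSpan-resp : ∀ {n} {b : Vector Carrierᴹ n} {w w′} → w ≈ᴹ w′ → InSpan b w′ → InSpan b w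
  inSpan-resp w≈w′ (c , eq) = c , ≈ᴹ-trans w≈w′ eq

  linearCombination-zero : ∀ {n} (b : Vector Carrierᴹ n) → linearCombination (λ _ → 0ℝ) b ≈ᴹ 0ᴹ
  linearCombination-zero {zero} b = ≈ᴹ-refl
  linearCombination-zero {suc n} b = ≈ᴹ-trans
    (+ᴹ-cong (*ₗ-zeroˡ (b zero)) (linearCombination-zero (b ∘ suc))) (+ᴹ-identityˡ 0ᴹ)

  linearCombination-+ : ∀ {n} (c c′ : Vector ℝ n) (b : Vector Carrierᴹ n) →
    linearCombination (λ i → c i +ℝ c′ i) b ≈ᴹ linearCombination c b +ᴹ linearCombination c′ b
  linearCombination-+ {zero} c c′ b = ≈ᴹ-sym (+ᴹ-identityˡ 0ᴹ)
  linearCombination-+ {suc n} c c′ b = ≈ᴹ-trans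
    (+ᴹ-cong (*ₗ-distribʳ (b zero) (c zero) (c′ zero)) (linearCombination-+ (c ∘ suc) (c′ ∘ suc) (b ∘ suc)))
    (+ᴹ-interchange _ _ _ _)

  linearCombination-* : ∀ {n} k (c : Vector ℝ n) (b : Vector Carrierᴹ n) →
    linearCombination (λ i → k *ℝ c i) b ≈ᴹ k *ₗ linearCombination c b
  linearCombination-* {zero} k c b = ≈ᴹ-sym (*ₗ-zeroʳ k)
  linearCombination-* {suc n} k c b = ≈ᴹ-trans
    (+ᴹ-cong (*ₗ-assoc k (c zero) (b zero)) (linearCombination-* k (c ∘ suc) (b ∘ suc)))
    (≈ᴹ-sym (*ₗ-distribˡ k _ _))

  inSpan-0 : ∀ {n} {b : Vector Carrierᴹ n} → InSpan b 0ᴹ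
  inSpan-0 {b = b} = (λ _ → 0ℝ) , ≈ᴹ-sym (linearCombination-zero b)

  inSpan-+ : ∀ {n} {b : Vector Carrierᴹ n} {w w′} → InSpan b w → InSpan b w′ → InSpan b (w +ᴹ w′)
  inSpan-+ {b = b} (c , eq) (c′ , eq′) = (λ i → c i +ℝ c′ i) ,
    ≈ᴹ-trans (+ᴹ-cong eq eq′) (≈ᴹ-sym (linearCombination-+ c c′ b))

  inSpan-* : ∀ {n} {b : Vector Carrierᴹ n} k {w} → InSpan b w → InSpan b (k *ₗ w)
  inSpan-* {b = b} k (c , eq) = (λ i → k *ℝ c i) ,
    ≈ᴹ-trans (*ₗ-congˡ eq) (≈ᴹ-sym (linearCombination-* k c b))

  inSpan-weaken : ∀ {n} {b : Vector Carrierᴹ (suc n)} {w} → InSpan (b ∘ suc) w → InSpan b w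
  inSpan-weaken {b = b} (c , eq) = (λ { zero → 0ℝ ; (suc i) → c i }) ,
    ≈ᴹ-trans eq (≈ᴹ-trans (≈ᴹ-sym (+ᴹ-identityˡ _)) (+ᴹ-congʳ (≈ᴹ-sym (*ₗ-zeroˡ (b zero)))))

  inSpan-member : ∀ {n} (b : Vector Carrierᴹ n) i → InSpan b (b i)
  inSpan-member b zero = (λ { zero → 1ℝ ; (suc i) → 0ℝ }) , ≈ᴹ-trans (≈ᴹ-sym (+ᴹ-identityʳ (b zero)))
    (+ᴹ-cong (≈ᴹ-sym (*ₗ-identityˡ (b zero))) (≈ᴹ-sym (linearCombination-zero (b ∘ suc))))
  inSpan-member b (suc i) = inSpan-weaken {b = b} (inSpan-member (b ∘ suc) i)

  inSpan-trans : ∀ {n k} {b : Vector Carrierᴹ n} {b′ : Vector Carrierᴹ k} →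
    (∀ i → InSpan b′ (b i)) → ∀ {w} → InSpan b w → InSpan b′ w
  inSpan-trans {b = b} {b′} b⊆b′ (c , eq) = inSpan-resp eq (go c b b⊆b′)
    where
    go : ∀ {n} (c : Vector ℝ n) b → (∀ i → InSpan b′ (b i)) → InSpan b′ (linearCombination c b)
    go {zero} c b b⊆b′ = inSpan-0
    go {suc n} c b b⊆b′ = inSpan-+ (inSpan-* (c zero) (b⊆b′ zero)) (go (c ∘ suc) (b ∘ suc) (b⊆b′ ∘ suc))

-- Rational series and Gaussian elimination

pointwise-≈ : {x y : ℝ} → (∀ n → seq x n ≡ seq y n) → x ≈ℝ y
pointwise-≈ {x} {y} eq = mk≈ λ ε 0<ε → 0 , λ n _ →
  subst (ℚ._< ε) (cong ℚ.∣_∣ (trans (sym (ℚₚ.+-inverseʳ (seq y n))) (cong (ℚ._- seq y n) (sym (eq n))))) 0<ε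

ι : {A : Set} → (A → ℚ) → A → ℝ
ι w f = fromℚ (w f)

fromℚ-cong : ∀ {p q} → p ≡ q → fromℚ p ≈ℝ fromℚ q
fromℚ-cong eq = pointwise-≈ λ _ → eq

fromℚ-+ : ∀ p q → fromℚ (p ℚ.+ q) ≈ℝ fromℚ p +ℝ fromℚ q
fromℚ-+ p q = pointwise-≈ λ _ → refl

fromℚ-* : ∀ p q → fromℚ (p ℚ.* q) ≈ℝ fromℚ p *ℝ fromℚ q
fromℚ-* p q = pointwise-≈ λ _ → refl

module ℝₚ = CommutativeRing ℝ-commutativeRing

module Elimination (d : ℕ) where
  open Spans (FormalSeries d)
  open LinearAlgebra (FormalSeries d)

  RationalSeries : Set
  RationalSeries = Word d → ℚ

  LinearlyClosed : ∀ {ℓ} → Pred RationalSeries ℓ → Set ℓ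
  LinearlyClosed P = ∀ p q {w w′} → P w → P w′ → P (λ f → p ℚ.* w f ℚ.+ q ℚ.* w′ f)

  real : (bs : List RationalSeries) → Vector (Word d → ℝ) (List.length bs)
  real bs i = ι (List.lookup bs i)

  inSpan-closed : ∀ {n} {b : Vector (Word d → ℝ) n} → LinearlyClosed (InSpan b ∘ ι)
  inSpan-closed p q {w} {w′} sw sw′ = inSpan-resp
    (λ f → ℝₚ.trans (fromℚ-+ (p ℚ.* w f) (q ℚ.* w′ f)) (ℝₚ.+-cong (fromℚ-* p (w f)) (fromℚ-* q (w′ f))))
    (inSpan-+ (inSpan-* (fromℚ p) sw) (inSpan-* (fromℚ q) sw′))

  inSpan-≗ : ∀ {n} {b : Vector (Word d → ℝ) n} {w w′ : RationalSeries} →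
    (∀ f → w f ≡ w′ f) → InSpan b (ι w′) → InSpan b (ι w)
  inSpan-≗ eq = inSpan-resp λ f → fromℚ-cong (eq f)

  -- Only later series must vanish at a pivot. This suffices to read off coefficients from the front
  -- and spares back substitution.
  data Echelon : List RationalSeries → Set where
    []    : Echelon []
    pivot : ∀ {b bs} g → b g ≡ 1ℚ → All (λ w → w g ≡ 0ℚ) bs → Echelon bs → Echelon (b ∷ bs)

  echelon-independent : ∀ {bs} → Echelon bs → LinearlyIndependent (real bs)
  echelon-independent [] c _ ()
  echelon-independent {b ∷ bs} (pivot g bg≡1 vanish ech) c c·b≈0 = coefficients
    where
    rest-vanishes : ∀ {bs} → All (λ w → w g ≡ 0ℚ) bs → ∀ c → linearCombination c (real bs) g ≈ℝ 0ℝ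
    rest-vanishes [] c = ℝₚ.refl
    rest-vanishes (eq ∷ eqs) c = ℝₚ.trans
      (ℝₚ.+-cong (ℝₚ.trans (ℝₚ.*-congˡ (fromℚ-cong eq)) (ℝₚ.zeroʳ (c zero))) (rest-vanishes eqs (c ∘ suc)))
      (ℝₚ.+-identityˡ 0ℝ)
    c₀≈0 : c zero ≈ℝ 0ℝ
    c₀≈0 = ℝₚ.trans (ℝₚ.sym (ℝₚ.trans
      (ℝₚ.+-cong (ℝₚ.trans (ℝₚ.*-congˡ (fromℚ-cong bg≡1)) (ℝₚ.*-identityʳ (c zero))) (rest-vanishes vanish (c ∘ suc)))
      (ℝₚ.+-identityʳ (c zero)))) (c·b≈0 g)
    coefficients : ∀ i → c i ≈ℝ 0ℝ
    coefficients zero = c₀≈0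
    coefficients (suc i) = echelon-independent ech (c ∘ suc) (λ f → ℝₚ.trans (ℝₚ.sym (ℝₚ.trans
      (ℝₚ.+-congʳ (ℝₚ.trans (ℝₚ.*-congʳ c₀≈0) (ℝₚ.zeroˡ (ι b f)))) (ℝₚ.+-identityˡ _))) (c·b≈0 f)) i

  module _ (tests : List (Word d)) where

    -- A series has infinitely many coefficients; finitely many test words make it decidable whether
    -- it is zero and locate a pivot if it is not.
    DetectedBy : RationalSeries → Set
    DetectedBy w = All (λ t → w t ≡ 0ℚ) tests → ∀ f → w f ≡ 0ℚ

    record Inserted {ℓ} (P : Pred RationalSeries ℓ) (w : RationalSeries) (bs : List RationalSeries) : Set ℓ where
      field
        series  : List RationalSeries
        echelon : Echelon series
        all     : All P series
        bounded : List.length series ≤ suc (List.length bs)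
        spans   : InSpan (real series) (ι w)
        spans-bs : All (InSpan (real series) ∘ ι) bs

    -- `P` is arbitrary so that the recursion can strengthen it by vanishing at the pivot just
    -- passed; all series produced further down then respect that pivot.
    insert : ∀ {ℓ} {P : Pred RationalSeries ℓ} → LinearlyClosed P → (∀ {w} → P w → DetectedBy w) →
      ∀ {w bs} → P w → All P bs → Echelon bs → Inserted P w bs
    insert {P = P} closed detected {w} Pw [] [] with All.all? (λ t → w t ℚₚ.≟ 0ℚ) tests
    ... | yes w≡0 = record
      { series = [] ; echelon = [] ; all = [] ; bounded = z≤n
      ; spans = inSpan-resp {b = real []} (λ f → fromℚ-cong (detected Pw w≡0 f)) (inSpan-0 {b = real []}) ; spans-bs = [] }
    ... | no w≢0 with Any.satisfied (Allₚ.¬All⇒Any¬ (λ t → w t ℚₚ.≟ 0ℚ) tests w≢0)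
    ...   | g , wg≢0 = record
      { series = b ∷ [] ; echelon = pivot g bg≡1 [] [] ; all = closed (ℚ.1/ w g) 0ℚ Pw Pw ∷ [] ; bounded = ≤-refl
      ; spans = inSpan-≗ {b = real (b ∷ [])} w≡ (inSpan-closed {b = real (b ∷ [])} (w g) 0ℚ {b} {b} (inSpan-member (real (b ∷ [])) zero) (inSpan-member (real (b ∷ [])) zero))
      ; spans-bs = [] }
      where
      instance
        wg-nonZero : ℚ.NonZero (w g)
        wg-nonZero = ℚ.≢-nonZero wg≢0
      b : RationalSeries
      -- The zero summand gives a mere rescaling the binary form that `LinearlyClosed` accepts.
      b f = ℚ.1/ w g ℚ.* w f ℚ.+ 0ℚ ℚ.* w f
      b≡ : ∀ f → b f ≡ ℚ.1/ w g ℚ.* w f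
      b≡ f = trans (cong (ℚ.1/ w g ℚ.* w f ℚ.+_) (ℚₚ.*-zeroˡ (w f))) (ℚₚ.+-identityʳ _)
      bg≡1 : b g ≡ 1ℚ
      bg≡1 = trans (b≡ g) (ℚₚ.*-inverseˡ (w g))
      w≡ : ∀ f → w f ≡ w g ℚ.* b f ℚ.+ 0ℚ ℚ.* b f
      w≡ f = sym (begin
        w g ℚ.* b f ℚ.+ 0ℚ ℚ.* b f       ≡⟨ cong (w g ℚ.* b f ℚ.+_) (ℚₚ.*-zeroˡ (b f)) ⟩
        w g ℚ.* b f ℚ.+ 0ℚ               ≡⟨ ℚₚ.+-identityʳ _ ⟩
        w g ℚ.* b f                      ≡⟨ cong (w g ℚ.*_) (b≡ f) ⟩
        w g ℚ.* (ℚ.1/ w g ℚ.* w f)       ≡⟨ ℚₚ.*-assoc (w g) (ℚ.1/ w g) (w f) ⟨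
        w g ℚ.* ℚ.1/ w g ℚ.* w f         ≡⟨ cong (ℚ._* w f) (ℚₚ.*-inverseʳ (w g)) ⟩
        1ℚ ℚ.* w f                       ≡⟨ ℚₚ.*-identityˡ (w f) ⟩
        w f                              ∎)
        where open ≡-Reasoning
    insert {P = P} closed detected {w} {b ∷ bs} Pw (Pb ∷ Pbs) (pivot g bg≡1 vanish ech) = record
      { series = b ∷ series
      ; echelon = pivot g bg≡1 (All.map proj₂ all) echelon
      ; all = Pb ∷ All.map proj₁ all
      ; bounded = s≤s bounded
      ; spans = inSpan-≗ {b = real (b ∷ series)} w≡ (inSpan-closed {b = real (b ∷ series)} 1ℚ (w g) {w₁} {b} (inSpan-weaken {b = real (b ∷ series)} spans) (inSpan-member (real (b ∷ series)) zero))
      ; spans-bs = inSpan-member (real (b ∷ series)) zero ∷ All.map (inSpan-weaken {b = real (b ∷ series)}) spans-bs }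
      where
      -- `b` is 1 at `g`, so subtracting `w g` times `b` clears `w` there.
      w₁ : RationalSeries
      w₁ f = 1ℚ ℚ.* w f ℚ.+ (ℚ.- w g) ℚ.* b f
      w≡ : ∀ f → w f ≡ 1ℚ ℚ.* w₁ f ℚ.+ w g ℚ.* b f
      w≡ f = solve 3 (λ w k b → w := con 1ℚ :* (con 1ℚ :* w :+ (:- k) :* b) :+ k :* b) refl (w f) (w g) (b f)
      w₁g≡0 : w₁ g ≡ 0ℚ
      w₁g≡0 = trans (cong (λ e → 1ℚ ℚ.* w g ℚ.+ (ℚ.- w g) ℚ.* e) bg≡1)
        (solve 1 (λ w → con 1ℚ :* w :+ (:- w) :* con 1ℚ := con 0ℚ) refl (w g))
      closed′ : LinearlyClosed (λ w → P w × w g ≡ 0ℚ)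
      closed′ p q (Pw , wg) (Pw′ , w′g) = closed p q Pw Pw′ ,
        trans (cong₂ (λ x y → p ℚ.* x ℚ.+ q ℚ.* y) wg w′g)
          (solve 2 (λ p q → p :* con 0ℚ :+ q :* con 0ℚ := con 0ℚ) refl p q)
      open Inserted (insert {P = λ w → P w × w g ≡ 0ℚ} closed′ (detected ∘ proj₁)
        (closed 1ℚ (ℚ.- w g) Pw Pb , w₁g≡0) (All.zip (Pbs , vanish)) ech)

    record Eliminated {ℓ} (P : Pred RationalSeries ℓ) (ws : List RationalSeries) : Set ℓ where
      field
        series  : List RationalSeries
        echelon : Echelon series
        all     : All P series
        bounded : List.length series ≤ List.length ws
        spans   : All (InSpan (real series) ∘ ι) ws

    eliminate : ∀ {ℓ} {P : Pred RationalSeries ℓ} → LinearlyClosed P → (∀ {w} → P w → DetectedBy w) →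
      ∀ {ws} → All P ws → Eliminated P ws
    eliminate closed detected [] = record
      { series = [] ; echelon = [] ; all = [] ; bounded = z≤n ; spans = [] }
    eliminate closed detected (Pw ∷ Pws) = record
      { series = I.series ; echelon = I.echelon ; all = I.all
      ; bounded = ≤-trans I.bounded (s≤s E.bounded)
      ; spans = I.spans ∷ All.map (inSpan-trans λ i → All.lookup I.spans-bs (∈-lookup i)) E.spans }
      where
      module E = Eliminated (eliminate closed detected Pws)
      module I = Inserted (insert closed detected Pw E.all E.echelon)

-- The image of Ψ

genericIndicator : Matroid d → Word d → ℚ
genericIndicator M f = ⟦ generic? M f ⟧

generic-resp : (M N : Matroid d) (f : Word d) → (∀ B → IsBasis M B ⇔ IsBasis N B) → Generic M f → Generic N f
generic-resp M N f M≈N (B , max , unique) = B , to-max max , λ maxN → unique (from-max maxN)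
  where
  module M≈N B = Equivalence (M≈N B)
  to-max : ∀ {B} → Maximizing M f B → Maximizing N f B
  to-max {B} (bB , max) = M≈N.to B bB , λ A bA → max A (M≈N.from A bA)
  from-max : ∀ {B} → Maximizing N f B → Maximizing M f B
  from-max {B} (bB , max) = M≈N.from B bB , λ A bA → max A (M≈N.to A bA)

laminar-cong : (c c′ : Chain {d} ⊥) → (∀ I → Sat c I ⇔ Sat c′ I) →
  ∀ f → genericIndicator (laminar c) f ≡ genericIndicator (laminar c′) f
laminar-cong c c′ equiv f = ⟦⟧-cong (generic? (laminar c) f) (generic? (laminar c′) f)
  (generic-resp (laminar c) (laminar c′) f bases⇔)
  (generic-resp (laminar c′) (laminar c) f λ B → mk⇔ (Equivalence.from (bases⇔ B)) (Equivalence.to (bases⇔ B)))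
  where
  module E I = Equivalence (equiv I)
  bases⇔ : ∀ B → IsBasis (laminar c) B ⇔ IsBasis (laminar c′) B
  bases⇔ B = mk⇔
    (λ (sat , max) → E.to B sat , λ A satA → max A (E.from A satA))
    (λ (sat , max) → E.from B sat , λ A satA → max A (E.to A satA))

-- The shape of the chains visited by `chainSum r`, apart from their end at `⊤`.
Ranked : (Subset d → ℕ) → Chain {d} X → Set
Ranked r [] = Unit.⊤
Ranked {X = X} r (step Y σ _ c) = X ⊏ Y × σ ≡ r Y × Ranked r c

ranked-growing : (M : Matroid d) (c : Chain {d} X) → Ranked (rank M) c → Growing X (rank M X) c
ranked-growing M [] _ = _
ranked-growing {X = X} M (step Y _ X⊑Y c) (_ , refl , ranked) =
  X⊑Y , rank-mono M X⊑Y , rank≤rank+∣─∣ M X Y , ranked-growing M c ranked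

ranked-positive : (M : Matroid d) → Loopless M → (c : Chain {d} X) → Ranked (rank M) c → AllC (λ _ σ → 1 ≤ σ) c
ranked-positive M loopless [] _ = _
ranked-positive M loopless (step Y _ _ c) ((_ , x , x∈Y , _) , refl , ranked) =
  rank-positive M loopless x∈Y , ranked-positive M loopless c ranked

sign-square : ∀ n → sign n ℚ.* sign n ≡ 1ℚ
sign-square zero = refl
sign-square (suc n) = trans (solve 1 (λ s → (:- s) :* (:- s) := s :* s) refl (sign n)) (sign-square n)

module Image (d : ℕ) where
  open Spans (FormalSeries d)
  open LinearAlgebra (FormalSeries d)
  open Elimination d
  open Free (matroidSetoid d)
  private module V = Module (FormalSeries d)

  module _ {n} {b : Vector (Word d → ℝ) n} where

    inSpan-∑ : ∀ {e} (g : Subset e → RationalSeries) → (∀ Y → InSpan b (ι (g Y))) →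
      InSpan b (ι λ f → ∑ λ Y → g Y f)
    inSpan-∑ {zero} g sg = sg []
    inSpan-∑ {suc e} g sg = inSpan-≗ {b = b}
      (λ f → sym (cong₂ ℚ._+_ (ℚₚ.*-identityˡ (∑ λ Y → g (false ∷ Y) f)) (ℚₚ.*-identityˡ (∑ λ Y → g (true ∷ Y) f))))
      (inSpan-closed {b = b} 1ℚ 1ℚ (inSpan-∑ (g ∘ (false ∷_)) (sg ∘ (false ∷_)))
                                   (inSpan-∑ (g ∘ (true ∷_)) (sg ∘ (true ∷_))))

    -- The hypothesis is restricted to ranked chains because only for them are growth and positivity
    -- of the bounds known, and normalisation depends on both.
    inSpan-chainSum : ∀ (r : Subset d → ℕ) k X (F : Chain X → RationalSeries) →
      (∀ c → Ranked r c → InSpan b (ι (F c))) → InSpan b (ι λ f → chainSum r k X λ c → F c f)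
    inSpan-chainTerm : ∀ (r : Subset d → ℕ) k X Y X⊂?Y (F : Chain X → RationalSeries) →
      (∀ c → Ranked r c → InSpan b (ι (F c))) → InSpan b (ι λ f → chainTerm r k X Y X⊂?Y λ c → F c f)
    inSpan-chainSum r zero X F sF = inSpan-0
    inSpan-chainSum r (suc k) X F sF = inSpan-≗ {b = b}
      (λ f → cong (⟦ Vecₚ.≡-dec Boolₚ._≟_ X ⊤ ⟧ ℚ.* F [] f ℚ.+_) (neg≡-1* _))
      (inSpan-closed {b = b} ⟦ Vecₚ.≡-dec Boolₚ._≟_ X ⊤ ⟧ (ℚ.- 1ℚ) (sF [] _)
        (inSpan-∑ (λ Y f → chainTerm r k X Y (X ⊂? Y) λ c → F c f)
          λ Y → inSpan-chainTerm r k X Y (X ⊂? Y) F sF))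
    inSpan-chainTerm r k X Y (yes X⊏Y) F sF =
      inSpan-chainSum r k Y _ λ c ranked → sF _ (X⊏Y , refl , ranked)
    inSpan-chainTerm r k X Y (no _) F sF = inSpan-0

  generators : List RationalSeries
  generators = List.map (genericIndicator ∘ laminar) (normalForms d ⊥ 0)

  length-generators : List.length generators ≡ d !
  length-generators = trans (Listₚ.length-map _ (normalForms d ⊥ 0))
    (trans (length-normalForms d ⊥ 0 (∣p∣≤n (∁ ⊥))) (cong _! (trans (∣∁p∣≡n∸∣p∣ (⊥ {d})) (cong (d ∸_) (∣⊥∣≡0 d)))))

  ranked-inSpan : (M : Matroid d) → Loopless M → (c : Chain ⊥) → Ranked (rank M) c →
    InSpan (real generators) (ι (genericIndicator (laminar c)))
  ranked-inSpan M loopless c ranked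
    with normalise c (subst (λ ρ → Growing ⊥ ρ c) r⊥≡0 (ranked-growing M c ranked)) (ranked-positive M loopless c ranked)
    where
    r⊥≡0 : rank M ⊥ ≡ 0
    r⊥≡0 = n≤0⇒n≡0 (≤-trans (rank≤∣S∣ M ⊥) (≤-reflexive (∣⊥∣≡0 d)))
  ... | c′ , normal , equiv with ∈-normalForms d normal (∣p∣≤n (∁ ⊥))
  ... | c″ , c″∈ , equiv′ = inSpan-≗ {b = real generators}
    (λ f → trans (laminar-cong c c′ equiv f) (laminar-cong c′ c″ equiv′ f))
    (member (∈-map⁺ (genericIndicator ∘ laminar) c″∈))
    where
    member : ∀ {ws w} → w ∈ₗ ws → InSpan (real ws) (ι w)
    member {_ ∷ ws} (Any.here refl) = inSpan-member (real (_ ∷ ws)) zero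
    member {w′ ∷ ws} (Any.there w∈) = inSpan-weaken {b = real (w′ ∷ ws)} (member w∈)

  generic-inSpan : (M : Matroid d) → InSpan (real generators) (ι (genericIndicator M))
  generic-inSpan M = inSpan-≗ {b = real generators} indicator≡
    (inSpan-closed {b = real generators} (sign d) 0ℚ chains chains)
    where
    M′ = loops⇒coloops M
    S : RationalSeries
    S f = chainSum (rank M′) (suc d) ⊥ λ c → genericIndicator (laminar c) f
    chains : InSpan (real generators) (ι S)
    chains = inSpan-chainSum (rank M′) (suc d) ⊥ (genericIndicator ∘ laminar)
      (ranked-inSpan M′ (loops⇒coloops-loopless M))
    -- The sign is its own inverse, so multiplying by it once more solves the alternating sum for
    -- `M′`.
    indicator≡ : ∀ f → genericIndicator M f ≡ sign d ℚ.* S f ℚ.+ 0ℚ ℚ.* S f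
    indicator≡ f = begin
      genericIndicator M f                                   ≡⟨ ⟦⟧-cong (generic? M f) (generic? M′ f) (generic-loops⇒coloops M f) (generic-coloops⇒loops M f) ⟩
      genericIndicator M′ f                                  ≡⟨ ℚₚ.*-identityˡ _ ⟨
      1ℚ ℚ.* genericIndicator M′ f                           ≡⟨ cong (ℚ._* genericIndicator M′ f) (sign-square d) ⟨
      sign d ℚ.* sign d ℚ.* genericIndicator M′ f            ≡⟨ ℚₚ.*-assoc (sign d) (sign d) _ ⟩
      sign d ℚ.* (sign d ℚ.* genericIndicator M′ f)          ≡⟨ cong (sign d ℚ.*_) (chainSum-generic M′ f) ⟨
      sign d ℚ.* S f                                         ≡⟨ ℚₚ.+-identityʳ _ ⟨
      sign d ℚ.* S f ℚ.+ 0ℚ                                  ≡⟨ cong (sign d ℚ.* S f ℚ.+_) (ℚₚ.*-zeroˡ (S f)) ⟨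
      sign d ℚ.* S f ℚ.+ 0ℚ ℚ.* S f                          ∎
      where open ≡-Reasoning

  genericSeries≈ : (M : Matroid d) → genericSeries M V.≈ᴹ ι (genericIndicator M)
  genericSeries≈ M f with does (generic? M f)
  ... | true = ℝₚ.refl
  ... | false = ℝₚ.refl

  imΨ-inSpan : ∀ {w} → imΨ d w → InSpan (real generators) w
  imΨ-inSpan (x , eq) = inSpan-resp eq (go x)
    where
    go : ∀ x → InSpan (real generators) (Ψ x)
    go (gen M) = inSpan-resp (genericSeries≈ M) (generic-inSpan M)
    go 𝟎 = inSpan-0
    go (x ⊕ y) = inSpan-+ (go x) (go y)
    go (k ⊙ x) = inSpan-* k (go x)

  generators-nested : All (LooplessNestedSeries d ∘ ι) generators
  generators-nested = Allₚ.map⁺ (All.map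
    (λ {c} positive → laminar c , laminar-loopless c positive , (λ {F} {G} → laminar-nested c {F} {G}) , V.≈ᴹ-sym (genericSeries≈ (laminar c)))
    (normalForms-positive d ⊥ 0))

  imΨ⊆span : imΨ d ⊆ span (LooplessNestedSeries d)
  imΨ⊆span im = let (c , eq) = imΨ-inSpan im in
    _ , c , real generators , (λ i → All.lookup generators-nested (∈-lookup i)) , eq

  imΨ-linearCombination : ∀ {n} (c : Vector ℝ n) (u : Vector (Word d → ℝ) n) →
    (∀ i → imΨ d (u i)) → imΨ d (linearCombination c u)
  imΨ-linearCombination {zero} c u im = 𝟎 , V.≈ᴹ-refl
  imΨ-linearCombination {suc n} c u im =
    let (x , eq) = im zero
        (y , eq′) = imΨ-linearCombination (c ∘ suc) (u ∘ suc) (im ∘ suc) in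
    c zero ⊙ x ⊕ y , V.+ᴹ-cong (V.*ₗ-congˡ eq) eq′

  span⊆imΨ : span (LooplessNestedSeries d) ⊆ imΨ d
  span⊆imΨ (n , c , u , members , v≈) =
    let (x , eq) = imΨ-linearCombination c u (λ i → let (N , _ , _ , eq) = members i in gen N , eq) in
    x , V.≈ᴹ-trans v≈ eq

  imΨ⊆WQSym : imΨ d ⊆ WQSym d
  imΨ⊆WQSym {w} (x , eq) f g same = ℝₚ.trans (eq f) (ℝₚ.trans (go x) (ℝₚ.sym (eq g)))
    where
    f≼g = setComposition⇒≼ f g same
    g≼f = setComposition⇒≼ g f (sym same)
    go : ∀ x → Ψ x f ≈ℝ Ψ x g
    go (gen M) = ℝₚ.reflexive (cong (if_then 1ℝ else 0ℝ)
      (does-⇔ (mk⇔ (generic-≼ M {f} {g} f≼g g≼f) (generic-≼ M {g} {f} g≼f f≼g)) (generic? M f) (generic? M g)))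
    go 𝟎 = ℝₚ.refl
    go (x ⊕ y) = ℝₚ.+-cong (go x) (go y)
    go (k ⊙ x) = ℝₚ.*-congˡ (go x)

  private
    -- What elimination must preserve: invariance under `pack` makes the packed words sufficient
    -- tests, and membership in the image makes the resulting series admissible as basis vectors.
    Candidate : Pred RationalSeries _
    Candidate w = (∀ f → w f ≡ w (pack f)) × imΨ d (ι w)

    candidate-closed : LinearlyClosed Candidate
    candidate-closed p q {w} {w′} (packed , x , eq) (packed′ , x′ , eq′) =
      (λ f → cong₂ (λ a b → p ℚ.* a ℚ.+ q ℚ.* b) (packed f) (packed′ f)) ,
      fromℚ p ⊙ x ⊕ fromℚ q ⊙ x′ , λ f → ℝₚ.trans (fromℚ-+ (p ℚ.* w f) (q ℚ.* w′ f))
        (ℝₚ.+-cong (ℝₚ.trans (fromℚ-* p (w f)) (ℝₚ.*-congˡ (eq f))) (ℝₚ.trans (fromℚ-* q (w′ f)) (ℝₚ.*-congˡ (eq′ f))))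

    candidate-detected : ∀ {w} → Candidate w → DetectedBy (words d d) w
    candidate-detected (packed , _) vanish f = trans (packed f) (All.lookup vanish (pack∈words f))

    generators-candidates : All Candidate generators
    generators-candidates = Allₚ.map⁺ (All.tabulate {xs = normalForms d ⊥ 0} λ {c} _ →
      (λ f → ⟦⟧-cong (generic? (laminar c) f) (generic? (laminar c) (pack f))
        (generic-≼ (laminar c) {f} {pack f} (≼-pack f) (pack-≼ f))
        (generic-≼ (laminar c) {pack f} {f} (pack-≼ f) (≼-pack f))) ,
      gen (laminar c) , V.≈ᴹ-sym (genericSeries≈ (laminar c)))

    module E = Eliminated (eliminate (words d d) candidate-closed candidate-detected generators-candidates)

  dimension : ∃[ k ] HasDimension (imΨ d) k × k ≤ d !
  dimension = List.length E.series , (real E.series , record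
      { members = λ i → proj₂ (All.lookup E.all (∈-lookup i))
      ; independent = echelon-independent E.echelon
      ; spanning = λ im → inSpan-trans (λ i → All.lookup E.spans (∈-lookup i)) (imΨ-inSpan im)
      }) ,
    ≤-trans E.bounded (≤-reflexive length-generators)

corollary4p8 : (d : ℕ) →
    let open LinearAlgebra (FormalSeries d) in
    imΨ d ⊆ WQSym d ×
    imΨ d ≐ span (LooplessNestedSeries d) ×
    (∃[ k ] HasDimension (imΨ d) k × k ≤ d !)
corollary4p8 d = imΨ⊆WQSym , (imΨ⊆span , span⊆imΨ) , dimension
  where open Image d
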